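{- Let $(W,S)$ be a finite Coxeter system and let $I,J\subseteq S$ with $|I|=|J|=|S|-1$. Let $H$ be a graph isomorphic to the $(I,J;W,S)$-graph (a generalised face-incidence graph), and let $t$ be the number of vertices in the larger part of its bipartition. Then $\mathrm{ex}(n,H)=O(n^{2-c})$ as $n\to\infty$, where $c=\frac{v(H)-t-1}{e(H)-t}$.
   Context: A (finite) Coxeter system $(W,S)$ consists of a finite group $W$ and a finite generating set $S=\{s_1,\dots,s_m\}$ such that $W$ has presentation $\langle s_1,\dots,s_m \mid (s_is_j)^{m_{ij}}=1\rangle$ with $m_{ii}=1$ and $m_{ij}=m_{ji}\ge 2$ integers for $i\ne j$. For $I\subseteq S$, $W_I$ denotes the subgroup of $W$ generated by $I$ (a parabolic subgroup) and $W/W_I$ the set of left cosets of $W_I$. For $I,J\subseteq S$, the $(I,J;W,S)$-graph is the bipartite graph with parts $W/W_I$ and $W/W_J$ in which $wW_I$ and $wW_J$ are adjacent for every $w\in W$ (i.e., two cosets are adjacent iff they intersect). A generalised face-incidence graph is a graph isomorphic to an $(I,J;W,S)$-graph with $|I|=|J|=|S|-1$. $\mathrm{ex}(n,H)$ is the largest number of edges in an $n$-vertex graph containing no subgraph isomorphic to $H$; $v(H),e(H)$ are the numbers of vertices and edges of $H$. -}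

module Defs where

open import Level using (0ℓ)
open import Algebra.Bundles using (Group)
open import Data.Nat using (ℕ; zero; suc; _<ᵇ_; _⊔_)
open import Data.Bool using (Bool; true; false; if_then_else_; _∧_; not)
open import Data.Fin using (Fin; toℕ)
open import Data.Fin.Subset using (Subset; _∈_)
open import Data.List using (List; []; _∷_; map; allFin)
open import Data.Nat.ListAction using (sum)
open import Data.List.Relation.Unary.All using (All)
open import Data.Product using (Σ; _×_; proj₁)
open import Data.Sum using (_⊎_; inj₁; inj₂)
open import Data.Empty using (⊥)
open import Relation.Binary.PropositionalEquality using (_≡_; _≢_)
open import Data.Nat using (_≤_)

-- Finite groups: a group whose underlying set is Fin N (every finite
-- group is isomorphic to one of these).

record FinGroup (N : ℕ) : Set where
  infixl 7 _·_
  field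
    _·_ : Fin N → Fin N → Fin N
    e   : Fin N
    inv : Fin N → Fin N
    assoc : ∀ x y z → (x · y) · z ≡ x · (y · z)
    identityˡ : ∀ x → e · x ≡ x
    identityʳ : ∀ x → x · e ≡ x
    inverseˡ : ∀ x → inv x · x ≡ e
    inverseʳ : ∀ x → x · inv x ≡ e

module _ {N : ℕ} (G : FinGroup N) where
  open FinGroup G

  pow : Fin N → ℕ → Fin N
  pow x zero    = e
  pow x (suc k) = x · pow x k

  evalWord : {m : ℕ} → (Fin m → Fin N) → List (Fin m × Bool) → Fin N
  evalWord s []               = e
  evalWord s ((i Data.Product., b) ∷ w) = (if b then inv (s i) else s i) · evalWord s w

  InParabolic : {m : ℕ} → (Fin m → Fin N) → Subset m → Fin N → Set
  InParabolic {m} s I x =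
    Σ (List (Fin m × Bool)) λ w → All (λ l → proj₁ l ∈ I) w × evalWord s w ≡ x

  InGenerated : {m : ℕ} → (Fin m → Fin N) → Fin N → Set
  InGenerated {m} s x = Σ (List (Fin m × Bool)) λ w → evalWord s w ≡ x

powG : (G : Group 0ℓ 0ℓ) → Group.Carrier G → ℕ → Group.Carrier G
powG G x zero    = Group.ε G
powG G x (suc k) = Group._∙_ G x (powG G x k)

-- (W,S) is a finite Coxeter system: W = G (on Fin N), S = {s_1..s_m}
-- (s injective), Coxeter matrix M, and W has the presentation
-- < s_1..s_m | (s_i s_j)^{M i j} = 1 >, expressed by: S generates W,
-- the relations hold, and the universal property of the presentation.

record IsCoxeterSystem {N m : ℕ} (G : FinGroup N) (s : Fin m → Fin N)
                       (M : Fin m → Fin m → ℕ) : Set₁ where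
  open FinGroup G
  field
    M-diag : ∀ i → M i i ≡ 1
    M-sym  : ∀ i j → M i j ≡ M j i
    M-off  : ∀ i j → i ≢ j → 2 ≤ M i j
    s-inj  : ∀ i j → s i ≡ s j → i ≡ j
    generates : ∀ x → InGenerated G s x
    relations : ∀ i j → pow G (s i · s j) (M i j) ≡ e
    universal : (K : Group 0ℓ 0ℓ) (g : Fin m → Group.Carrier K) →
      (∀ i j → Group._≈_ K (powG K (Group._∙_ K (g i) (g j)) (M i j)) (Group.ε K)) →
      Σ (Fin N → Group.Carrier K) λ φ →
        (∀ x y → Group._≈_ K (φ (x · y)) (Group._∙_ K (φ x) (φ y))) ×
        (∀ i → Group._≈_ K (φ (s i)) (g i))

record Graph (n : ℕ) : Set where
  field
    adj    : Fin n → Fin n → Bool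
    sym    : ∀ a b → adj a b ≡ adj b a
    irrefl : ∀ a → adj a a ≡ false
open Graph public

countF : {n : ℕ} → (Fin n → Bool) → ℕ
countF {n} p = sum (map (λ b → if p b then 1 else 0) (allFin n))

edges : {n : ℕ} → Graph n → ℕ
edges {n} G = sum (map (λ a → countF (λ b → (toℕ a <ᵇ toℕ b) ∧ adj G a b)) (allFin n))

ContainsSub : {n v : ℕ} → Graph n → Graph v → Set
ContainsSub {n} {v} G H =
  Σ (Fin v → Fin n) λ φ →
    (∀ a b → φ a ≡ φ b → a ≡ b) ×
    (∀ a b → adj H a b ≡ true → adj G (φ a) (φ b) ≡ true)

-- The (I,J;W,S)-graph.  Vertices: left cosets wW_I (tagged inj₁) and
-- wW_J (tagged inj₂), represented by elements w, up to the relation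
-- "same coset".  wW_I and w'W_J adjacent iff they intersect.

module _ {N m : ℕ} (G : FinGroup N) (s : Fin m → Fin N) (I J : Subset m) where
  open FinGroup G

  SameCoset : Subset m → Fin N → Fin N → Set
  SameCoset K x y = InParabolic G s K (inv x · y)

  CosetRel : Fin N ⊎ Fin N → Fin N ⊎ Fin N → Set
  CosetRel (inj₁ x) (inj₁ y) = SameCoset I x y
  CosetRel (inj₂ x) (inj₂ y) = SameCoset J x y
  CosetRel _        _        = ⊥

  CosetAdj : Fin N ⊎ Fin N → Fin N ⊎ Fin N → Set
  CosetAdj (inj₁ x) (inj₂ y) = Σ (Fin N) λ u → SameCoset I x u × SameCoset J y u
  CosetAdj (inj₂ y) (inj₁ x) = Σ (Fin N) λ u → SameCoset I x u × SameCoset J y u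
  CosetAdj _        _        = ⊥

  record CosetGraphIso {v : ℕ} (H : Graph v) : Set where
    field
      to   : Fin v → Fin N ⊎ Fin N
      from : Fin N ⊎ Fin N → Fin v
      from-resp : ∀ x y → CosetRel x y → from x ≡ from y
      from-to   : ∀ a → from (to a) ≡ a
      to-from   : ∀ x → CosetRel (to (from x)) x
      adj-to    : ∀ a b → adj H a b ≡ true → CosetAdj (to a) (to b)
      adj-from  : ∀ a b → CosetAdj (to a) (to b) → adj H a b ≡ true

    isPart₁ : Fin N ⊎ Fin N → Bool
    isPart₁ (inj₁ _) = true
    isPart₁ (inj₂ _) = false

    largerPart : ℕ
    largerPart = countF (λ a → isPart₁ (to a)) ⊔ countF (λ a → not (isPart₁ (to a)))

-- Let H be the coset graph. Each simple reflection of W splits H into two mirror halves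
-- sharing only fixed vertices, so by Cauchy-Schwarz the square of a decorated homomorphism count
-- is at most the product of the counts of its two foldings. Folding towards the identity along
-- the simple reflections eventually identifies all chambers. Applied to decorations of the edges
-- this gives hom(H) n^(2e) >= m^e n^v, for a host with n vertices and m ordered edges; applied to
-- homomorphisms identifying two vertices of H it shows that if every homomorphism is
-- non-injective, then hom(H) is at most a constant times the number of homomorphisms constant on
-- one part, hence at most a constant times n D^t in a host of maximum degree D. A host of average
-- degree about D is brought to maximum degree D by splitting its vertices; the splitting map is
-- locally injective, which suffices because H is connected.
module Submission where

open import Level using (0ℓ)
open import Defs hiding (sym)
open import Algebra.Bundles using (Group)
import Algebra.Properties.CommutativeMonoid.Sum as CommutativeMonoidSum
import Algebra.Properties.Group as GroupProperties
open import Data.Bool using (Bool; true; false; if_then_else_; _∧_; _∨_; _xor_; not)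
import Data.Bool.Properties as Bool
open import Data.Empty using (⊥-elim)
open import Data.Fin using (Fin; zero; suc; toℕ; fromℕ<)
import Data.Fin.Permutation as Perm
import Data.Fin.Properties as Fin
open import Data.Fin.Subset using (Subset; inside; outside; ∣_∣; _∈_)
open import Data.Fin.Subset.Properties using (_∈?_; ∣p∣≡n⇒p≡⊤; ∈⊤)
open import Data.List using (List; []; _∷_; map; allFin; cartesianProductWith; cartesianProduct; _++_; concatMap; length)
open import Data.List.Membership.Propositional using () renaming (_∈_ to _∈ˡ_)
open import Data.List.Membership.Propositional.Properties using (∈-allFin)
open import Data.List.Properties using (map-tabulate)
open import Data.List.Relation.Unary.All using (All; []; _∷_)
import Data.List.Relation.Unary.All.Properties as All
open import Data.List.Relation.Unary.Any using (here; there)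
open import Data.Nat using (ℕ; zero; suc; _+_; _*_; _∸_; _^_; _⊔_; _≤_; _<_; _≥_; z≤n; s≤s; _≡ᵇ_; _<ᵇ_; NonZero)
open import Data.Nat.Base using (>-nonZero; >-nonZero⁻¹)
open import Data.Nat.DivMod using (_/_; m≡m%n+[m/n]*n; m%n<n; m/n*n≤m; /-monoˡ-≤)
open import Data.Nat.ListAction using (sum)
open import Data.Nat.Properties hiding (_≟_)
open import Data.Nat.Tactic.RingSolver using (solve-∀)
open import Data.Product using (Σ; _×_; _,_; proj₁; proj₂)
open import Data.Sum using (_⊎_; inj₁; inj₂; map₂; swap)
open import Data.Unit using (⊤; tt)
open import Data.Vec using ([]; _∷_; here; there)
import Data.Vec.Functional as VF
open import Function using (_∘_; id; const)
open import Function.Bundles using (Equivalence)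
open import Relation.Binary.Definitions using (DecidableEquality)
open import Relation.Binary.PropositionalEquality
open import Relation.Nullary using (¬_; Dec; yes; no; does)
open import Relation.Nullary.Decidable using (dec-true; dec-false; ¬?; _×-dec_)
open import Tactic.MonoidSolver using (solve)

-- Finite sums and products

-- Take D about m/n. Then m^e n^v <= n^(2e) hom and hom <= C n D^t combine to m^(e-t) n^(v-t-1) <=
-- C' n^(2(e-t)), the claimed bound raised to the power e-t. The exponent t comes from collapsing a
-- part of H to a point: what remains is a star whose leaves are the other part. Folding loses
-- something at every step. If D counts the homomorphisms collapsing a set U, then D^2 <= D' hom,
-- where D' is the count after folding. Iterating gives D^(T+1) <= S hom^T, with T depending only on
-- H and S the star bound. When D is at least hom/v^2, the powers of hom cancel and a bound linear
-- in S is left, however large T is. Collapses are measured after projection to the original host,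
-- since only injectivity there yields a copy of H. Walls need neither roots nor a geometric
-- representation: the universal property alone yields the inversion cocycle, and the deletion
-- condition follows from it. All averages are multiplied out, so every inequality is between
-- natural numbers.

module Prod = CommutativeMonoidSum *-1-commutativeMonoid


⟦_⟧ : Bool → ℕ
⟦ b ⟧ = if b then 1 else 0

∑ : {A : Set} → List A → (A → ℕ) → ℕ
∑ []       f = 0
∑ (x ∷ xs) f = f x + ∑ xs f

∏ : {n : ℕ} → (Fin n → ℕ) → ℕ
∏ {zero}  f = 1
∏ {suc n} f = f zero * ∏ (f ∘ suc)

∑≡sum : {A : Set} (xs : List A) (f : A → ℕ) → ∑ xs f ≡ sum (map f xs)
∑≡sum []       f = refl
∑≡sum (x ∷ xs) f = cong (f x +_) (∑≡sum xs f)

∏≡sum : ∀ {n} (f : Fin n → ℕ) → ∏ f ≡ Prod.sum f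
∏≡sum {zero}  f = refl
∏≡sum {suc n} f = cong (f zero *_) (∏≡sum (f ∘ suc))

module _ {A : Set} where
  ∑-cong : (xs : List A) {f g : A → ℕ} → (∀ x → f x ≡ g x) → ∑ xs f ≡ ∑ xs g
  ∑-cong []       eq = refl
  ∑-cong (x ∷ xs) eq = cong₂ _+_ (eq x) (∑-cong xs eq)

  ∑-mono : (xs : List A) {f g : A → ℕ} → (∀ x → f x ≤ g x) → ∑ xs f ≤ ∑ xs g
  ∑-mono []       le = z≤n
  ∑-mono (x ∷ xs) le = +-mono-≤ (le x) (∑-mono xs le)

  ∑-zero : (xs : List A) → ∑ xs (λ _ → 0) ≡ 0
  ∑-zero []       = refl
  ∑-zero (x ∷ xs) = ∑-zero xs

  ∑-+ : (xs : List A) (f g : A → ℕ) → ∑ xs (λ x → f x + g x) ≡ ∑ xs f + ∑ xs g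
  ∑-+ []       f g = refl
  ∑-+ (x ∷ xs) f g = trans (cong (f x + g x +_) (∑-+ xs f g)) (lemma (f x) (g x) (∑ xs f) (∑ xs g))
    where
    lemma : ∀ a b c d → a + b + (c + d) ≡ a + c + (b + d)
    lemma = solve-∀

  ∑-*ˡ : (xs : List A) (c : ℕ) (f : A → ℕ) → ∑ xs (λ x → c * f x) ≡ c * ∑ xs f
  ∑-*ˡ []       c f = sym (*-zeroʳ c)
  ∑-*ˡ (x ∷ xs) c f = trans (cong (c * f x +_) (∑-*ˡ xs c f)) (sym (*-distribˡ-+ c (f x) _))

  ∑-*ʳ : (xs : List A) (f : A → ℕ) (c : ℕ) → ∑ xs (λ x → f x * c) ≡ ∑ xs f * c
  ∑-*ʳ xs f c = trans (∑-cong xs (λ x → *-comm (f x) c)) (trans (∑-*ˡ xs c f) (*-comm c _))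

  ∑-const : (xs : List A) (c : ℕ) → ∑ xs (λ _ → c) ≡ ∑ xs (λ _ → 1) * c
  ∑-const xs c = trans (∑-cong xs (λ _ → sym (*-identityˡ c))) (∑-*ʳ xs (λ _ → 1) c)

  ∑-++ : (xs ys : List A) (f : A → ℕ) → ∑ (xs ++ ys) f ≡ ∑ xs f + ∑ ys f
  ∑-++ []       ys f = refl
  ∑-++ (x ∷ xs) ys f = trans (cong (f x +_) (∑-++ xs ys f)) (sym (+-assoc (f x) _ _))

∑-comm : {A B : Set} (xs : List A) (ys : List B) (f : A → B → ℕ) →
  ∑ xs (λ x → ∑ ys (f x)) ≡ ∑ ys (λ y → ∑ xs (λ x → f x y))
∑-comm []       ys f = sym (∑-zero ys)
∑-comm (x ∷ xs) ys f =
  trans (cong (∑ ys (f x) +_) (∑-comm xs ys f)) (sym (∑-+ ys (f x) (λ y → ∑ xs (λ x → f x y))))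

∑-map : {A B : Set} (g : A → B) (xs : List A) (f : B → ℕ) → ∑ (map g xs) f ≡ ∑ xs (f ∘ g)
∑-map g []       f = refl
∑-map g (x ∷ xs) f = cong (f (g x) +_) (∑-map g xs f)

∑-cartesian : {A B C : Set} (g : A → B → C) (xs : List A) (ys : List B) (f : C → ℕ) →
  ∑ (cartesianProductWith g xs ys) f ≡ ∑ xs (λ x → ∑ ys (λ y → f (g x y)))
∑-cartesian g []       ys f = refl
∑-cartesian g (x ∷ xs) ys f =
  trans (∑-++ (map (g x) ys) _ f) (cong₂ _+_ (∑-map (g x) ys f) (∑-cartesian g xs ys f))

∑-concatMap : {A B : Set} (g : A → List B) (xs : List A) (f : B → ℕ) →
  ∑ (concatMap g xs) f ≡ ∑ xs (λ x → ∑ (g x) f)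
∑-concatMap g []       f = refl
∑-concatMap g (x ∷ xs) f = trans (∑-++ (g x) _ f) (cong (∑ (g x) f +_) (∑-concatMap g xs f))

∑-allFin-suc : ∀ n (f : Fin (suc n) → ℕ) → ∑ (allFin (suc n)) f ≡ f zero + ∑ (allFin n) (f ∘ suc)
∑-allFin-suc n f = cong (f zero +_) (trans (cong (λ l → ∑ l f) (sym (map-tabulate id suc))) (∑-map suc (allFin n) f))

∑-allFin-1 : ∀ n → ∑ (allFin n) (λ _ → 1) ≡ n
∑-allFin-1 zero    = refl
∑-allFin-1 (suc n) = trans (∑-allFin-suc n (λ _ → 1)) (cong suc (∑-allFin-1 n))

term≤∑ : ∀ {n} (f : Fin n → ℕ) i → f i ≤ ∑ (allFin n) f
term≤∑ {suc n} f zero    = subst (f zero ≤_) (sym (∑-allFin-suc n f)) (m≤m+n _ _)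
term≤∑ {suc n} f (suc i) = subst (f (suc i) ≤_) (sym (∑-allFin-suc n f))
  (≤-trans (term≤∑ (f ∘ suc) i) (m≤n+m _ _))

2ab≤a²+b² : ∀ a b → 2 * (a * b) ≤ a * a + b * b
2ab≤a²+b² a b with ≤-total a b
... | inj₁ a≤b with m≤n⇒∃[o]m+o≡n a≤b
...   | k , refl = subst (2 * (a * (a + k)) ≤_) (lemma a k) (m≤m+n _ (k * k))
  where
  lemma : ∀ a k → 2 * (a * (a + k)) + k * k ≡ a * a + (a + k) * (a + k)
  lemma = solve-∀
2ab≤a²+b² a b | inj₂ b≤a with m≤n⇒∃[o]m+o≡n b≤a
...   | k , refl = subst (2 * ((b + k) * b) ≤_) (lemma b k) (m≤m+n _ (k * k))
  where
  lemma : ∀ b k → 2 * ((b + k) * b) + k * k ≡ (b + k) * (b + k) + b * b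
  lemma = solve-∀

∑-*-∑ : {A B : Set} (xs : List A) (ys : List B) (f : A → ℕ) (g : B → ℕ) →
  ∑ xs f * ∑ ys g ≡ ∑ xs (λ x → ∑ ys (λ y → f x * g y))
∑-*-∑ xs ys f g = trans (sym (∑-*ʳ xs f _)) (∑-cong xs (λ x → sym (∑-*ˡ ys (f x) g)))

-- Sum 2ab <= a^2 + b^2 over all pairs (x, y) with a = `p x * q y` and b = `p y * q x`; the
-- resulting double sums factor.
cauchy-schwarz : {A : Set} (xs : List A) (p q : A → ℕ) →
  ∑ xs (λ x → p x * q x) * ∑ xs (λ x → p x * q x) ≤ ∑ xs (λ x → p x * p x) * ∑ xs (λ x → q x * q x)
cauchy-schwarz xs p q = *-cancelˡ-≤ 2 (begin
  2 * (∑ xs pq * ∑ xs pq)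
    ≡⟨ cong (2 *_) (∑-*-∑ xs xs pq pq) ⟩
  2 * ∑ xs (λ x → ∑ xs (λ y → pq x * pq y))
    ≡⟨ trans (sym (∑-*ˡ xs 2 _)) (∑-cong xs (λ x → sym (∑-*ˡ xs 2 _))) ⟩
  ∑ xs (λ x → ∑ xs (λ y → 2 * (pq x * pq y)))
    ≤⟨ ∑-mono xs (λ x → ∑-mono xs (λ y → pointwise x y)) ⟩
  ∑ xs (λ x → ∑ xs (λ y → pp x * qq y + pp y * qq x))
    ≡⟨ trans (∑-cong xs (λ x → ∑-+ xs _ _)) (∑-+ xs _ _) ⟩
  ∑ xs (λ x → ∑ xs (λ y → pp x * qq y)) + ∑ xs (λ x → ∑ xs (λ y → pp y * qq x))
    ≡⟨ cong₂ _+_ (sym (∑-*-∑ xs xs pp qq)) (trans (∑-comm xs xs _) (sym (∑-*-∑ xs xs pp qq))) ⟩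
  ∑ xs pp * ∑ xs qq + ∑ xs pp * ∑ xs qq
    ≡⟨ double (∑ xs pp * ∑ xs qq) ⟩
  2 * (∑ xs pp * ∑ xs qq) ∎)
  where
  open ≤-Reasoning
  pq = λ x → p x * q x
  pp = λ x → p x * p x
  qq = λ x → q x * q x
  double : ∀ a → a + a ≡ 2 * a
  double = solve-∀
  pointwise : ∀ x y → 2 * (pq x * pq y) ≤ pp x * qq y + pp y * qq x
  pointwise x y = subst₂ _≤_ (l₁ (p x) (q x) (p y) (q y)) (l₂ (p x) (q x) (p y) (q y))
    (2ab≤a²+b² (p x * q y) (p y * q x))
    where
    l₁ : ∀ a b c d → 2 * (a * d * (c * b)) ≡ 2 * (a * b * (c * d))
    l₁ = solve-∀
    l₂ : ∀ a b c d → a * d * (a * d) + c * b * (c * b) ≡ a * a * (d * d) + c * c * (b * b)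
    l₂ = solve-∀

∏-cong : ∀ {n} {f g : Fin n → ℕ} → (∀ i → f i ≡ g i) → ∏ f ≡ ∏ g
∏-cong {zero}  eq = refl
∏-cong {suc n} eq = cong₂ _*_ (eq zero) (∏-cong (eq ∘ suc))

∏-* : ∀ {n} (f g : Fin n → ℕ) → ∏ (λ i → f i * g i) ≡ ∏ f * ∏ g
∏-* {zero}  f g = refl
∏-* {suc n} f g = trans (cong (f zero * g zero *_) (∏-* (f ∘ suc) (g ∘ suc)))
  (lemma (f zero) (g zero) (∏ (f ∘ suc)) (∏ (g ∘ suc)))
  where
  lemma : ∀ a b c d → a * b * (c * d) ≡ a * c * (b * d)
  lemma = solve-∀

∏-reindex : ∀ {n} (σ τ : Fin n → Fin n) → (∀ i → σ (τ i) ≡ i) → (∀ i → τ (σ i) ≡ i) →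
  (f : Fin n → ℕ) → ∏ (f ∘ σ) ≡ ∏ f
∏-reindex σ τ στ τσ f =
  trans (∏≡sum (f ∘ σ)) (trans (sym (Prod.sum-permute f (Perm.permutation σ τ στ τσ))) (sym (∏≡sum f)))

∏-mono : ∀ {n} {f g : Fin n → ℕ} → (∀ i → f i ≤ g i) → ∏ f ≤ ∏ g
∏-mono {zero}  le = ≤-refl
∏-mono {suc n} le = *-mono-≤ (le zero) (∏-mono (le ∘ suc))

∏-1 : ∀ n → ∏ {n} (λ _ → 1) ≡ 1
∏-1 zero    = refl
∏-1 (suc n) = trans (+-identityʳ _) (∏-1 n)

∏-const : ∀ n c → ∏ {n} (λ _ → c) ≡ c ^ n
∏-const zero    c = refl
∏-const (suc n) c = cong (c *_) (∏-const n c)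

∏-Bool : ∀ {n} (b : Fin n → Bool) →
  ((∀ i → b i ≡ true) × ∏ (λ i → ⟦ b i ⟧) ≡ 1) ⊎ (Σ (Fin n) (λ i → b i ≡ false) × ∏ (λ i → ⟦ b i ⟧) ≡ 0)
∏-Bool {zero}  b = inj₁ ((λ ()) , refl)
∏-Bool {suc n} b with b zero in eq | ∏-Bool (b ∘ suc)
... | false | _ = inj₂ ((zero , eq) , refl)
... | true  | inj₁ (all , p) = inj₁ ((λ { zero → eq ; (suc i) → all i }) , trans (+-identityʳ _) p)
... | true  | inj₂ ((i , bi) , p) = inj₂ ((suc i , bi) , trans (+-identityʳ _) p)

∏-factor-zero : ∀ {n} (f : Fin n → ℕ) i → f i ≡ 0 → ∏ f ≡ 0
∏-factor-zero {suc n} f zero    eq = cong (_* ∏ (f ∘ suc)) eq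
∏-factor-zero {suc n} f (suc i) eq = trans (cong (f zero *_) (∏-factor-zero (f ∘ suc) i eq)) (*-zeroʳ (f zero))

-- Every element occurs exactly once in elems up to _≈_; functions Fin v → A need _≈_ = _≗_.
record Enumeration (A : Set) (_≈_ : A → A → Set) : Set where
  field
    elems : List A
    δ     : A → A → ℕ
    ∑-δ   : ∀ (h : A → ℕ) → (∀ {x y} → x ≈ y → h x ≡ h y) → ∀ y → ∑ elems (λ x → δ x y * h x) ≡ h y

  -- Bijectivity is phrased as adjointness of `f` and `g` for `δ`, because on function spaces the
  -- inverse laws hold only pointwise. Expanding `h` through `δ` and exchanging the sums turns
  -- adjointness into the claim.
  ∑-reindex : (f g : A → A) → (∀ x y → δ y (f x) ≡ δ x (g y)) →
    (h : A → ℕ) → (∀ {x y} → x ≈ y → h x ≡ h y) → ∑ elems (h ∘ f) ≡ ∑ elems h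
  ∑-reindex f g adjoint h ext = begin
    ∑ elems (h ∘ f)
      ≡⟨ ∑-cong elems (λ x → sym (∑-δ h ext (f x))) ⟩
    ∑ elems (λ x → ∑ elems (λ y → δ y (f x) * h y))
      ≡⟨ ∑-comm elems elems _ ⟩
    ∑ elems (λ y → ∑ elems (λ x → δ y (f x) * h y))
      ≡⟨ ∑-cong elems (λ y → ∑-*ʳ elems _ (h y)) ⟩
    ∑ elems (λ y → ∑ elems (λ x → δ y (f x)) * h y)
      ≡⟨ ∑-cong elems (λ y → cong (_* h y)
           (trans (∑-cong elems (λ x → trans (adjoint x y) (sym (*-identityʳ _)))) (∑-δ (λ _ → 1) (λ _ → refl) (g y)))) ⟩
    ∑ elems (λ y → 1 * h y)
      ≡⟨ ∑-cong elems (λ y → *-identityˡ (h y)) ⟩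
    ∑ elems h ∎
    where open ≡-Reasoning

  δ-term≤∑ : (h : A → ℕ) → (∀ {x y} → x ≈ y → h x ≡ h y) → (∀ x y → δ x y ≤ 1) → ∀ y → h y ≤ ∑ elems h
  δ-term≤∑ h ext δ≤1 y = subst (_≤ ∑ elems h) (∑-δ h ext y)
    (∑-mono elems (λ x → subst (δ x y * h x ≤_) (*-identityˡ (h x)) (*-monoˡ-≤ (h x) (δ≤1 x y))))

record Finite (A : Set) : Set where
  field
    elems : List A
    _≟_   : DecidableEquality A
    once  : ∀ y → ∑ elems (λ x → ⟦ does (x ≟ y) ⟧) ≡ 1

  card : ℕ
  card = ∑ elems (λ _ → 1)

  δ : A → A → ℕ
  δ x y = ⟦ does (x ≟ y) ⟧

  δ≤1 : ∀ x y → δ x y ≤ 1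
  δ≤1 x y with does (x ≟ y)
  ... | true  = ≤-refl
  ... | false = z≤n

  δ-refl : ∀ x → δ x x ≡ 1
  δ-refl x with x ≟ x
  ... | yes _ = refl
  ... | no ne = ⊥-elim (ne refl)

  ∑-δ : ∀ (h : A → ℕ) y → ∑ elems (λ x → δ x y * h x) ≡ h y
  ∑-δ h y = begin
    ∑ elems (λ x → δ x y * h x) ≡⟨ ∑-cong elems pointwise ⟩
    ∑ elems (λ x → δ x y * h y) ≡⟨ ∑-*ʳ elems _ (h y) ⟩
    ∑ elems (λ x → δ x y) * h y ≡⟨ cong (_* h y) (once y) ⟩
    1 * h y ≡⟨ *-identityˡ (h y) ⟩
    h y ∎
    where
    open ≡-Reasoning
    pointwise : ∀ x → δ x y * h x ≡ δ x y * h y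
    pointwise x with x ≟ y
    ... | yes refl = refl
    ... | no _     = refl

  enumeration : Enumeration A _≡_
  enumeration = record { elems = elems ; δ = δ ; ∑-δ = λ h _ → ∑-δ h }

  δ-adjoint : (f g : A → A) → (∀ x → f (g x) ≡ x) → (∀ x → g (f x) ≡ x) → ∀ x y → δ y (f x) ≡ δ x (g y)
  δ-adjoint f g fg gf x y with y ≟ f x | x ≟ g y
  ... | yes _ | yes _ = refl
  ... | no _  | no _  = refl
  ... | yes e | no ne = ⊥-elim (ne (trans (sym (gf x)) (cong g (sym e))))
  ... | no ne | yes e = ⊥-elim (ne (trans (sym (fg y)) (cong f (sym e))))

  ∑-bijection : (f g : A → A) → (∀ x → f (g x) ≡ x) → (∀ x → g (f x) ≡ x) →
    (h : A → ℕ) → ∑ elems (h ∘ f) ≡ ∑ elems h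
  ∑-bijection f g fg gf h = Enumeration.∑-reindex enumeration f g (δ-adjoint f g fg gf) h (cong h)

∑-δFin : ∀ {n} (j : Fin n) → ∑ (allFin n) (λ i → ⟦ does (i Fin.≟ j) ⟧) ≡ 1
∑-δFin {suc n} zero    = trans (∑-allFin-suc n (λ i → ⟦ does (i Fin.≟ zero) ⟧)) (cong suc (∑-zero (allFin n)))
∑-δFin {suc n} (suc j) = trans (∑-allFin-suc n (λ i → ⟦ does (i Fin.≟ suc j) ⟧))
  (trans (∑-cong (allFin n) pointwise) (∑-δFin j))
  where
  pointwise : ∀ i → ⟦ does (suc i Fin.≟ suc j) ⟧ ≡ ⟦ does (i Fin.≟ j) ⟧
  pointwise i with i Fin.≟ j
  ... | yes _ = refl
  ... | no _  = refl

finiteFin : ∀ n → Finite (Fin n)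
finiteFin n = record { elems = allFin n ; _≟_ = Fin._≟_ ; once = ∑-δFin }

module Functions {A : Set} (FA : Finite A) where
  private module A = Finite FA

  funs : ∀ v → List (Fin v → A)
  funs zero    = (λ ()) ∷ []
  funs (suc v) = cartesianProductWith VF._∷_ A.elems (funs v)

  -- Stands in for function extensionality: a summand over maps has to be shown to respect pointwise
  -- equality.
  Ext : ∀ {v} → ((Fin v → A) → ℕ) → Set
  Ext h = ∀ {φ ψ} → φ ≗ ψ → h φ ≡ h ψ

  ∷-cong : ∀ {v} (x : A) {φ ψ : Fin v → A} → φ ≗ ψ → (x VF.∷ φ) ≗ (x VF.∷ ψ)
  ∷-cong x e zero    = refl
  ∷-cong x e (suc i) = e i

  ∷-η : ∀ {v} (φ : Fin (suc v) → A) → (φ zero VF.∷ (φ ∘ suc)) ≗ φ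
  ∷-η φ zero    = refl
  ∷-η φ (suc i) = refl

  δF : ∀ {v} → (Fin v → A) → (Fin v → A) → ℕ
  δF φ ψ = ∏ (λ u → A.δ (φ u) (ψ u))

  δF≤1 : ∀ {v} (φ ψ : Fin v → A) → δF φ ψ ≤ 1
  δF≤1 {v} φ ψ = ≤-trans (∏-mono (λ u → A.δ≤1 (φ u) (ψ u))) (≤-reflexive (∏-1 v))

  ∑-δF : ∀ {v} (h : (Fin v → A) → ℕ) → Ext h → ∀ ψ → ∑ (funs v) (λ φ → δF φ ψ * h φ) ≡ h ψ
  ∑-δF {zero}  h ext ψ = trans (+-identityʳ _) (trans (*-identityˡ _) (ext (λ ())))
  ∑-δF {suc v} h ext ψ = begin
    ∑ (funs (suc v)) (λ φ → δF φ ψ * h φ)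
      ≡⟨ ∑-cartesian VF._∷_ A.elems (funs v) _ ⟩
    ∑ A.elems (λ x → ∑ (funs v) (λ φ → A.δ x (ψ zero) * δF φ (ψ ∘ suc) * h (x VF.∷ φ)))
      ≡⟨ ∑-cong A.elems (λ x → trans (∑-cong (funs v) (λ φ → *-assoc (A.δ x (ψ zero)) _ _))
           (trans (∑-*ˡ (funs v) (A.δ x (ψ zero)) _)
             (cong (A.δ x (ψ zero) *_) (∑-δF (λ φ → h (x VF.∷ φ)) (λ e → ext (∷-cong x e)) (ψ ∘ suc))))) ⟩
    ∑ A.elems (λ x → A.δ x (ψ zero) * h (x VF.∷ (ψ ∘ suc)))
      ≡⟨ A.∑-δ (λ x → h (x VF.∷ (ψ ∘ suc))) (ψ zero) ⟩
    h (ψ zero VF.∷ (ψ ∘ suc))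
      ≡⟨ ext (∷-η ψ) ⟩
    h ψ ∎
    where open ≡-Reasoning

  enumeration : ∀ v → Enumeration (Fin v → A) _≗_
  enumeration v = record { elems = funs v ; δ = δF ; ∑-δ = ∑-δF }

  ∑-precompose : ∀ {v} (σ τ : Fin v → Fin v) → (∀ i → σ (τ i) ≡ i) → (∀ i → τ (σ i) ≡ i) →
    (h : (Fin v → A) → ℕ) → Ext h → ∑ (funs v) (λ φ → h (φ ∘ σ)) ≡ ∑ (funs v) h
  ∑-precompose {v} σ τ στ τσ = Enumeration.∑-reindex (enumeration v) (_∘ σ) (_∘ τ) adjoint
    where
    δ-sym : ∀ x y → A.δ x y ≡ A.δ y x
    δ-sym = λ x y → A.δ-adjoint id id (λ _ → refl) (λ _ → refl) y x
    adjoint : ∀ φ ψ → δF ψ (φ ∘ σ) ≡ δF φ (ψ ∘ τ)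
    adjoint φ ψ = trans (sym (∏-reindex τ σ τσ στ (λ u → A.δ (ψ u) (φ (σ u)))))
      (∏-cong (λ u → trans (δ-sym _ _) (cong (λ w → A.δ (φ w) (ψ (τ u))) (στ u))))

  ∑-∏ : ∀ {v} (h : Fin v → A → ℕ) → ∑ (funs v) (λ φ → ∏ (λ u → h u (φ u))) ≡ ∏ (λ u → ∑ A.elems (h u))
  ∑-∏ {zero}  h = refl
  ∑-∏ {suc v} h = begin
    ∑ (funs (suc v)) (λ φ → ∏ (λ u → h u (φ u)))
      ≡⟨ ∑-cartesian VF._∷_ A.elems (funs v) _ ⟩
    ∑ A.elems (λ x → ∑ (funs v) (λ φ → h zero x * ∏ (λ u → h (suc u) (φ u))))
      ≡⟨ sym (∑-*-∑ A.elems (funs v) (h zero) (λ φ → ∏ (λ u → h (suc u) (φ u)))) ⟩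
    ∑ A.elems (h zero) * ∑ (funs v) (λ φ → ∏ (λ u → h (suc u) (φ u)))
      ≡⟨ cong (∑ A.elems (h zero) *_) (∑-∏ (h ∘ suc)) ⟩
    ∏ (λ u → ∑ A.elems (h u)) ∎
    where open ≡-Reasoning

  ∑-funs-1 : ∀ v → ∑ (funs v) (λ _ → 1) ≡ A.card ^ v
  ∑-funs-1 v = trans (∑-cong (funs v) (λ _ → sym (∏-1 v))) (trans (∑-∏ {v} (λ _ _ → 1)) (∏-const v A.card))

  mix : ∀ {v} → (Fin v → Bool) → (Fin v → A) → (Fin v → A) → Fin v → A
  mix P φ ψ u = if P u then φ u else ψ u

  -- Every map arises from `A.card ^ v` pairs: the values of `φ` off `P` and those of `ψ` on `P` are
  -- ignored and remain free.
  ∑-mix : ∀ {v} (P : Fin v → Bool) (h : (Fin v → A) → ℕ) → Ext h →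
    ∑ (funs v) (λ φ → ∑ (funs v) (λ ψ → h (mix P φ ψ))) ≡ A.card ^ v * ∑ (funs v) h
  ∑-mix {zero}  P h ext = trans (+-identityʳ _) (trans (cong (_+ 0) (ext (λ ()))) (sym (*-identityˡ _)))
  ∑-mix {suc v} P h ext = begin
    ∑ (funs (suc v)) (λ φ → ∑ (funs (suc v)) (λ ψ → h (mix P φ ψ)))
      ≡⟨ trans (∑-cartesian VF._∷_ A.elems (funs v) _)
           (∑-cong A.elems (λ x → ∑-cong (funs v) (λ φ → ∑-cartesian VF._∷_ A.elems (funs v) _))) ⟩
    ∑ A.elems (λ x → ∑ (funs v) (λ φ → ∑ A.elems (λ y → ∑ (funs v) (λ ψ → h (mix P (x VF.∷ φ) (y VF.∷ ψ))))))
      ≡⟨ ∑-cong A.elems (λ x → ∑-comm (funs v) A.elems _) ⟩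
    ∑ A.elems (λ x → ∑ A.elems (λ y → ∑ (funs v) (λ φ → ∑ (funs v) (λ ψ → h (mix P (x VF.∷ φ) (y VF.∷ ψ))))))
      ≡⟨ ∑-cong A.elems (λ x → ∑-cong A.elems (λ y → trans
           (∑-cong (funs v) (λ φ → ∑-cong (funs v) (λ ψ → ext (mix-∷ x y φ ψ))))
           (∑-mix (P ∘ suc) (λ χ → h (pick x y VF.∷ χ)) (λ e → ext (∷-cong _ e))))) ⟩
    ∑ A.elems (λ x → ∑ A.elems (λ y → c * H (pick x y)))
      ≡⟨ picked ⟩
    A.card * (c * ∑ A.elems H)
      ≡⟨ trans (sym (*-assoc A.card c _)) (cong (A.card * c *_) (sym (∑-cartesian VF._∷_ A.elems (funs v) h))) ⟩
    A.card * c * ∑ (funs (suc v)) h ∎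
    where
    open ≡-Reasoning
    c = A.card ^ v
    pick : A → A → A
    pick x y = if P zero then x else y
    H : A → ℕ
    H x = ∑ (funs v) (λ χ → h (x VF.∷ χ))
    mix-∷ : ∀ x y φ ψ → mix P (x VF.∷ φ) (y VF.∷ ψ) ≗ (pick x y VF.∷ mix (P ∘ suc) φ ψ)
    mix-∷ x y φ ψ zero    = refl
    mix-∷ x y φ ψ (suc u) = refl
    picked : ∑ A.elems (λ x → ∑ A.elems (λ y → c * H (pick x y))) ≡ A.card * (c * ∑ A.elems H)
    picked with P zero
    ... | true  = trans (∑-cong A.elems (λ x → ∑-const A.elems _))
                    (trans (∑-*ˡ A.elems A.card _) (cong (A.card *_) (∑-*ˡ A.elems c H)))
    ... | false = trans (∑-const A.elems _) (cong (A.card *_) (∑-*ˡ A.elems c H))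

-- Walls and foldings of a Coxeter group

does-⇔ : {P Q : Set} (p : Dec P) (q : Dec Q) → (P → Q) → (Q → P) → does p ≡ does q
does-⇔ (yes _) (yes _) f g = refl
does-⇔ (no _)  (no _)  f g = refl
does-⇔ (yes a) (no b)  f g = ⊥-elim (b (f a))
does-⇔ (no a)  (yes b) f g = ⊥-elim (a (g b))

module FiniteGroup {N : ℕ} (G : FinGroup N) where
  open FinGroup G public

  group : Group 0ℓ 0ℓ
  group = record
    { Carrier = Fin N ; _≈_ = _≡_ ; _∙_ = _·_ ; ε = e ; _⁻¹ = inv
    ; isGroup = record
      { isMonoid = record
        { isSemigroup = record
          { isMagma = record { isEquivalence = isEquivalence ; ∙-cong = cong₂ _·_ }
          ; assoc = assoc }
        ; identity = identityˡ , identityʳ }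
      ; inverse = inverseˡ , inverseʳ
      ; ⁻¹-cong = cong inv } }

  monoid = Group.monoid group
  open GroupProperties group public
    using () renaming (ε⁻¹≈ε to inv-e; ⁻¹-anti-homo-∙ to inv-·; ⁻¹-involutive to inv-inv
                      ; ∙-cancelˡ to ·-cancelˡ; ∙-cancelʳ to ·-cancelʳ; inverseʳ-unique to inv-unique)

  inv-cancelˡ : ∀ x y → inv x · (x · y) ≡ y
  inv-cancelˡ x y = trans (sym (assoc _ _ _)) (trans (cong (_· y) (inverseˡ x)) (identityˡ y))

  cancel-invˡ : ∀ x y → x · (inv x · y) ≡ y
  cancel-invˡ x y = trans (sym (assoc _ _ _)) (trans (cong (_· y) (inverseʳ x)) (identityˡ y))

  conj : Fin N → Fin N → Fin N
  conj w t = w · t · inv w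

  conj-· : ∀ x y t → conj (x · y) t ≡ conj x (conj y t)
  conj-· x y t = trans (cong ((x · y) · t ·_) (inv-· x y)) (reassoc x y t (inv y) (inv x))
    where
    reassoc : ∀ a b c d f → (a · b) · c · (d · f) ≡ a · (b · c · d) · f
    reassoc a b c d f = solve monoid

  conj-e : ∀ t → conj e t ≡ t
  conj-e t = trans (cong₂ _·_ (identityˡ t) inv-e) (identityʳ t)

  conj-injective : ∀ w t u → conj w t ≡ conj w u → t ≡ u
  conj-injective w t u eq = ·-cancelˡ w t u (·-cancelʳ (inv w) _ _ eq)

  pow-+ : ∀ x k l → pow G x (k + l) ≡ pow G x k · pow G x l
  pow-+ x zero    l = sym (identityˡ _)
  pow-+ x (suc k) l = trans (cong (x ·_) (pow-+ x k l)) (sym (assoc _ _ _))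

  pow-comm : ∀ x k → pow G x k · x ≡ x · pow G x k
  pow-comm x zero    = trans (identityˡ x) (sym (identityʳ x))
  pow-comm x (suc k) = trans (assoc _ _ _) (cong (x ·_) (pow-comm x k))

xorSum : ℕ → (ℕ → Bool) → Bool
xorSum zero    f = false
xorSum (suc l) f = xorSum l f xor f l

xorSum-+ : ∀ b a f → xorSum (b + a) f ≡ xorSum a f xor xorSum b (λ l → f (l + a))
xorSum-+ zero    a f = sym (Bool.xor-identityʳ _)
xorSum-+ (suc b) a f = trans (cong (_xor f (b + a)) (xorSum-+ b a f)) (Bool.xor-assoc (xorSum a f) _ _)

xorSum-cong : ∀ l {f g : ℕ → Bool} → (∀ i → f i ≡ g i) → xorSum l f ≡ xorSum l g
xorSum-cong zero    eq = refl
xorSum-cong (suc l) eq = cong₂ _xor_ (xorSum-cong l eq) (eq l)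

xor-self : ∀ b → b xor b ≡ false
xor-self true  = refl
xor-self false = refl

module Coxeter {N m : ℕ} (G : FinGroup N) (s : Fin m → Fin N) (M : Fin m → Fin m → ℕ)
               (cox : IsCoxeterSystem G s M) where
  open FiniteGroup G public
  open IsCoxeterSystem cox

  s-involutive : ∀ i → s i · s i ≡ e
  s-involutive i = trans (sym (identityʳ _)) (subst (λ k → pow G (s i · s i) k ≡ e) (M-diag i) (relations i i))

  inv-s : ∀ i → inv (s i) ≡ s i
  inv-s i = sym (inv-unique (s i) (s i) (s-involutive i))

  s-cancelˡ : ∀ i x → s i · (s i · x) ≡ x
  s-cancelˡ i x = trans (sym (assoc _ _ _)) (trans (cong (_· x) (s-involutive i)) (identityˡ x))

  s-cancelʳ : ∀ x i → x · s i · s i ≡ x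
  s-cancelʳ x i = trans (assoc _ _ _) (trans (cong (x ·_) (s-involutive i)) (identityʳ x))

  word : List (Fin m) → Fin N
  word []       = e
  word (i ∷ is) = s i · word is

  letters : {A : Set} → List (Fin m × A) → List (Fin m)
  letters = map proj₁

  evalWord≡word : (w : List (Fin m × Bool)) → evalWord G s w ≡ word (letters w)
  evalWord≡word []              = refl
  evalWord≡word ((i , true) ∷ w)  = cong₂ _·_ (inv-s i) (evalWord≡word w)
  evalWord≡word ((i , false) ∷ w) = cong (s i ·_) (evalWord≡word w)

  word-of : ∀ x → Σ (List (Fin m)) λ is → word is ≡ x
  word-of x with generates x
  ... | w , eq = letters w , trans (sym (evalWord≡word w)) eq

  private
    Cocycle : Set
    Cocycle = Fin N × (Fin N → Bool)

    _≈ᶜ_ : Cocycle → Cocycle → Set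
    (w , a) ≈ᶜ (w' , a') = w ≡ w' × (∀ t → a t ≡ a' t)

    _∙ᶜ_ : Cocycle → Cocycle → Cocycle
    (w , a) ∙ᶜ (w' , a') = w · w' , λ t → a' t xor a (conj w' t)

  -- W acting on the sign assignments of the potential reflections: the twist in
  -- the product makes the second component of the image of w record which
  -- reflections separate w from the identity.
  twisted : Group 0ℓ 0ℓ
  twisted = record
    { Carrier = Cocycle
    ; _≈_ = _≈ᶜ_
    ; _∙_ = _∙ᶜ_
    ; ε = e , λ _ → false
    ; _⁻¹ = λ (w , a) → inv w , λ t → a (conj (inv w) t)
    ; isGroup = record
      { isMonoid = record
        { isSemigroup = record
          { isMagma = record
            { isEquivalence = record
              { refl = refl , λ _ → refl
              ; sym = λ (p , q) → sym p , λ t → sym (q t)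
              ; trans = λ (p , q) (p' , q') → trans p p' , λ t → trans (q t) (q' t) }
            ; ∙-cong = λ { {_ , a} {_ , a'} (refl , q) (refl , q') → refl , λ t → cong₂ _xor_ (q' t) (q _) } }
          ; assoc = λ (w , a) (w' , a') (w″ , a″) → assoc w w' w″ ,
              λ t → trans (cong (λ u → a″ t xor (a' (conj w″ t) xor a u)) (sym (conj-· w' w″ t)))
                          (sym (Bool.xor-assoc (a″ t) _ _)) }
        ; identity = (λ (w , a) → identityˡ w , λ t → Bool.xor-identityʳ _)
                   , (λ (w , a) → identityʳ w , λ t → cong a (conj-e t)) }
      ; inverse = (λ (w , a) → inverseˡ w , λ t →
                    trans (cong (λ u → a t xor a u)
                      (trans (sym (conj-· (inv w) w t)) (trans (cong (λ x → conj x t) (inverseˡ w)) (conj-e t))))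
                      (xor-self (a t)))
                , (λ (w , a) → inverseʳ w , λ t → xor-self (a (conj (inv w) t)))
      ; ⁻¹-cong = λ { {_ , a} (refl , q) → refl , λ t → q _ } } }

  -- The chambers `e` and `s i` are separated by exactly one wall, that of the reflection `s i`.
  generator : Fin m → Cocycle
  generator i = s i , λ t → does (t Fin.≟ s i)

  private
    module Relation (i j : Fin m) where
      r : Fin N
      r = s i · s j
      h : Cocycle
      h = generator i ∙ᶜ generator j

      -- Conjugation by `s j` inverts the rotation `r`; this form of it avoids inverses.
      dihedral : ∀ k → pow G r k · s j · pow G r k ≡ s j
      dihedral zero    = trans (identityʳ _) (identityˡ _)
      dihedral (suc k) = begin
        r · pow G r k · s j · (r · pow G r k)
          ≡⟨ cong (λ x → r · pow G r k · s j · x) (sym (pow-comm r k)) ⟩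
        r · pow G r k · s j · (pow G r k · r)
          ≡⟨ reassoc r (pow G r k) (s j) ⟩
        r · (pow G r k · s j · pow G r k) · r
          ≡⟨ cong (λ x → r · x · r) (dihedral k) ⟩
        s i · s j · s j · (s i · s j)
          ≡⟨ cong (_· r) (s-cancelʳ (s i) j) ⟩
        s i · (s i · s j)
          ≡⟨ s-cancelˡ i (s j) ⟩
        s j ∎
        where
        open ≡-Reasoning
        reassoc : ∀ a b c → a · b · c · (b · a) ≡ a · (b · c · b) · a
        reassoc a b c = solve monoid

      -- This identity and `conj-odd` locate the walls met by the next factor `r` after `pow G r k`:
      -- pulled back through that power, the walls of `s j` and `s i` are the terms `k + k` and
      -- `suc (k + k)` of the sequence `s j · pow G r l`.
      conj-even : ∀ k → conj (pow G r k) (s j · pow G r (k + k)) ≡ s j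
      conj-even k = begin
        p · (s j · pow G r (k + k)) · inv p
          ≡⟨ cong (λ x → p · (s j · x) · inv p) (pow-+ r k k) ⟩
        p · (s j · (p · p)) · inv p
          ≡⟨ reassoc p (s j) (inv p) ⟩
        (p · s j · p) · (p · inv p)
          ≡⟨ cong₂ _·_ (dihedral k) (inverseʳ p) ⟩
        s j · e
          ≡⟨ identityʳ _ ⟩
        s j ∎
        where
        open ≡-Reasoning
        p = pow G r k
        reassoc : ∀ a b c → a · (b · (a · a)) · c ≡ (a · b · a) · (a · c)
        reassoc a b c = solve monoid

      conj-odd : ∀ k → conj (s j) (conj (pow G r k) (s j · pow G r (suc (k + k)))) ≡ s i
      conj-odd k = begin
        s j · (p · (s j · pow G r (suc (k + k))) · inv p) · inv (s j)
          ≡⟨ cong₂ (λ x y → s j · (p · (s j · x) · inv p) · y)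
               (trans (sym (pow-comm r (k + k))) (trans (cong (_· r) (pow-+ r k k))
                 (trans (assoc _ _ _) (trans (cong (p ·_) (pow-comm r k)) (sym (assoc _ _ _)))))) (inv-s j) ⟩
        s j · (p · (s j · (p · r · p)) · inv p) · s j
          ≡⟨ reassoc p (s j) r (inv p) ⟩
        s j · (p · s j · p) · r · (p · inv p) · s j
          ≡⟨ cong₂ (λ x y → s j · x · r · y · s j) (dihedral k) (inverseʳ p) ⟩
        s j · s j · (s i · s j) · e · s j
          ≡⟨ cong (λ x → x · (s i · s j) · e · s j) (s-involutive j) ⟩
        e · (s i · s j) · e · s j
          ≡⟨ reassoc′ (s i) (s j) ⟩
        s i · s j · s j
          ≡⟨ s-cancelʳ (s i) j ⟩
        s i ∎
        where
        open ≡-Reasoning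
        p = pow G r k
        reassoc : ∀ a b r c → b · (a · (b · (a · r · a)) · c) · b ≡ b · (a · b · a) · r · (a · c) · b
        reassoc a b r c = solve monoid
        reassoc′ : ∀ a b → e · (a · b) · e · b ≡ a · b · b
        reassoc′ a b = solve monoid

      -- The reflections s_j r^l, l < 2M, are the walls crossed by the word (s_i s_j)^M,
      -- and each is crossed twice since r^M = 1.
      wall : Fin N → ℕ → Bool
      wall t l = does (t Fin.≟ (s j · pow G r l))

      power : ∀ k → proj₁ (powG twisted h k) ≡ pow G r k
                  × (∀ t → proj₂ (powG twisted h k) t ≡ xorSum (k + k) (wall t))
      power zero    = refl , λ _ → refl
      power (suc k) with power k
      ... | p , q = cong (r ·_) p , λ t → begin
        proj₂ (powG twisted h k) t xor proj₂ h (conj (proj₁ (powG twisted h k)) t)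
          ≡⟨ cong₂ (λ b w → b xor proj₂ h (conj w t)) (q t) p ⟩
        xorSum (k + k) (wall t) xor proj₂ h (conj (pow G r k) t)
          ≡⟨ cong (xorSum (k + k) (wall t) xor_) (cong₂ _xor_
               (does-⇔ (_ Fin.≟ s j) (t Fin.≟ _)
                 (λ eq → conj-injective (pow G r k) _ _ (trans eq (sym (conj-even k))))
                 (λ { refl → conj-even k }))
               (does-⇔ (_ Fin.≟ s i) (t Fin.≟ _)
                 (λ eq → conj-injective (pow G r k) _ _ (conj-injective (s j) _ _ (trans eq (sym (conj-odd k)))))
                 (λ { refl → conj-odd k }))) ⟩
        xorSum (k + k) (wall t) xor (wall t (k + k) xor wall t (suc (k + k)))
          ≡⟨ sym (Bool.xor-assoc (xorSum (k + k) (wall t)) _ _) ⟩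
        xorSum (suc (suc (k + k))) (wall t)
          ≡⟨ cong (λ l → xorSum (suc l) (wall t)) (sym (+-suc k k)) ⟩
        xorSum (suc k + suc k) (wall t) ∎
        where open ≡-Reasoning

      wall-periodic : ∀ t l → wall t (l + M i j) ≡ wall t l
      wall-periodic t l = cong (λ x → does (t Fin.≟ (s j · x)))
        (trans (pow-+ r l (M i j)) (trans (cong (pow G r l ·_) (relations i j)) (identityʳ _)))

      relation : powG twisted h (M i j) ≈ᶜ (e , λ _ → false)
      relation = trans (proj₁ (power (M i j))) (relations i j) , λ t →
        trans (proj₂ (power (M i j)) t) (trans (xorSum-+ (M i j) (M i j) (wall t))
          (trans (cong (xorSum (M i j) (wall t) xor_) (xorSum-cong (M i j) (wall-periodic t)))
            (xor-self (xorSum (M i j) (wall t)))))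

    -- Extending the letterwise data to a homomorphism shows that the parity of crossings of a wall
    -- depends only on the group element, not on the word chosen for it.
    sections = universal twisted generator Relation.relation

  private
    lift : Fin N → Cocycle
    lift = proj₁ sections

    lift-· : ∀ x y → lift (x · y) ≈ᶜ (lift x ∙ᶜ lift y)
    lift-· = proj₁ (proj₂ sections)

    lift-s : ∀ i → lift (s i) ≈ᶜ generator i
    lift-s = proj₂ (proj₂ sections)

    base-e : proj₁ (lift e) ≡ e
    base-e = ·-cancelˡ (proj₁ (lift e)) _ _
      (trans (sym (proj₁ (lift-· e e))) (trans (cong (proj₁ ∘ lift) (identityˡ e)) (sym (identityʳ _))))

    base-word : ∀ is → proj₁ (lift (word is)) ≡ word is
    base-word []       = base-e
    base-word (i ∷ is) = trans (proj₁ (lift-· (s i) (word is))) (cong₂ _·_ (proj₁ (lift-s i)) (base-word is))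

    base : ∀ x → proj₁ (lift x) ≡ x
    base x with word-of x
    ... | is , refl = base-word is

  -- The inversion cocycle: for a word of `w` read from its right end, the parity of the occurrences
  -- of `t` among the last letter, the letter before it conjugated by the last, and so on.
  η : Fin N → Fin N → Bool
  η w = proj₂ (lift w)

  η-· : ∀ x y t → η (x · y) t ≡ η y t xor η x (conj y t)
  η-· x y t = trans (proj₂ (lift-· x y) t) (cong (λ w → η y t xor η x (conj w t)) (base y))

  η-s : ∀ i t → η (s i) t ≡ does (t Fin.≟ s i)
  η-s i = proj₂ (lift-s i)

  η-e : ∀ t → η e t ≡ false
  η-e t = trans (trans (cong (λ w → η w t) (sym (identityˡ e)))
    (trans (η-· e e t) (cong (λ u → η e t xor η e u) (conj-e t)))) (xor-self (η e t))

  -- True when the wall of `s k` separates the chamber of `w` from that of `e`. The inverse turns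
  -- right inversions into left ones, so that left multiplication by `s k` is the reflection in this
  -- wall.
  side : Fin m → Fin N → Bool
  side k w = η (inv w) (s k)

  side-e : ∀ k → side k e ≡ false
  side-e k = trans (cong (λ w → η w (s k)) inv-e) (η-e (s k))

  conj-s : ∀ k → conj (s k) (s k) ≡ s k
  conj-s k = trans (cong₂ _·_ (s-involutive k) (inv-s k)) (identityˡ _)

  does-refl : ∀ (x : Fin N) → does (x Fin.≟ x) ≡ true
  does-refl x with x Fin.≟ x
  ... | yes _ = refl
  ... | no ne = ⊥-elim (ne refl)

  side-reflect : ∀ k w → side k (s k · w) ≡ not (side k w)
  side-reflect k w = begin
    η (inv (s k · w)) (s k)
      ≡⟨ cong (λ x → η x (s k)) (trans (inv-· (s k) w) (cong (inv w ·_) (inv-s k))) ⟩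
    η (inv w · s k) (s k)
      ≡⟨ η-· (inv w) (s k) (s k) ⟩
    η (s k) (s k) xor η (inv w) (conj (s k) (s k))
      ≡⟨ cong₂ (λ b t → b xor η (inv w) t) (trans (η-s k (s k)) (does-refl (s k))) (conj-s k) ⟩
    not (side k w) ∎
    where open ≡-Reasoning

  -- The only wall between the adjacent chambers `w` and `w · s j` is that of the conjugate of `s j`
  -- by `w`. A change of side forces this conjugate to be `s k`.
  side-cross : ∀ k w j → side k (w · s j) ≢ side k w → s k · w ≡ w · s j
  side-cross k w j ne with conj (inv w) (s k) Fin.≟ s j | step
    where
    step : side k (w · s j) ≡ side k w xor does (conj (inv w) (s k) Fin.≟ s j)
    step = trans (cong (λ x → η x (s k)) (trans (inv-· w (s j)) (cong (_· inv w) (inv-s j))))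
      (trans (η-· (s j) (inv w) (s k)) (cong (side k w xor_) (η-s j _)))
  ... | no _   | eq = ⊥-elim (ne (trans eq (Bool.xor-identityʳ _)))
  ... | yes eq | _  = begin
    s k · w
      ≡⟨ sym (trans (sym (assoc _ _ _)) (trans (cong (_· (s k · w)) (inverseʳ w)) (identityˡ _))) ⟩
    w · (inv w · (s k · w))
      ≡⟨ cong (λ x → w · x) (trans (sym (assoc _ _ _)) (cong (inv w · s k ·_) (sym (inv-inv w)))) ⟩
    w · conj (inv w) (s k)
      ≡⟨ cong (w ·_) eq ⟩
    w · s j ∎
    where open ≡-Reasoning

  separated : ∀ k w → side k w ≡ true → side k (e · w) ≢ side k e
  separated k w eq eq' with trans (sym eq) (trans (cong (side k) (sym (identityˡ w))) (trans eq' (side-e k)))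
  ... | ()

  side-s : ∀ k j → k ≢ j → side k (s j) ≡ false
  side-s k j k≢j with side k (s j) in eq
  ... | false = refl
  ... | true  = ⊥-elim (k≢j (s-inj k j (trans (sym (identityʳ _)) (trans
                  (side-cross k e j (separated k (s j) eq)) (identityˡ _)))))

  -- Retractions onto the two half-spaces of the wall of `s k`: `fold` onto the one containing `e`,
  -- `unfold` onto the far one.
  fold unfold : Fin m → Fin N → Fin N
  fold   k w = if side k w then s k · w else w
  unfold k w = if side k w then w else s k · w

  fold-e : ∀ k → fold k e ≡ e
  fold-e k rewrite side-e k = refl

  side-s-self : ∀ k → side k (s k) ≡ true
  side-s-self k = trans (cong (side k) (sym (identityʳ (s k)))) (trans (side-reflect k e) (cong not (side-e k)))

  fold-s-self : ∀ k → fold k (s k) ≡ e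
  fold-s-self k rewrite side-s-self k = s-involutive k

  fold-s : ∀ k j → k ≢ j → fold k (s j) ≡ s j
  fold-s k j ne rewrite side-s k j ne = refl

  unfold-s-self : ∀ k → unfold k (s k) ≡ s k
  unfold-s-self k rewrite side-s-self k = refl

  -- The deletion condition. A gallery whose ends lie on different sides crosses the wall at some
  -- letter; there `s k` can be moved through the prefix and cancels that letter.
  delete : ∀ k x is → side k (x · word is) ≢ side k x →
    Σ (List (Fin m)) λ js → s k · (x · word is) ≡ x · word js × suc (length js) ≡ length is
  delete k x []       ne = ⊥-elim (ne (cong (side k) (identityʳ x)))
  delete k x (i ∷ is) ne with side k (x · s i) Bool.≟ side k x
  ... | no crossed = is , trans (sym (assoc _ _ _)) (trans (cong (_· word (i ∷ is)) (side-cross k x i crossed))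
                       (trans (assoc _ _ _) (cong (x ·_) (s-cancelˡ i (word is))))) , refl
  ... | yes same with delete k (x · s i) is (λ eq → ne (trans (cong (side k) (sym (assoc _ _ _))) (trans eq same)))
  ...   | js , eq , len = i ∷ js , trans (cong (s k ·_) (sym (assoc _ _ _))) (trans eq (assoc _ _ _)) , cong suc len

  -- A bound witnessed by some word replaces the length function, so shortest words never have to be
  -- found.
  HasLength≤ : ℕ → Fin N → Set
  HasLength≤ n w = Σ (List (Fin m)) λ is → word is ≡ w × length is ≤ n

  reflect-shorter : ∀ k is → side k (word is) ≡ true →
    Σ (List (Fin m)) λ js → s k · word is ≡ word js × suc (length js) ≡ length is
  reflect-shorter k is eq with delete k e is (separated k (word is) eq)
  ... | js , p , len = js , trans (cong (s k ·_) (sym (identityˡ _))) (trans p (identityˡ _)) , len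

  -- Before the letter `j` is put in front, `word is` lies beyond the wall of `s j`, so that letter
  -- undoes a crossing already made.
  head-side-false : ∀ j is → side j (word (j ∷ is)) ≡ false →
    Σ (List (Fin m)) λ js → word (j ∷ is) ≡ word js × suc (length js) ≡ length is
  head-side-false j is eq = reflect-shorter j is (Bool.not-injective (trans (sym (side-reflect j (word is))) eq))

  fold-length : ∀ n k w → HasLength≤ (suc n) w → (fold k w ≡ w) ⊎ HasLength≤ n (fold k w)
  fold-length n k w (is , refl , le) with side k (word is) in eq
  ... | false = inj₁ refl
  ... | true with reflect-shorter k is eq
  ...   | js , p , len = inj₂ (js , sym p , ≤-pred (subst (_≤ suc n) (sym len) le))

  fold-length≤ : ∀ n k w → HasLength≤ n w → HasLength≤ n (fold k w)
  fold-length≤ n k w (is , refl , le) with side k (word is) in eq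
  ... | false = is , refl , le
  ... | true with reflect-shorter k is eq
  ...   | js , p , len = js , sym p , ≤-trans (n≤1+n _) (subst (_≤ n) (sym len) le)

  foldAll : List (Fin m) → Fin N → Fin N
  foldAll []       w = w
  foldAll (k ∷ ks) w = fold k (foldAll ks w)

  foldAll-length≤ : ∀ n ks w → HasLength≤ n w → HasLength≤ n (foldAll ks w)
  foldAll-length≤ n []       w l = l
  foldAll-length≤ n (k ∷ ks) w l = fold-length≤ n k _ (foldAll-length≤ n ks w l)

  foldAll-length : ∀ n ks w → HasLength≤ (suc n) w → (foldAll ks w ≡ w) ⊎ HasLength≤ n (foldAll ks w)
  foldAll-length n []       w l = inj₁ refl
  foldAll-length n (k ∷ ks) w l with foldAll-length n ks w l
  ... | inj₂ l' = inj₂ (fold-length≤ n k _ l')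
  ... | inj₁ eq rewrite eq = fold-length n k w l

  -- If the folds made before that at `j` have not shortened the element, they have not moved it.
  -- Then either the fold at `j` cancels the first letter, or the element is already on the near
  -- side of that wall and the word was not reduced.
  foldAll-shortens : ∀ n ks j is → j ∈ˡ ks → length is ≤ n → HasLength≤ n (foldAll ks (word (j ∷ is)))
  foldAll-shortens n (k ∷ ks) j is (there j∈) le = fold-length≤ n k _ (foldAll-shortens n ks j is j∈ le)
  foldAll-shortens n (j ∷ ks) .j is (here refl) le
    with foldAll-length n ks (word (j ∷ is)) (j ∷ is , refl , s≤s le)
  ... | inj₂ l = fold-length≤ n j _ l
  ... | inj₁ eq rewrite eq with side j (word (j ∷ is)) in eq'
  ...   | true  = is , sym (s-cancelˡ j (word is)) , le
  ...   | false with head-side-false j is eq'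
  ...     | js , p , len = js , sym p , ≤-trans (n≤1+n _) (subst (_≤ n) (sym len) le)

  foldAll-++ : ∀ ks ls w → foldAll (ks ++ ls) w ≡ foldAll ks (foldAll ls w)
  foldAll-++ []       ls w = refl
  foldAll-++ (k ∷ ks) ls w = cong (fold k) (foldAll-++ ks ls w)

  -- One pass over all generators removes at least one letter from any nonempty word, so `n` passes
  -- bring every element with a word of at most `n` letters to `e`.
  sweeps : ℕ → List (Fin m)
  sweeps zero    = []
  sweeps (suc n) = sweeps n ++ allFin m

  sweeps-e : ∀ n w → HasLength≤ n w → foldAll (sweeps n) w ≡ e
  sweeps-e zero    w ([] , refl , _) = refl
  sweeps-e (suc n) w (is , eq , le) = trans (foldAll-++ (sweeps n) (allFin m) w)
    (sweeps-e n _ (shorter is eq le))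
    where
    shorter : ∀ is → word is ≡ w → length is ≤ suc n → HasLength≤ n (foldAll (allFin m) w)
    shorter []       refl le = foldAll-length≤ n (allFin m) w ([] , refl , z≤n)
    shorter (j ∷ js) refl (s≤s le) = foldAll-shortens n (allFin m) j js (∈-allFin j) le

  -- Any common bound on the lengths of the chosen words will do; the sum is the simplest.
  maxLength : ℕ
  maxLength = ∑ (allFin N) (λ w → length (proj₁ (word-of w)))

  total : List (Fin m)
  total = sweeps maxLength

  total-e : ∀ w → foldAll total w ≡ e
  total-e w = sweeps-e maxLength w
    (proj₁ (word-of w) , proj₂ (word-of w) , term≤∑ (λ w → length (proj₁ (word-of w))) w)

-- The folding inequality

module Gluing {A : Set} (FA : Finite A) where
  open Functions FA public
  private module A = Finite FA

  DependsOn : ∀ {v} → (Fin v → Bool) → ((Fin v → A) → ℕ) → Set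
  DependsOn P h = ∀ φ ψ → (∀ u → P u ≡ true → φ u ≡ ψ u) → h φ ≡ h ψ

  -- Once the values on `P` are fixed, `f` and `g` look at disjoint sets of coordinates, so a pair
  -- of extensions can be merged into a single map. Each factor `A.card ^ v` counts the coordinates
  -- that one use of `mix` ignores.
  glue : ∀ {v} (P Q : Fin v → Bool) (f g : (Fin v → A) → ℕ) →
    DependsOn (λ u → P u ∨ Q u) f → DependsOn (λ u → P u ∨ not (Q u)) g →
    ∑ (funs v) (λ z → ∑ (funs v) (λ φ → f (mix P z φ)) * ∑ (funs v) (λ ψ → g (mix P z ψ)))
      ≡ A.card ^ v * (A.card ^ v * ∑ (funs v) (λ φ → f φ * g φ))
  glue {v} P Q f g fP gP = begin
    ∑ Φ (λ z → ∑ Φ (λ φ → f (mix P z φ)) * ∑ Φ (λ ψ → g (mix P z ψ)))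
      ≡⟨ ∑-cong Φ (λ z → ∑-*-∑ Φ Φ _ _) ⟩
    ∑ Φ (λ z → ∑ Φ (λ φ → ∑ Φ (λ ψ → f (mix P z φ) * g (mix P z ψ))))
      ≡⟨ ∑-cong Φ (λ z → ∑-cong Φ (λ φ → ∑-cong Φ (λ ψ → cong₂ _*_
           (fP _ _ (left z φ ψ)) (gP _ _ (right z φ ψ))))) ⟩
    ∑ Φ (λ z → ∑ Φ (λ φ → ∑ Φ (λ ψ → fg (mix P z (mix Q φ ψ)))))
      ≡⟨ ∑-cong Φ (λ z → ∑-mix Q (λ χ → fg (mix P z χ)) (λ e → fg-ext (mix-cong z e))) ⟩
    ∑ Φ (λ z → A.card ^ v * ∑ Φ (λ χ → fg (mix P z χ)))
      ≡⟨ ∑-*ˡ Φ (A.card ^ v) _ ⟩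
    A.card ^ v * ∑ Φ (λ z → ∑ Φ (λ χ → fg (mix P z χ)))
      ≡⟨ cong (A.card ^ v *_) (∑-mix P fg fg-ext) ⟩
    A.card ^ v * (A.card ^ v * ∑ Φ fg) ∎
    where
    open ≡-Reasoning
    Φ = funs v
    fg : (Fin v → A) → ℕ
    fg φ = f φ * g φ
    fg-ext : Ext fg
    fg-ext e = cong₂ _*_ (fP _ _ (λ u _ → e u)) (gP _ _ (λ u _ → e u))
    mix-cong : ∀ z {φ ψ} → φ ≗ ψ → mix P z φ ≗ mix P z ψ
    mix-cong z e u with P u
    ... | true  = refl
    ... | false = e u
    left : ∀ z φ ψ u → P u ∨ Q u ≡ true → mix P z φ u ≡ mix P z (mix Q φ ψ) u
    left z φ ψ u eq with P u | Q u
    ... | true  | _    = refl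
    ... | false | true = refl
    right : ∀ z φ ψ u → P u ∨ not (Q u) ≡ true → mix P z ψ u ≡ mix P z (mix Q φ ψ) u
    right z φ ψ u eq with P u | Q u
    ... | true  | _     = refl
    ... | false | false = refl

module CosetGeometry {N m : ℕ} (G : FinGroup N) (s : Fin m → Fin N) (M : Fin m → Fin m → ℕ)
                     (cox : IsCoxeterSystem G s M) where
  open Coxeter G s M cox public

  Fixes : {V : Set} → (Fin N → V) → Fin m → Set
  Fixes γ k = ∀ x → γ (x · s k) ≡ γ x

  -- Abstracts the map from `w` to its coset of a parabolic subgroup. The field `gallery` says that
  -- a coset is connected through right multiplication by generators of the subgroup.
  record Orbit {V : Set} (act : Fin N → V → V) (γ : Fin N → V) : Set where
    field
      equivariant : ∀ g w → γ (g · w) ≡ act g (γ w)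
      gallery     : ∀ w w' → γ w ≡ γ w' → Σ (List (Fin m)) λ is → All (Fixes γ) is × w · word is ≡ w'

    -- A crossing inside a coset gives `s k · x ≡ x · s i` with `s i` in the parabolic subgroup, so
    -- the reflection would fix the coset.
    same-side : ∀ k x is → All (Fixes γ) is → γ (s k · x) ≢ γ x → side k (x · word is) ≡ side k x
    same-side k x []       []       ne = cong (side k) (identityʳ x)
    same-side k x (i ∷ is) (f ∷ fs) ne with side k (x · s i) Bool.≟ side k x
    ... | no crossed = ⊥-elim (ne (trans (cong γ (side-cross k x i crossed)) (f x)))
    ... | yes same = trans (cong (side k) (sym (assoc _ _ _)))
      (trans (same-side k (x · s i) is fs λ eq → ne (trans (sym (f (s k · x)))
                (trans (cong γ (assoc _ _ _)) (trans eq (f x))))) same)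

    same-side′ : ∀ k w w' → γ w ≡ γ w' → γ (s k · w) ≢ γ w → side k w' ≡ side k w
    same-side′ k w w' eq ne with gallery w w' eq
    ... | is , fs , refl = same-side k w is fs ne

  record CosetStructure (v : ℕ) : Set where
    field
      act   : Fin N → Fin v → Fin v
      α β   : Fin N → Fin v
      orbitα : Orbit act α
      orbitβ : Orbit act β
      rep   : Fin v → Fin N
      cover : ∀ u → (u ≡ α (rep u)) ⊎ (u ≡ β (rep u))
      α≢β   : ∀ w w' → α w ≢ β w'

    module A = Orbit orbitα
    module B = Orbit orbitβ

    act-cancel : ∀ g h → g · h ≡ e → ∀ u → act g (act h u) ≡ u
    act-cancel g h gh u with cover u
    ... | inj₁ eq = trans (cong (act g ∘ act h) eq) (trans (cong (act g) (sym (A.equivariant h _)))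
                      (trans (sym (A.equivariant g _)) (trans (cong α (trans (sym (assoc _ _ _))
                        (trans (cong (_· rep u) gh) (identityˡ _)))) (sym eq))))
    ... | inj₂ eq = trans (cong (act g ∘ act h) eq) (trans (cong (act g) (sym (B.equivariant h _)))
                      (trans (sym (B.equivariant g _)) (trans (cong β (trans (sym (assoc _ _ _))
                        (trans (cong (_· rep u) gh) (identityˡ _)))) (sym eq))))

    -- The choice of `rep` does not matter: a coset meeting both sides of the wall is fixed by the
    -- reflection.
    foldV unfoldV : Fin m → Fin v → Fin v
    foldV   k u = if side k (rep u) then act (s k) u else u
    unfoldV k u = if side k (rep u) then u else act (s k) u

    -- A vertex not fixed by a reflection lies, as a coset, strictly on one side of its wall.
    α-side : ∀ k w → (act (s k) (α w) ≡ α w) ⊎ (side k (rep (α w)) ≡ side k w)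
    α-side k w with act (s k) (α w) Fin.≟ α w
    ... | yes eq = inj₁ eq
    ... | no ne with cover (α w)
    ...   | inj₁ eq = inj₂ (A.same-side′ k w _ eq (ne ∘ trans (sym (A.equivariant _ _))))
    ...   | inj₂ eq = ⊥-elim (α≢β _ _ eq)

    β-side : ∀ k w → (act (s k) (β w) ≡ β w) ⊎ (side k (rep (β w)) ≡ side k w)
    β-side k w with act (s k) (β w) Fin.≟ β w
    ... | yes eq = inj₁ eq
    ... | no ne with cover (β w)
    ...   | inj₂ eq = inj₂ (B.same-side′ k w _ eq (ne ∘ trans (sym (B.equivariant _ _))))
    ...   | inj₁ eq = ⊥-elim (α≢β _ _ (sym eq))

    module FoldVertex (γ : Fin N → Fin v) (orbit : Orbit act γ)
      (γ-side : ∀ k w → (act (s k) (γ w) ≡ γ w) ⊎ (side k (rep (γ w)) ≡ side k w)) where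
      open Orbit orbit

      foldV-γ : ∀ k w → foldV k (γ w) ≡ γ (fold k w)
      foldV-γ k w with γ-side k w
      foldV-γ k w | inj₂ eq with side k (rep (γ w)) | side k w
      foldV-γ k w | inj₂ refl | true  | true  = sym (equivariant _ _)
      foldV-γ k w | inj₂ refl | false | false = refl
      foldV-γ k w | inj₁ eq with side k (rep (γ w)) | side k w
      ... | true  | true  = sym (equivariant _ _)
      ... | true  | false = eq
      ... | false | true  = sym (trans (equivariant _ _) eq)
      ... | false | false = refl

      unfoldV-γ : ∀ k w → unfoldV k (γ w) ≡ γ (unfold k w)
      unfoldV-γ k w with γ-side k w
      unfoldV-γ k w | inj₂ eq with side k (rep (γ w)) | side k w
      unfoldV-γ k w | inj₂ refl | true  | true  = refl
      unfoldV-γ k w | inj₂ refl | false | false = sym (equivariant _ _)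
      unfoldV-γ k w | inj₁ eq with side k (rep (γ w)) | side k w
      ... | true  | true  = refl
      ... | true  | false = sym (trans (equivariant _ _) eq)
      ... | false | true  = eq
      ... | false | false = sym (equivariant _ _)

    open FoldVertex α orbitα α-side public renaming (foldV-γ to foldV-α; unfoldV-γ to unfoldV-α)
    open FoldVertex β orbitβ β-side public renaming (foldV-γ to foldV-β; unfoldV-γ to unfoldV-β)

    module Homs {X : Set} (FX : Finite X) where
      open Gluing FX public
      module X = Finite FX

      -- The product runs over chambers rather than edges, so that folding acts on the index `w` of
      -- the factors. An edge is repeated once for each chamber representing it, which does no harm
      -- to factors with values 0 and 1.
      weight : (Fin N → X → X → ℕ) → (Fin v → X) → ℕ
      weight F φ = ∏ (λ w → F w (φ (α w)) (φ (β w)))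

      weight-ext : ∀ F → Ext (weight F)
      weight-ext F e = ∏-cong (λ w → cong₂ (F w) (e (α w)) (e (β w)))

      -- The parameter `ζ` is summed outside the product; Cauchy-Schwarz will run over it together
      -- with the values on the fixed vertices. It later serves as the common image of the vertices
      -- being identified.
      count : {Z : Set} → List Z → (Z → Fin N → X → X → ℕ) → ℕ
      count Zs F = ∑ Zs (λ ζ → ∑ (funs v) (weight (F ζ)))

      count-cong : {Z : Set} (Zs : List Z) {F F' : Z → Fin N → X → X → ℕ} →
        (∀ ζ w x y → F ζ w x y ≡ F' ζ w x y) → count Zs F ≡ count Zs F'
      count-cong Zs eq = ∑-cong Zs (λ ζ → ∑-cong (funs v) (λ φ → ∏-cong (λ w → eq ζ w _ _)))

      -- Conditioning on the image of the fixed vertices makes the two halves independent.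
      module _ .{{_ : NonZero X.card}} {Z : Set} (Zs : List Z) (F : Z → Fin N → X → X → ℕ) (k : Fin m) where
        private
          t : Fin v → Fin v
          t = act (s k)

          t-involutive : ∀ u → t (t u) ≡ u
          t-involutive = act-cancel (s k) (s k) (s-involutive k)

          fixed near : Fin v → Bool
          fixed u = does (t u Fin.≟ u)
          near u = not (side k (rep u))

          c : ℕ
          c = X.card ^ v

          lower upper : Z → Fin N → X → X → ℕ
          lower ζ w x y = if side k w then 1 else F ζ w x y
          upper ζ w x y = if side k w then F ζ w x y else 1

          -- Mirror images of `lower` and `upper`. The original factors are `lower` times `upper`,
          -- the folded ones `lower` times `lowerᵗ`, the unfolded ones `upperᵗ` times `upper`.
          lowerᵗ upperᵗ : Z → Fin N → X → X → ℕ
          lowerᵗ ζ w x y = if side k w then F ζ (s k · w) x y else 1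
          upperᵗ ζ w x y = if side k w then 1 else F ζ (s k · w) x y

          t-fixed : ∀ u → fixed (t u) ≡ fixed u
          t-fixed u = does-⇔ (t (t u) Fin.≟ t u) (t u Fin.≟ u)
            (λ eq → trans (sym eq) (t-involutive u)) (cong t)

          fixed⇒ : ∀ u → fixed u ≡ true → t u ≡ u
          fixed⇒ u eq with t u Fin.≟ u
          ... | yes e = e

          αβ-visible : (Q : Fin v → Bool) (w : Fin N) → (∀ u → side k (rep u) ≡ side k w → Q u ≡ true) →
            (fixed (α w) ∨ Q (α w) ≡ true) × (fixed (β w) ∨ Q (β w) ≡ true)
          αβ-visible Q w Qw = visible (α w) (α-side k w) , visible (β w) (β-side k w)
            where
            visible : ∀ u → (t u ≡ u) ⊎ (side k (rep u) ≡ side k w) → fixed u ∨ Q u ≡ true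
            visible u (inj₁ eq) rewrite dec-true (t u Fin.≟ u) eq = refl
            visible u (inj₂ eq) rewrite Qw u eq = Bool.∨-zeroʳ (fixed u)

          -- A chamber on side `b` has only vertices that are fixed by the reflection or have their
          -- representative on side `b`; all other chambers contribute the factor 1.
          depends : (Q : Fin v → Bool) (H : Fin N → X → X → ℕ) (b : Bool) →
            (∀ u → side k (rep u) ≡ b → Q u ≡ true) → (∀ w → side k w ≢ b → ∀ x y → H w x y ≡ 1) →
            DependsOn (λ u → fixed u ∨ Q u) (weight H)
          depends Q H b Qb trivial φ ψ agree = ∏-cong pointwise
            where
            pointwise : ∀ w → H w (φ (α w)) (φ (β w)) ≡ H w (ψ (α w)) (ψ (β w))
            pointwise w with side k w Bool.≟ b
            ... | no ne = trans (trivial w ne _ _) (sym (trivial w ne _ _))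
            ... | yes eq with αβ-visible Q w (λ u e → Qb u (trans e eq))
            ...   | p , q = cong₂ (H w) (agree (α w) p) (agree (β w) q)

          trivial-lower : ∀ ζ w → side k w ≢ false → ∀ x y → lower ζ w x y ≡ 1
          trivial-lower ζ w ne x y with side k w
          ... | true  = refl
          ... | false = ⊥-elim (ne refl)
          trivial-upper : ∀ ζ w → side k w ≢ true → ∀ x y → upper ζ w x y ≡ 1
          trivial-upper ζ w ne x y with side k w
          ... | false = refl
          ... | true  = ⊥-elim (ne refl)
          trivial-lowerᵗ : ∀ ζ w → side k w ≢ true → ∀ x y → lowerᵗ ζ w x y ≡ 1
          trivial-lowerᵗ ζ w ne x y with side k w
          ... | false = refl
          ... | true  = ⊥-elim (ne refl)
          trivial-upperᵗ : ∀ ζ w → side k w ≢ false → ∀ x y → upperᵗ ζ w x y ≡ 1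
          trivial-upperᵗ ζ w ne x y with side k w
          ... | true  = refl
          ... | false = ⊥-elim (ne refl)

          near-lower : ∀ u → side k (rep u) ≡ false → near u ≡ true
          near-lower u eq rewrite eq = refl
          near-upper : ∀ u → side k (rep u) ≡ true → not (near u) ≡ true
          near-upper u eq rewrite eq = refl

          dep-lower : ∀ ζ → DependsOn (λ u → fixed u ∨ near u) (weight (lower ζ))
          dep-lower ζ = depends near (lower ζ) false near-lower (trivial-lower ζ)
          dep-upper : ∀ ζ → DependsOn (λ u → fixed u ∨ not (near u)) (weight (upper ζ))
          dep-upper ζ = depends (not ∘ near) (upper ζ) true near-upper (trivial-upper ζ)
          dep-lowerᵗ : ∀ ζ → DependsOn (λ u → fixed u ∨ not (near u)) (weight (lowerᵗ ζ))
          dep-lowerᵗ ζ = depends (not ∘ near) (lowerᵗ ζ) true near-upper (trivial-lowerᵗ ζ)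
          dep-upperᵗ : ∀ ζ → DependsOn (λ u → fixed u ∨ near u) (weight (upperᵗ ζ))
          dep-upperᵗ ζ = depends near (upperᵗ ζ) false near-lower (trivial-upperᵗ ζ)

          reflected : (H Hᵗ : Fin N → X → X → ℕ) → (∀ w x y → H (s k · w) x y ≡ Hᵗ w x y) →
            ∀ φ → weight H (φ ∘ t) ≡ weight Hᵗ φ
          reflected H Hᵗ eq φ = begin
            ∏ (λ w → H w (φ (t (α w))) (φ (t (β w))))
              ≡⟨ sym (∏-reindex (s k ·_) (s k ·_) (s-cancelˡ k) (s-cancelˡ k) _) ⟩
            ∏ (λ w → H (s k · w) (φ (t (α (s k · w)))) (φ (t (β (s k · w)))))
              ≡⟨ ∏-cong (λ w → trans (cong₂ (λ a b → H (s k · w) (φ a) (φ b))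
                   (trans (cong t (A.equivariant _ _)) (t-involutive _)) (trans (cong t (B.equivariant _ _)) (t-involutive _)))
                   (eq w _ _)) ⟩
            ∏ (λ w → Hᵗ w (φ (α w)) (φ (β w))) ∎
            where open ≡-Reasoning

          lower-reflected : ∀ ζ w x y → lower ζ (s k · w) x y ≡ lowerᵗ ζ w x y
          lower-reflected ζ w x y rewrite side-reflect k w with side k w
          ... | true  = refl
          ... | false = refl
          upper-reflected : ∀ ζ w x y → upper ζ (s k · w) x y ≡ upperᵗ ζ w x y
          upper-reflected ζ w x y rewrite side-reflect k w with side k w
          ... | true  = refl
          ... | false = refl

          half : (Fin N → X → X → ℕ) → (Fin v → X) → ℕ
          half H z = ∑ (funs v) (λ φ → weight H (mix fixed z φ))

          -- Precomposition with the reflection permutes the extensions of `z` and keeps their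
          -- values on the fixed vertices.
          half-reflected : (H Hᵗ : Fin N → X → X → ℕ) → (∀ w x y → H (s k · w) x y ≡ Hᵗ w x y) →
            ∀ z → half H z ≡ half Hᵗ z
          half-reflected H Hᵗ eq z = begin
            ∑ (funs v) (λ φ → weight H (mix fixed z φ))
              ≡⟨ sym (∑-precompose t t t-involutive t-involutive (λ φ → weight H (mix fixed z φ)) (λ e → weight-ext H (mix-ext e))) ⟩
            ∑ (funs v) (λ φ → weight H (mix fixed z (φ ∘ t)))
              ≡⟨ ∑-cong (funs v) (λ φ → trans (weight-ext H (mix-t φ)) (reflected H Hᵗ eq (mix fixed z φ))) ⟩
            ∑ (funs v) (λ φ → weight Hᵗ (mix fixed z φ)) ∎
            where
            open ≡-Reasoning
            mix-ext : ∀ {φ ψ} → φ ≗ ψ → mix fixed z φ ≗ mix fixed z ψ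
            mix-ext e u with fixed u
            ... | true  = refl
            ... | false = e u
            mix-t : ∀ φ → mix fixed z (φ ∘ t) ≗ (mix fixed z φ ∘ t)
            mix-t φ u rewrite t-fixed u with fixed u in eq
            ... | true  = cong z (sym (fixed⇒ u eq))
            ... | false = refl

          merge : ∀ ζ (H H' : Fin N → X → X → ℕ) →
            DependsOn (λ u → fixed u ∨ near u) (weight H) →
            DependsOn (λ u → fixed u ∨ not (near u)) (weight H') →
            ∑ (funs v) (λ z → half H z * half H' z) ≡ c * c * ∑ (funs v) (weight (λ w x y → H w x y * H' w x y))
          merge ζ H H' dep dep' = trans (glue fixed near (weight H) (weight H') dep dep')
            (trans (sym (*-assoc c c _)) (cong (c * c *_) (∑-cong (funs v) (λ φ → sym (∏-*
              (λ w → H w (φ (α w)) (φ (β w))) (λ w → H' w (φ (α w)) (φ (β w))))))))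

          Zφ : List (Z × (Fin v → X))
          Zφ = cartesianProduct Zs (funs v)

          collect : (H H' K : Z → Fin N → X → X → ℕ) →
            (∀ ζ → DependsOn (λ u → fixed u ∨ near u) (weight (H ζ))) →
            (∀ ζ → DependsOn (λ u → fixed u ∨ not (near u)) (weight (H' ζ))) →
            (∀ ζ w x y → H ζ w x y * H' ζ w x y ≡ K ζ w x y) →
            ∑ Zφ (λ (ζ , z) → half (H ζ) z * half (H' ζ) z) ≡ c * c * count Zs K
          collect H H' K dep dep' eq =
            trans (∑-cartesian _,_ Zs (funs v) _) (trans
              (∑-cong Zs (λ ζ → trans (merge ζ (H ζ) (H' ζ) (dep ζ) (dep' ζ))
                (cong (c * c *_) (∑-cong (funs v) (λ φ → ∏-cong (λ w → eq ζ w _ _))))))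
              (∑-*ˡ Zs (c * c) _))

        -- Cauchy-Schwarz over pairs of a parameter and an assignment to the fixed vertices.
        -- Assignments are padded to all of `Fin v`; the powers of `c` count the padding and cancel.
        fold-inequality : count Zs F * count Zs F
          ≤ count Zs (λ ζ w → F ζ (fold k w)) * count Zs (λ ζ w → F ζ (unfold k w))
        fold-inequality = *-cancelˡ-≤ (c * c * (c * c)) (begin
          c * c * (c * c) * (n₀ * n₀)
            ≡⟨ rearrange (c * c) n₀ n₀ ⟩
          (c * c * n₀) * (c * c * n₀)
            ≡⟨ sym (cong₂ _*_ split split) ⟩
          ∑ Zφ (λ i → p i * q i) * ∑ Zφ (λ i → p i * q i)
            ≤⟨ cauchy-schwarz Zφ p q ⟩
          ∑ Zφ (λ i → p i * p i) * ∑ Zφ (λ i → q i * q i)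
            ≡⟨ cong₂ _*_ split₊ split₋ ⟩
          (c * c * n₊) * (c * c * n₋)
            ≡⟨ sym (rearrange (c * c) n₊ n₋) ⟩
          c * c * (c * c) * (n₊ * n₋) ∎)
          where
          open ≤-Reasoning
          instance
            c≢0 : NonZero c
            c≢0 = m^n≢0 X.card v
            cc≢0 : NonZero (c * c)
            cc≢0 = m*n≢0 c c
            cccc≢0 : NonZero (c * c * (c * c))
            cccc≢0 = m*n≢0 (c * c) (c * c)
          rearrange : ∀ a b d → a * a * (b * d) ≡ a * b * (a * d)
          rearrange = solve-∀
          n₀ = count Zs F
          n₊ = count Zs (λ ζ w → F ζ (fold k w))
          n₋ = count Zs (λ ζ w → F ζ (unfold k w))
          p q : Z × (Fin v → X) → ℕ
          p (ζ , z) = half (lower ζ) z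
          q (ζ , z) = half (upper ζ) z
          split : ∑ Zφ (λ i → p i * q i) ≡ c * c * n₀
          split = collect lower upper F dep-lower dep-upper whole
            where
            whole : ∀ ζ w x y → lower ζ w x y * upper ζ w x y ≡ F ζ w x y
            whole ζ w x y with side k w
            ... | true  = *-identityˡ _
            ... | false = *-identityʳ _
          split₊ : ∑ Zφ (λ i → p i * p i) ≡ c * c * n₊
          split₊ = trans (∑-cong Zφ (λ (ζ , z) → cong (half (lower ζ) z *_)
              (half-reflected (lower ζ) (lowerᵗ ζ) (lower-reflected ζ) z)))
            (collect lower lowerᵗ _ dep-lower dep-lowerᵗ whole)
            where
            whole : ∀ ζ w x y → lower ζ w x y * lowerᵗ ζ w x y ≡ F ζ (fold k w) x y
            whole ζ w x y with side k w
            ... | true  = *-identityˡ _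
            ... | false = *-identityʳ _
          split₋ : ∑ Zφ (λ i → q i * q i) ≡ c * c * n₋
          split₋ = trans (∑-cong Zφ (λ (ζ , z) → cong (_* half (upper ζ) z)
              (half-reflected (upper ζ) (upperᵗ ζ) (upper-reflected ζ) z)))
            (collect upperᵗ upper _ dep-upperᵗ dep-upper whole)
            where
            whole : ∀ ζ w x y → upperᵗ ζ w x y * upper ζ w x y ≡ F ζ (unfold k w) x y
            whole ζ w x y with side k w
            ... | true  = *-identityˡ _
            ... | false = *-identityʳ _

-- The Sidorenko-type lower bound

*-^ : ∀ a b n → (a * b) ^ n ≡ a ^ n * b ^ n
*-^ a b zero    = refl
*-^ a b (suc n) = trans (cong (a * b *_) (*-^ a b n)) (lemma a b (a ^ n) (b ^ n))
  where
  lemma : ∀ a b c d → a * b * (c * d) ≡ a * c * (b * d)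
  lemma = solve-∀

^-cancelʳ-≤ : ∀ n .{{_ : NonZero n}} a b → a ^ n ≤ b ^ n → a ≤ b
^-cancelʳ-≤ n a b le with ≤-<-connex a b
... | inj₁ a≤b = a≤b
... | inj₂ b<a = ⊥-elim (<⇒≱ (^-monoˡ-< n b<a) le)

square≤⇒≤ : ∀ b x → b * b ≤ x * b → b ≤ x
square≤⇒≤ zero    x le = z≤n
square≤⇒≤ (suc b) x le = *-cancelʳ-≤ (suc b) x (suc b) le

⟦⟧≤1 : ∀ b → ⟦ b ⟧ ≤ 1
⟦⟧≤1 true  = ≤-refl
⟦⟧≤1 false = z≤n

⟦⟧-pos : ∀ b → 0 < ⟦ b ⟧ → b ≡ true
⟦⟧-pos true _ = refl

∑-pos : {A : Set} (xs : List A) (f : A → ℕ) → 0 < ∑ xs f → Σ A λ x → 0 < f x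
∑-pos (x ∷ xs) f pos with f x in eq
... | suc _ = x , subst (0 <_) (sym eq) (s≤s z≤n)
... | zero  = ∑-pos xs f pos

∏-pos : ∀ {n} (f : Fin n → ℕ) → 0 < ∏ f → ∀ i → 0 < f i
∏-pos f pos i with f i in eq
... | suc _ = s≤s z≤n
... | zero  = ⊥-elim (<-irrefl (sym (∏-factor-zero f i eq)) pos)

∏-all-1 : ∀ {n} (f : Fin n → ℕ) → (∀ i → f i ≡ 1) → ∏ f ≡ 1
∏-all-1 {n} f eq = trans (∏-cong eq) (∏-1 n)

∏≤1 : ∀ {n} (f : Fin n → ℕ) → (∀ i → f i ≤ 1) → ∏ f ≤ 1
∏≤1 {n} f le = ≤-trans (∏-mono le) (≤-reflexive (∏-1 n))

∏≤factor : ∀ {n} (f : Fin n → ℕ) → (∀ i → f i ≤ 1) → ∀ i → ∏ f ≤ f i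
∏≤factor {suc n} f le zero    = ≤-trans (*-monoʳ-≤ (f zero) (∏≤1 (f ∘ suc) (le ∘ suc))) (≤-reflexive (*-identityʳ _))
∏≤factor {suc n} f le (suc i) = ≤-trans (*-monoˡ-≤ _ (le zero)) (≤-trans (≤-reflexive (*-identityˡ _)) (∏≤factor (f ∘ suc) (le ∘ suc) i))

∑-⟦⟧+∑-not : ∀ {n} (b : Fin n → Bool) → ∑ (allFin n) (λ i → ⟦ b i ⟧) + ∑ (allFin n) (λ i → ⟦ not (b i) ⟧) ≡ n
∑-⟦⟧+∑-not {n} b = trans (sym (∑-+ (allFin n) _ _)) (trans (∑-cong (allFin n) (λ i → one (b i))) (∑-allFin-1 n))
  where
  one : ∀ b → ⟦ b ⟧ + ⟦ not b ⟧ ≡ 1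
  one true  = refl
  one false = refl

∏-if : ∀ {n} (b : Fin n → Bool) (d : ℕ) → ∏ (λ i → if b i then 1 else d) ≡ d ^ ∑ (allFin n) (λ i → ⟦ not (b i) ⟧)
∏-if {zero}  b d = refl
∏-if {suc n} b d = trans (cong ((if b zero then 1 else d) *_) (∏-if (b ∘ suc) d))
  (trans head (cong (d ^_) (sym (∑-allFin-suc n (λ i → ⟦ not (b i) ⟧)))))
  where
  r = ∑ (allFin n) (λ i → ⟦ not (b (suc i)) ⟧)
  head : (if b zero then 1 else d) * d ^ r ≡ d ^ (⟦ not (b zero) ⟧ + r)
  head with b zero
  ... | true  = *-identityˡ _
  ... | false = refl

maximum : ∀ v (f : (Fin v → Bool) → ℕ) → (∀ {φ ψ} → φ ≗ ψ → f φ ≡ f ψ) →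
  Σ (Fin v → Bool) λ Q → ∀ R → f R ≤ f Q
maximum zero    f ext = (λ ()) , λ R → ≤-reflexive (ext (λ ()))
maximum (suc v) f ext
  with maximum v (λ φ → f (true VF.∷ φ)) (λ e → ext (λ { zero → refl ; (suc i) → e i }))
     | maximum v (λ φ → f (false VF.∷ φ)) (λ e → ext (λ { zero → refl ; (suc i) → e i }))
... | Q₁ , max₁ | Q₀ , max₀ with ≤-total (f (true VF.∷ Q₁)) (f (false VF.∷ Q₀))
...   | inj₁ le = false VF.∷ Q₀ , bound
  where
  bound : ∀ R → f R ≤ f (false VF.∷ Q₀)
  bound R with R zero in eq
  ... | true  = ≤-trans (≤-reflexive (ext λ { zero → eq ; (suc i) → refl })) (≤-trans (max₁ (R ∘ suc)) le)
  ... | false = ≤-trans (≤-reflexive (ext λ { zero → eq ; (suc i) → refl })) (max₀ (R ∘ suc))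
...   | inj₂ le = true VF.∷ Q₁ , bound
  where
  bound : ∀ R → f R ≤ f (true VF.∷ Q₁)
  bound R with R zero in eq
  ... | true  = ≤-trans (≤-reflexive (ext λ { zero → eq ; (suc i) → refl })) (max₁ (R ∘ suc))
  ... | false = ≤-trans (≤-reflexive (ext λ { zero → eq ; (suc i) → refl })) (≤-trans (max₀ (R ∘ suc)) le)

module Marginals {A : Set} (FA : Finite A) where
  open Gluing FA
  private module A = Finite FA

  -- The value of a uniformly random map at `a` is uniform, with denominators cleared.
  marginal : ∀ {v} (f : A → ℕ) (a : Fin v) → A.card * ∑ (funs v) (λ φ → f (φ a)) ≡ A.card ^ v * ∑ A.elems f
  marginal {suc v} f zero = begin
    A.card * ∑ (funs (suc v)) (λ φ → f (φ zero))
      ≡⟨ cong (A.card *_) (trans (∑-cartesian VF._∷_ A.elems (funs v) _)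
           (trans (∑-cong A.elems (λ x → trans (∑-const (funs v) (f x)) (cong (_* f x) (∑-funs-1 v))))
             (∑-*ˡ A.elems (A.card ^ v) f))) ⟩
    A.card * (A.card ^ v * ∑ A.elems f)
      ≡⟨ sym (*-assoc A.card _ _) ⟩
    A.card * A.card ^ v * ∑ A.elems f ∎
    where open ≡-Reasoning
  marginal {suc v} f (suc a) = begin
    A.card * ∑ (funs (suc v)) (λ φ → f (φ (suc a)))
      ≡⟨ cong (A.card *_) (trans (∑-cartesian VF._∷_ A.elems (funs v) _) (trans (∑-const A.elems _) (marginal f a))) ⟩
    A.card * (A.card ^ v * ∑ A.elems f)
      ≡⟨ sym (*-assoc A.card _ _) ⟩
    A.card * A.card ^ v * ∑ A.elems f ∎
    where open ≡-Reasoning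

  -- The values at two distinct points are independent: splice the value of one map at `a` into
  -- another map and average over both.
  joint-marginal : .{{_ : NonZero A.card}} → ∀ {v} (g : A → A → ℕ) (a b : Fin v) → a ≢ b →
    A.card * A.card * ∑ (funs v) (λ φ → g (φ a) (φ b)) ≡ A.card ^ v * ∑ A.elems (λ x → ∑ A.elems (g x))
  joint-marginal {v} g a b a≢b = *-cancelˡ-≡ _ _ (A.card ^ v) {{m^n≢0 A.card v}} (begin
    c ^ v * (c * c * ∑ Φ (λ φ → g (φ a) (φ b)))
      ≡⟨ exchange (c ^ v) (c * c) _ ⟩
    c * c * (c ^ v * ∑ Φ (λ φ → g (φ a) (φ b)))
      ≡⟨ cong (c * c *_) (sym (∑-mix P (λ φ → g (φ a) (φ b)) (λ e → cong₂ g (e a) (e b)))) ⟩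
    c * c * ∑ Φ (λ φ → ∑ Φ (λ ψ → g (mix P φ ψ a) (mix P φ ψ b)))
      ≡⟨ cong (c * c *_) (∑-cong Φ (λ φ → ∑-cong Φ (λ ψ → cong₂ g (at-a φ ψ) (at-b φ ψ)))) ⟩
    c * c * ∑ Φ (λ φ → ∑ Φ (λ ψ → g (φ a) (ψ b)))
      ≡⟨ trans (*-assoc c c _) (cong (c *_) (sym (∑-*ˡ Φ c _))) ⟩
    c * ∑ Φ (λ φ → c * ∑ Φ (λ ψ → g (φ a) (ψ b)))
      ≡⟨ cong (c *_) (trans (∑-cong Φ (λ φ → marginal (g (φ a)) b)) (∑-*ˡ Φ (c ^ v) _)) ⟩
    c * (c ^ v * ∑ Φ (λ φ → ∑ A.elems (g (φ a))))
      ≡⟨ exchange c (c ^ v) _ ⟩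
    c ^ v * (c * ∑ Φ (λ φ → ∑ A.elems (g (φ a))))
      ≡⟨ cong (c ^ v *_) (marginal (λ x → ∑ A.elems (g x)) a) ⟩
    c ^ v * (c ^ v * ∑ A.elems (λ x → ∑ A.elems (g x))) ∎)
    where
    open ≡-Reasoning
    c = A.card
    Φ = funs v
    P : Fin v → Bool
    P u = does (u Fin.≟ a)
    exchange : ∀ x y z → x * (y * z) ≡ y * (x * z)
    exchange = solve-∀
    at-a : ∀ φ ψ → mix P φ ψ a ≡ φ a
    at-a φ ψ rewrite dec-true (a Fin.≟ a) refl = refl
    at-b : ∀ φ ψ → mix P φ ψ b ≡ ψ b
    at-b φ ψ rewrite dec-false (b Fin.≟ a) (a≢b ∘ sym) = refl

module Domination {N m : ℕ} (G : FinGroup N) (s : Fin m → Fin N) (M : Fin m → Fin m → ℕ)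
  (cox : IsCoxeterSystem G s M) {v : ℕ} (C : CosetGeometry.CosetStructure G s M cox v) where
  open CosetGeometry G s M cox public
  open CosetStructure C public

  size : (Fin N → Bool) → ℕ
  size Q = ∑ (allFin N) (λ w → ⟦ Q w ⟧)

  -- For each `w`, the pair `fold k w`, `unfold k w` is the pair `w`, `s k · w` in some order.
  size-fold : ∀ k Q → size (Q ∘ fold k) + size (Q ∘ unfold k) ≡ size Q + size Q
  size-fold k Q = begin
    size (Q ∘ fold k) + size (Q ∘ unfold k)
      ≡⟨ sym (∑-+ (allFin N) _ _) ⟩
    ∑ (allFin N) (λ w → ⟦ Q (fold k w) ⟧ + ⟦ Q (unfold k w) ⟧)
      ≡⟨ ∑-cong (allFin N) pointwise ⟩
    ∑ (allFin N) (λ w → ⟦ Q w ⟧ + ⟦ Q (s k · w) ⟧)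
      ≡⟨ ∑-+ (allFin N) _ _ ⟩
    size Q + size (Q ∘ (s k ·_))
      ≡⟨ cong (size Q +_) (Finite.∑-bijection (finiteFin N) (s k ·_) (s k ·_) (s-cancelˡ k) (s-cancelˡ k) (λ w → ⟦ Q w ⟧)) ⟩
    size Q + size Q ∎
    where
    open ≡-Reasoning
    pointwise : ∀ w → ⟦ Q (fold k w) ⟧ + ⟦ Q (unfold k w) ⟧ ≡ ⟦ Q w ⟧ + ⟦ Q (s k · w) ⟧
    pointwise w with side k w
    ... | true  = +-comm ⟦ Q (s k · w) ⟧ ⟦ Q w ⟧
    ... | false = refl

  size-not : ∀ Q → size Q + size (not ∘ Q) ≡ N
  size-not = ∑-⟦⟧+∑-not

  -- The elements w whose chamber represents the same edge (wW_I, wW_J) as the identity.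
  edgeStabilizer : Fin N → Bool
  edgeStabilizer w = does (α w Fin.≟ α e) ∧ does (β w Fin.≟ β e)

  multiplicity : ℕ
  multiplicity = size edgeStabilizer

  multiplicity>0 : 0 < multiplicity
  multiplicity>0 = ≤-trans (≤-reflexive (sym (cong ⟦_⟧ (cong₂ _∧_ (dec-true (α e Fin.≟ α e) refl) (dec-true (β e Fin.≟ β e) refl)))))
    (term≤∑ (λ w → ⟦ edgeStabilizer w ⟧) e)

  isα : Fin v → Bool
  isα u = does (u Fin.≟ α (rep u))

  isα-α : ∀ w → isα (α w) ≡ true
  isα-α w with cover (α w)
  ... | inj₁ eq = dec-true (_ Fin.≟ _) eq
  ... | inj₂ eq = ⊥-elim (α≢β _ _ eq)

  isα-β : ∀ w → isα (β w) ≡ false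
  isα-β w = dec-false (_ Fin.≟ _) (α≢β _ _ ∘ sym)

  #α #β : ℕ
  #α = ∑ (allFin v) (λ u → ⟦ isα u ⟧)
  #β = ∑ (allFin v) (λ u → ⟦ not (isα u) ⟧)

  #α+#β : #α + #β ≡ v
  #α+#β = ∑-⟦⟧+∑-not isα

  module HomCounts {X : Set} (FX : Finite X) .{{_ : NonZero (Finite.card FX)}} (E : X → X → Bool) where
    open Homs FX public

    adjacency : Fin N → X → X → ℕ
    adjacency _ x y = ⟦ E x y ⟧

    hom : ℕ
    hom = ∑ (funs v) (weight adjacency)

    edgeMass : ℕ
    edgeMass = ∑ X.elems (λ x → ∑ X.elems (λ y → ⟦ E x y ⟧))

    edgeMass≤ : edgeMass ≤ X.card * X.card
    edgeMass≤ = ≤-trans (∑-mono X.elems (λ x → ∑-mono X.elems (λ y → ⟦⟧≤1 (E x y)))) (≤-reflexive (∑-const X.elems X.card))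

    partial : (Fin N → Bool) → Fin N → X → X → ℕ
    partial Q w x y = if Q w then ⟦ E x y ⟧ else 1

    homOn : (Fin N → Bool) → ℕ
    homOn Q = count (tt ∷ []) (λ _ → partial Q)

    homOn-ext : ∀ {Q R} → Q ≗ R → homOn Q ≡ homOn R
    homOn-ext e = count-cong (tt ∷ []) (λ _ w x y → cong (λ b → if b then ⟦ E x y ⟧ else 1) (e w))

    homOn-all : homOn (const true) ≡ hom
    homOn-all = +-identityʳ _

    homOn-none : homOn (const false) ≡ X.card ^ v
    homOn-none = trans (+-identityʳ _) (trans (∑-cong (funs v) (λ _ → ∏-1 N)) (∑-funs-1 v))

    private
      h₁ h₀ : ℕ
      h₁ = homOn (const true)
      h₀ = homOn (const false)

      -- The Nth power of homOn Q, normalised so that the two constant labellings have equal value.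
      score : (Fin N → Bool) → ℕ
      score Q = homOn Q ^ N * (h₁ ^ size (not ∘ Q) * h₀ ^ size Q)

      score-ext : ∀ {Q R} → Q ≗ R → score Q ≡ score R
      score-ext {Q} {R} e = cong₂ _*_ (cong (_^ N) (homOn-ext e)) (cong₂ (λ a b → h₁ ^ a * h₀ ^ b)
        (∑-cong (allFin N) (λ w → cong (⟦_⟧ ∘ not) (e w))) (∑-cong (allFin N) (λ w → cong ⟦_⟧ (e w))))

      -- The `N`th power of the folding inequality. The normalising powers of `h₁` and `h₀` agree on
      -- both sides because folding and unfolding together preserve the total size.
      score-fold : ∀ k Q → score Q * score Q ≤ score (Q ∘ fold k) * score (Q ∘ unfold k)
      score-fold k Q = begin
        score Q * score Q
          ≡⟨ combine (homOn Q) (homOn Q) (size (not ∘ Q)) (size Q) (size (not ∘ Q)) (size Q) ⟩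
        (homOn Q * homOn Q) ^ N * (h₁ ^ (size (not ∘ Q) + size (not ∘ Q)) * h₀ ^ (size Q + size Q))
          ≤⟨ *-monoˡ-≤ _ (^-monoˡ-≤ N (fold-inequality (tt ∷ []) (λ _ → partial Q) k)) ⟩
        (homOn Q₊ * homOn Q₋) ^ N * (h₁ ^ (size (not ∘ Q) + size (not ∘ Q)) * h₀ ^ (size Q + size Q))
          ≡⟨ cong₂ (λ a b → (homOn Q₊ * homOn Q₋) ^ N * (h₁ ^ a * h₀ ^ b))
               (sym (size-fold k (not ∘ Q))) (sym (size-fold k Q)) ⟩
        (homOn Q₊ * homOn Q₋) ^ N * (h₁ ^ (size (not ∘ Q₊) + size (not ∘ Q₋)) * h₀ ^ (size Q₊ + size Q₋))
          ≡⟨ sym (combine (homOn Q₊) (homOn Q₋) (size (not ∘ Q₊)) (size Q₊) (size (not ∘ Q₋)) (size Q₋)) ⟩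
        score Q₊ * score Q₋ ∎
        where
        open ≤-Reasoning
        Q₊ = Q ∘ fold k
        Q₋ = Q ∘ unfold k
        shuffle : ∀ a b c a' b' c' → a * (b * c) * (a' * (b' * c')) ≡ a * a' * (b * b' * (c * c'))
        shuffle = solve-∀
        combine : ∀ x y a b a' b' → x ^ N * (h₁ ^ a * h₀ ^ b) * (y ^ N * (h₁ ^ a' * h₀ ^ b'))
          ≡ (x * y) ^ N * (h₁ ^ (a + a') * h₀ ^ (b + b'))
        combine x y a b a' b' = trans (shuffle (x ^ N) (h₁ ^ a) (h₀ ^ b) (y ^ N) (h₁ ^ a') (h₀ ^ b'))
          (cong₂ _*_ (sym (*-^ x y N)) (cong₂ _*_ (sym (^-distribˡ-+-* h₁ a a')) (sym (^-distribˡ-+-* h₀ b b'))))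

      score-const : ∀ b → score (const b) ≡ h₁ ^ N * h₀ ^ N
      score-const true  = trans (cong₂ (λ a b → h₁ ^ N * (h₁ ^ a * h₀ ^ b)) (∑-zero (allFin N)) (∑-allFin-1 N))
        (cong (h₁ ^ N *_) (*-identityˡ _))
      score-const false = trans (cong₂ (λ a b → h₀ ^ N * (h₁ ^ a * h₀ ^ b)) (∑-allFin-1 N) (∑-zero (allFin N)))
        (trans (cong (h₀ ^ N *_) (*-identityʳ _)) (*-comm (h₀ ^ N) (h₁ ^ N)))

      -- A maximiser of the score stays a maximiser under folding, and folding ends in a constant labelling.
      score-bound : ∀ Q → score Q ≤ h₁ ^ N * h₀ ^ N
      score-bound Q = ≤-trans (max Q) (≤-trans (folded total Q* ≤-refl)
        (≤-reflexive (trans (score-ext (λ w → cong Q* (total-e w))) (score-const (Q* e)))))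
        where
        Q* = proj₁ (maximum N score score-ext)
        max = proj₂ (maximum N score score-ext)
        folded : ∀ ks R → score Q* ≤ score R → score Q* ≤ score (R ∘ foldAll ks)
        folded []       R le = le
        -- The square of the maximum is at most the score of the folded labelling times that of the
        -- unfolded one, and the latter is at most the maximum; one factor cancels.
        folded (k ∷ ks) R le = folded ks (R ∘ fold k) (square≤⇒≤ (score Q*) _
          (≤-trans (*-mono-≤ le le) (≤-trans (score-fold k R) (*-monoʳ-≤ (score (R ∘ fold k)) (max (R ∘ unfold k))))))

    -- H is bipartite, so its two parts can be sent to the two ends of a single edge.
    hom>0 : 0 < edgeMass → 0 < hom
    hom>0 pos with ∑-pos X.elems _ pos
    ... | x , pos-x with ∑-pos X.elems _ pos-x
    ...   | y , pos-xy = ≤-trans (≤-reflexive (sym (∏-all-1 _ mapped)))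
      (Enumeration.δ-term≤∑ (enumeration v) (weight adjacency) (weight-ext adjacency) δF≤1 φ)
      where
      φ : Fin v → X
      φ u = if isα u then x else y
      mapped : ∀ w → ⟦ E (φ (α w)) (φ (β w)) ⟧ ≡ 1
      mapped w rewrite isα-α w | isα-β w = cong ⟦_⟧ (⟦⟧-pos (E x y) pos-xy)

    private
      -- All chambers in `edgeStabilizer` impose one and the same condition, on the edge from `α e`
      -- to `β e`, and its two ends are independent.
      oneEdge : X.card * X.card * homOn edgeStabilizer ≥ X.card ^ v * edgeMass
      oneEdge = ≤-trans (≤-reflexive (sym (Marginals.joint-marginal FX (λ x y → ⟦ E x y ⟧) (α e) (β e) (α≢β e e))))
        (*-monoʳ-≤ (X.card * X.card) (≤-trans (∑-mono (funs v) pointwise) (≤-reflexive (sym (+-identityʳ _)))))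
        where
        pointwise : ∀ φ → ⟦ E (φ (α e)) (φ (β e)) ⟧ ≤ weight (partial edgeStabilizer) φ
        pointwise φ with E (φ (α e)) (φ (β e)) in eq
        ... | false = z≤n
        ... | true  = ≤-reflexive (sym (∏-all-1 _ factor))
          where
          factor : ∀ w → partial edgeStabilizer w (φ (α w)) (φ (β w)) ≡ 1
          factor w with α w Fin.≟ α e | β w Fin.≟ β e
          ... | no _   | _      = refl
          ... | yes _  | no _   = refl
          ... | yes p  | yes q rewrite p | q | eq = refl

    -- Apply `score-bound` to `edgeStabilizer`. With `oneEdge` it gives hom^κ >= c^(vκ) (μ/c^2)^N.
    -- Since μ <= c^2, the exponent N can be raised to κε, the surplus being `r`; then take κth
    -- roots.
    sidorenko : ∀ ε → N ≤ multiplicity * ε → 0 < edgeMass → edgeMass ^ ε * X.card ^ v ≤ X.card ^ (2 * ε) * hom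
    sidorenko ε N≤κε pos with m≤n⇒∃[o]m+o≡n N≤κε
    ... | r , N+r≡κε = ^-cancelʳ-≤ κ _ _ (begin
      (μ ^ ε * c ^ v) ^ κ
        ≡⟨ trans (*-^ (μ ^ ε) (c ^ v) κ) (cong₂ _*_ (trans (^-*-assoc μ ε κ) (cong (μ ^_) (trans (*-comm ε κ) (sym N+r≡κε)))) refl) ⟩
      μ ^ (N + r) * (c ^ v) ^ κ
        ≡⟨ trans (cong (_* (c ^ v) ^ κ) (^-distribˡ-+-* μ N r)) (*-exchangeʳ (μ ^ N) (μ ^ r) _) ⟩
      μ ^ N * (c ^ v) ^ κ * μ ^ r
        ≤⟨ *-mono-≤ cancelled (^-monoˡ-≤ r edgeMass≤) ⟩
      (c * c) ^ N * h₁ ^ κ * (c * c) ^ r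
        ≡⟨ trans (*-exchangeʳ ((c * c) ^ N) (h₁ ^ κ) _) (cong (_* h₁ ^ κ) (trans (sym (^-distribˡ-+-* (c * c) N r)) power)) ⟩
      (c ^ (2 * ε)) ^ κ * h₁ ^ κ
        ≡⟨ sym (*-^ (c ^ (2 * ε)) h₁ κ) ⟩
      (c ^ (2 * ε) * h₁) ^ κ
        ≡⟨ cong (λ h → (c ^ (2 * ε) * h) ^ κ) homOn-all ⟩
      (c ^ (2 * ε) * hom) ^ κ ∎)
      where
      open ≤-Reasoning
      c = X.card
      μ = edgeMass
      κ = multiplicity
      κ' = size (not ∘ edgeStabilizer)
      f = homOn edgeStabilizer
      instance
        κ≢0 : NonZero κ
        κ≢0 = >-nonZero multiplicity>0
        h₁≢0 : NonZero h₁
        h₁≢0 = >-nonZero (subst (0 <_) (sym homOn-all) (hom>0 pos))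
        h₀≢0 : NonZero h₀
        h₀≢0 = subst NonZero (sym homOn-none) (m^n≢0 c v)
      *-exchangeʳ : ∀ a b d → a * b * d ≡ a * d * b
      *-exchangeʳ = solve-∀
      power : (c * c) ^ (N + r) ≡ (c ^ (2 * ε)) ^ κ
      power = trans (cong₂ _^_ (cong (c *_) (sym (*-identityʳ c))) (trans N+r≡κε (*-comm κ ε)))
        (trans (^-*-assoc c 2 (ε * κ)) (trans (cong (c ^_) (sym (*-assoc 2 ε κ))) (sym (^-*-assoc c (2 * ε) κ))))
      scored : f ^ N ≤ h₁ ^ κ * h₀ ^ κ'
      scored = *-cancelʳ-≤ _ _ (h₁ ^ κ' * h₀ ^ κ) {{m*n≢0 _ _ {{m^n≢0 h₁ κ'}} {{m^n≢0 h₀ κ}}}}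
        (≤-trans (score-bound edgeStabilizer) (≤-reflexive (trans
          (cong (λ n → h₁ ^ n * h₀ ^ n) (sym (size-not edgeStabilizer)))
          (trans (cong₂ _*_ (^-distribˡ-+-* h₁ κ κ') (^-distribˡ-+-* h₀ κ κ'))
            (shuffle (h₁ ^ κ) (h₁ ^ κ') (h₀ ^ κ) (h₀ ^ κ'))))))
        where
        shuffle : ∀ a b x y → a * b * (x * y) ≡ a * y * (b * x)
        shuffle = solve-∀
      cancelled : μ ^ N * (c ^ v) ^ κ ≤ (c * c) ^ N * h₁ ^ κ
      cancelled = *-cancelʳ-≤ _ _ ((c ^ v) ^ κ') {{m^n≢0 _ κ' {{m^n≢0 c v}}}} (begin
        μ ^ N * (c ^ v) ^ κ * (c ^ v) ^ κ'
          ≡⟨ trans (*-assoc (μ ^ N) _ _) (cong (μ ^ N *_) (trans (sym (^-distribˡ-+-* (c ^ v) κ κ'))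
               (cong ((c ^ v) ^_) (size-not edgeStabilizer)))) ⟩
        μ ^ N * (c ^ v) ^ N
          ≡⟨ trans (*-comm (μ ^ N) _) (sym (*-^ (c ^ v) μ N)) ⟩
        (c ^ v * μ) ^ N
          ≤⟨ ^-monoˡ-≤ N oneEdge ⟩
        (c * c * f) ^ N
          ≡⟨ *-^ (c * c) f N ⟩
        (c * c) ^ N * f ^ N
          ≤⟨ *-monoʳ-≤ ((c * c) ^ N) scored ⟩
        (c * c) ^ N * (h₁ ^ κ * h₀ ^ κ')
          ≡⟨ trans (sym (*-assoc ((c * c) ^ N) _ _)) (cong (λ h → (c * c) ^ N * h₁ ^ κ * h ^ κ') homOn-none) ⟩
        (c * c) ^ N * h₁ ^ κ * (c ^ v) ^ κ' ∎)

-- Homomorphisms identifying two vertices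

pigeonhole : {A : Set} (xs : List A) (f : A → ℕ) → (∑ xs f ≡ 0) ⊎ Σ A (λ x → ∑ xs f ≤ ∑ xs (λ _ → 1) * f x)
pigeonhole []       f = inj₁ refl
pigeonhole (x ∷ xs) f with pigeonhole xs f
... | inj₁ eq = inj₂ (x , +-monoʳ-≤ (f x) (≤-trans (≤-reflexive eq) z≤n))
... | inj₂ (y , le) with ≤-total (f x) (f y)
...   | inj₁ x≤y = inj₂ (y , +-mono-≤ x≤y le)
...   | inj₂ y≤x = inj₂ (x , +-monoʳ-≤ (f x) (≤-trans le (*-monoʳ-≤ (∑ xs (λ _ → 1)) y≤x)))

module Percolation {N m : ℕ} (G : FinGroup N) (s : Fin m → Fin N) (M : Fin m → Fin m → ℕ)
  (cox : IsCoxeterSystem G s M) {v : ℕ} (C : CosetGeometry.CosetStructure G s M cox v) where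
  open Domination G s M cox C public

  -- Vertex sets U for which the number of homomorphisms collapsing U to one point can be
  -- bounded, by repeated folding, in terms of the homomorphisms collapsing a whole part.
  data Percolates : (Fin v → Bool) → Set where
    fullα  : ∀ {U} → (∀ w → U (α w) ≡ true) → Percolates U
    fullβ  : ∀ {U} → (∀ w → U (β w) ≡ true) → Percolates U
    clash  : ∀ {U} w → U (α w) ≡ true → U (β w) ≡ true → Percolates U
    folded : ∀ {U} k u → U (unfoldV k u) ≡ true → Percolates (U ∘ foldV k) → Percolates U
    moved  : ∀ {U} g → Percolates (U ∘ act g) → Percolates U

  -- The power of `hom` lost along the way: a fold squares the inequality obtained so far and costs
  -- one further factor.
  depth : ∀ {U} → Percolates U → ℕ
  depth (fullα _)        = 0
  depth (fullβ _)        = 0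
  depth (clash _ _ _)    = 0
  depth (folded _ _ _ p) = suc (depth p + depth p)
  depth (moved _ p)      = depth p

  record Part (γ : Fin N → Fin v) : Set where
    field
      equiv    : ∀ g w → γ (g · w) ≡ act g (γ w)
      foldV-γ  : ∀ k w → foldV k (γ w) ≡ γ (fold k w)
      unfoldV-γ : ∀ k w → unfoldV k (γ w) ≡ γ (unfold k w)

  partα : Part α
  partα = record { equiv = A.equivariant ; foldV-γ = foldV-α ; unfoldV-γ = unfoldV-α }

  partβ : Part β
  partβ = record { equiv = B.equivariant ; foldV-γ = foldV-β ; unfoldV-γ = unfoldV-β }

  module Stage (γ : Fin N → Fin v) (part : Part γ) (i₀ : Fin m) (fixes : ∀ k → (k ≡ i₀) ⊎ Fixes γ k)
    (full : ∀ {U} → (∀ w → U (γ w) ≡ true) → Percolates U) where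
    open Part part

    γ-s : ∀ k → Fixes γ k → γ (s k) ≡ γ e
    γ-s k fix = trans (cong γ (sym (identityˡ _))) (fix e)

    -- The invariant is that `U` contains the origin `γ e` and its neighbouring vertex `γ (s i₀)`.
    -- Folds at `i₀` send both to the origin and other folds fix both, so the invariant survives
    -- until the pullback of `U` contains the whole part.
    spread : ∀ ks U → U (γ e) ≡ true → U (γ (s i₀)) ≡ true →
      (∀ w → U (γ (foldAll ks w)) ≡ true) → Percolates U
    spread []       U Ue Us all = full all
    spread (k ∷ ks) U Ue Us all with k Fin.≟ i₀
    ... | yes refl = folded k (γ (s k))
      (trans (cong U (trans (unfoldV-γ k (s k)) (cong γ (unfold-s-self k)))) Us)
      (spread ks (U ∘ foldV k)
        (trans (cong U (trans (foldV-γ k e) (cong γ (fold-e k)))) Ue)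
        (trans (cong U (trans (foldV-γ k (s k)) (cong γ (fold-s-self k)))) Ue)
        (λ w → trans (cong U (foldV-γ k (foldAll ks w))) (all w)))
    ... | no k≢i₀ with fixes k
    ...   | inj₁ k≡i₀ = ⊥-elim (k≢i₀ k≡i₀)
    -- The reflection `s k` fixes the vertex `γ e`, so unfolding leaves it in `U`; in the case of
    -- `i₀` the witness is `γ (s k)`, already on the far side.
    ...   | inj₂ fix = folded k (γ e)
      (trans (cong U (trans (unfoldV-γ k e) unfold-e)) Ue)
      (spread ks (U ∘ foldV k)
        (trans (cong U (trans (foldV-γ k e) (cong γ (fold-e k)))) Ue)
        (trans (cong U (trans (foldV-γ k (s i₀)) (cong γ (fold-s k i₀ k≢i₀)))) Us)
        (λ w → trans (cong U (foldV-γ k (foldAll ks w))) (all w)))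
      where
      unfold-e : γ (unfold k e) ≡ γ e
      unfold-e rewrite side-e k = trans (cong γ (identityʳ _)) (γ-s k fix)

    percolate : ∀ U → U (γ e) ≡ true → U (γ (s i₀)) ≡ true → Percolates U
    percolate U Ue Us = spread total U Ue Us (λ w → trans (cong (U ∘ γ) (total-e w)) Ue)

    module _ (ζ : Fin N → Fin v) (partζ : Part ζ)
      (atOrigin : ∀ {U} → U (γ e) ≡ true → U (ζ e) ≡ true → ζ e ≢ γ e → Percolates U) where
      private module ζ = Part partζ

      -- Induction on the word leading to the second vertex. A first letter that fixes the origin
      -- vertex is removed by a translation. Otherwise it is `i₀`, and either the word can be
      -- shortened or the second vertex lies beyond that wall. In the latter case it witnesses a
      -- fold at `i₀`, after which the pullback of `U` contains both the origin and its neighbour.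
      approach : ∀ n is → length is ≤ n → ∀ U → U (γ e) ≡ true → U (ζ (word is)) ≡ true →
        ζ (word is) ≢ γ e → Percolates U
      approach n       []       le U Ue Uw ne = atOrigin Ue Uw ne
      approach (suc n) (j ∷ is) (s≤s le) U Ue Uw ne with γ (s j) Fin.≟ γ e
      ... | yes eq = moved (s j) (approach n is le (U ∘ act (s j))
        (trans (cong U act-e) Ue)
        (trans (cong U (sym (ζ.equiv (s j) (word is)))) Uw)
        (λ eq' → ne (trans (ζ.equiv (s j) (word is)) (trans (cong (act (s j)) eq') act-e))))
        where
        act-e : act (s j) (γ e) ≡ γ e
        act-e = trans (sym (equiv (s j) e)) (trans (cong γ (identityʳ _)) eq)
      ... | no γs≢γe with fixes j
      ...   | inj₂ fix = ⊥-elim (γs≢γe (γ-s j fix))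
      ...   | inj₁ refl with side j (word (j ∷ is)) in eq
      ...     | false with head-side-false j is eq
      ...       | js , p , len = approach n js (≤-trans (n≤1+n _) (≤-trans (≤-reflexive len) le)) U Ue
        (trans (cong (U ∘ ζ) (sym p)) Uw) (λ eq' → ne (trans (cong ζ p) eq'))
      approach (suc n) (j ∷ is) (s≤s le) U Ue Uw ne | no γs≢γe | inj₁ refl | true =
        folded j (ζ (word (j ∷ is)))
          (trans (cong U (trans (ζ.unfoldV-γ j (word (j ∷ is))) (cong (λ b → ζ (if b then word (j ∷ is) else s j · word (j ∷ is))) eq))) Uw)
          (percolate (U ∘ foldV j)
            (trans (cong U (trans (foldV-γ j e) (cong γ (fold-e j)))) Ue)
            (trans (cong U (trans (foldV-γ j (s j)) (cong γ (fold-s-self j)))) Ue))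

      pair : ∀ U x y → U (γ x) ≡ true → U (ζ y) ≡ true → ζ y ≢ γ x → Percolates U
      pair U x y Ux Uy ne with word-of (inv x · y)
      ... | is , eq = moved x (approach (length is) is ≤-refl (U ∘ act x)
        (trans (cong U act-e) Ux)
        (trans (cong U act-w) Uy)
        (λ eq' → ne (trans (sym act-w) (trans (cong (act x) eq') act-e))))
        where
        act-e : act x (γ e) ≡ γ x
        act-e = trans (sym (equiv x e)) (cong γ (identityʳ x))
        act-w : act x (ζ (word is)) ≡ ζ y
        act-w = trans (sym (ζ.equiv x (word is))) (cong ζ (trans (cong (x ·_) eq) (cancel-invˡ x y)))

  module _ (iα iβ : Fin m) (fixesα : ∀ k → (k ≡ iα) ⊎ Fixes α k) (fixesβ : ∀ k → (k ≡ iβ) ⊎ Fixes β k) where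
    private
      module Sα = Stage α partα iα fixesα fullα
      module Sβ = Stage β partβ iβ fixesβ fullβ

    pair-percolates : ∀ U u u' → u ≢ u' → U u ≡ true → U u' ≡ true → Percolates U
    pair-percolates U u u' ne Uu Uu' with cover u | cover u'
    ... | inj₁ p | inj₁ q = Sα.pair α partα (λ _ _ ne → ⊥-elim (ne refl)) U (rep u) (rep u')
      (trans (cong U (sym p)) Uu) (trans (cong U (sym q)) Uu') (λ eq → ne (trans p (trans (sym eq) (sym q))))
    ... | inj₁ p | inj₂ q = Sα.pair β partβ (λ a b _ → clash e a b) U (rep u) (rep u')
      (trans (cong U (sym p)) Uu) (trans (cong U (sym q)) Uu') (λ eq → ne (trans p (trans (sym eq) (sym q))))
    ... | inj₂ p | inj₁ q = Sβ.pair α partα (λ b a _ → clash e a b) U (rep u) (rep u')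
      (trans (cong U (sym p)) Uu) (trans (cong U (sym q)) Uu') (λ eq → ne (trans p (trans (sym eq) (sym q))))
    ... | inj₂ p | inj₂ q = Sβ.pair β partβ (λ _ _ ne → ⊥-elim (ne refl)) U (rep u) (rep u')
      (trans (cong U (sym p)) Uu) (trans (cong U (sym q)) Uu') (λ eq → ne (trans p (trans (sym eq) (sym q))))

  module Collapses {X Z : Set} (FX : Finite X) .{{_ : NonZero (Finite.card FX)}} (FZ : Finite Z)
    (π : X → Z) (E : X → X → Bool) where
    open HomCounts FX E public
    private module Z = Finite FZ

    gate : Bool → Z → X → ℕ
    gate b ζ x = if b then Z.δ ζ (π x) else 1

    gate≤1 : ∀ b ζ x → gate b ζ x ≤ 1
    gate≤1 true  ζ x = Z.δ≤1 ζ (π x)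
    gate≤1 false ζ x = ≤-refl

    -- Besides the edge condition, vertices in `U` must project to the host vertex `ζ`. The gate of
    -- a vertex is repeated at all its chambers, harmlessly, as its values are 0 and 1.
    gated : (Fin v → Bool) → Z → Fin N → X → X → ℕ
    gated U ζ w x y = ⟦ E x y ⟧ * (gate (U (α w)) ζ x * gate (U (β w)) ζ y)

    collapsing : (Fin v → Bool) → ℕ
    collapsing U = count Z.elems (gated U)

    weight-gated≤ : ∀ U u → U u ≡ true → ∀ φ ζ → weight (gated U ζ) φ ≤ Z.δ ζ (π (φ u)) * weight adjacency φ
    weight-gated≤ U u Uu φ ζ = ≤-trans (≤-reflexive (∏-* (λ w → ⟦ E (φ (α w)) (φ (β w)) ⟧) gates))
      (≤-trans (≤-reflexive (*-comm (weight adjacency φ) (∏ gates))) (*-monoˡ-≤ (weight adjacency φ) bound))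
      where
      gates : Fin N → ℕ
      gates w = gate (U (α w)) ζ (φ (α w)) * gate (U (β w)) ζ (φ (β w))
      gates≤1 : ∀ w → gates w ≤ 1
      gates≤1 w = *-mono-≤ (gate≤1 (U (α w)) ζ _) (gate≤1 (U (β w)) ζ _)
      bound : ∏ gates ≤ Z.δ ζ (π (φ u))
      bound with cover u
      ... | inj₁ eq = ≤-trans (∏≤factor gates gates≤1 (rep u)) (≤-trans
              (*-monoʳ-≤ (gate (U (α (rep u))) ζ (φ (α (rep u)))) (gate≤1 (U (β (rep u))) ζ _)) (≤-reflexive (trans (*-identityʳ _)
              (trans (cong (λ x → gate (U x) ζ (φ x)) (sym eq)) (cong (λ b → gate b ζ (φ u)) Uu)))))
      ... | inj₂ eq = ≤-trans (∏≤factor gates gates≤1 (rep u)) (≤-trans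
              (*-monoˡ-≤ (gate (U (β (rep u))) ζ (φ (β (rep u)))) (gate≤1 (U (α (rep u))) ζ _)) (≤-reflexive (trans (*-identityˡ _)
              (trans (cong (λ x → gate (U x) ζ (φ x)) (sym eq)) (cong (λ b → gate b ζ (φ u)) Uu)))))

    ∑-gated≤ : ∀ U u → U u ≡ true → ∀ φ → ∑ Z.elems (λ ζ → weight (gated U ζ) φ) ≤ weight adjacency φ
    ∑-gated≤ U u Uu φ = ≤-trans (∑-mono Z.elems (weight-gated≤ U u Uu φ))
      (≤-reflexive (trans (∑-*ʳ Z.elems _ _) (trans (cong (_* weight adjacency φ) (Z.once (π (φ u)))) (*-identityˡ _))))

    collapsing-swap : ∀ U → collapsing U ≡ ∑ (funs v) (λ φ → ∑ Z.elems (λ ζ → weight (gated U ζ) φ))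
    collapsing-swap U = ∑-comm Z.elems (funs v) _

    -- A member of `U` makes `ζ` a function of `φ`; for empty `U` each homomorphism would be counted
    -- once for every `ζ`. This is why the constructor `folded` carries a witness.
    collapsing≤hom : ∀ U u → U u ≡ true → collapsing U ≤ hom
    collapsing≤hom U u Uu = ≤-trans (≤-reflexive (collapsing-swap U)) (∑-mono (funs v) (∑-gated≤ U u Uu))

    collapsing-move : ∀ U g → collapsing (U ∘ act g) ≡ collapsing U
    collapsing-move U g = ∑-cong Z.elems λ ζ → begin
      ∑ (funs v) (weight (gated (U ∘ act g) ζ))
        ≡⟨ sym (∑-precompose (act g) (act (inv g)) (act-cancel g (inv g) (inverseʳ g)) (act-cancel (inv g) g (inverseˡ g))
             (weight (gated (U ∘ act g) ζ)) (weight-ext (gated (U ∘ act g) ζ))) ⟩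
      ∑ (funs v) (λ φ → weight (gated (U ∘ act g) ζ) (φ ∘ act g))
        ≡⟨ ∑-cong (funs v) (λ φ → trans
             (∏-cong (λ w → cong₂ (λ a b → ⟦ E (φ a) (φ b) ⟧ * (gate (U a) ζ (φ a) * gate (U b) ζ (φ b)))
               (sym (A.equivariant g w)) (sym (B.equivariant g w))))
             (∏-reindex (g ·_) (inv g ·_) (cancel-invˡ g) (inv-cancelˡ g)
               (λ w → gated U ζ w (φ (α w)) (φ (β w))))) ⟩
      ∑ (funs v) (weight (gated U ζ)) ∎
      where open ≡-Reasoning

    collapsing-fold : ∀ U k → collapsing U * collapsing U ≤ collapsing (U ∘ foldV k) * collapsing (U ∘ unfoldV k)
    collapsing-fold U k = ≤-trans (fold-inequality Z.elems (gated U) k) (≤-reflexive (cong₂ _*_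
      (count-cong Z.elems (λ ζ w x y → cong₂ (λ a b → ⟦ E x y ⟧ * (gate (U a) ζ x * gate (U b) ζ y))
        (sym (foldV-α k w)) (sym (foldV-β k w))))
      (count-cong Z.elems (λ ζ w x y → cong₂ (λ a b → ⟦ E x y ⟧ * (gate (U a) ζ x * gate (U b) ζ y))
        (sym (unfoldV-α k w)) (sym (unfoldV-β k w))))))

    module _ (loopless : ∀ x y → E x y ≡ true → π x ≢ π y) where
      -- Two adjacent vertices of H cannot have the same image in a loopless host.
      collapsing-clash : ∀ U w → U (α w) ≡ true → U (β w) ≡ true → collapsing U ≡ 0
      collapsing-clash U w Uα Uβ = trans (∑-cong Z.elems (λ ζ → trans (∑-cong (funs v) (λ φ →
          ∏-factor-zero _ w (vanish ζ (φ (α w)) (φ (β w))))) (∑-zero (funs v)))) (∑-zero Z.elems)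
        where
        vanish : ∀ ζ x y → gated U ζ w x y ≡ 0
        vanish ζ x y rewrite Uα | Uβ with E x y in eq
        ... | false = refl
        ... | true with ζ Z.≟ π x | ζ Z.≟ π y
        ...   | yes p | yes q = ⊥-elim (loopless x y eq (trans (sym p) q))
        ...   | yes _ | no _  = refl
        ...   | no _  | _     = refl

      module _ (S : ℕ) (boundα : ∀ U → (∀ w → U (α w) ≡ true) → collapsing U ≤ S)
               (boundβ : ∀ U → (∀ w → U (β w) ≡ true) → collapsing U ≤ S) where

        -- From D^2 <= D₊ hom and D₊^(T+1) <= S hom^T follows D^(2T+2) <= S hom^(2T+1), so T becomes
        -- 2T+1 at each fold.
        collapsing-bound : ∀ {U} (p : Percolates U) → collapsing U ^ suc (depth p) ≤ S * hom ^ depth p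
        collapsing-bound {U} (fullα all) = *-monoˡ-≤ 1 (boundα U all)
        collapsing-bound {U} (fullβ all) = *-monoˡ-≤ 1 (boundβ U all)
        collapsing-bound {U} (clash w a b) = ≤-trans (≤-reflexive (cong (_^ 1) (collapsing-clash U w a b))) z≤n
        collapsing-bound {U} (moved g p) = subst (λ d → d ^ suc (depth p) ≤ S * hom ^ depth p)
          (collapsing-move U g) (collapsing-bound p)
        collapsing-bound {U} (folded k u Uu p) = begin
          D ^ suc (suc (T + T))
            ≡⟨ cong (D ^_) (cong suc (sym (+-suc T T))) ⟩
          D ^ (suc T + suc T)
            ≡⟨ trans (^-distribˡ-+-* D (suc T) (suc T)) (sym (*-^ D D (suc T))) ⟩
          (D * D) ^ suc T
            ≤⟨ ^-monoˡ-≤ (suc T) (≤-trans (collapsing-fold U k) (*-monoʳ-≤ D₊ (collapsing≤hom (U ∘ unfoldV k) u Uu))) ⟩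
          (D₊ * hom) ^ suc T
            ≡⟨ *-^ D₊ hom (suc T) ⟩
          D₊ ^ suc T * hom ^ suc T
            ≤⟨ *-monoˡ-≤ (hom ^ suc T) (collapsing-bound p) ⟩
          S * hom ^ T * hom ^ suc T
            ≡⟨ trans (*-assoc S _ _) (cong (S *_) (trans (sym (^-distribˡ-+-* hom T (suc T))) (cong (hom ^_) (+-suc T T)))) ⟩
          S * hom ^ suc (T + T) ∎
          where
          open ≤-Reasoning
          D = collapsing U
          D₊ = collapsing (U ∘ foldV k)
          T = depth p

  both : Fin v → Fin v → Fin v → Bool
  both u u' x = does (x Fin.≟ u) ∨ does (x Fin.≟ u')

  both-left : ∀ u u' → both u u' u ≡ true
  both-left u u' rewrite dec-true (u Fin.≟ u) refl = refl

  both-right : ∀ u u' → both u u' u' ≡ true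
  both-right u u' rewrite dec-true (u' Fin.≟ u') refl = Bool.∨-zeroʳ _

  module Degenerate (percolates : ∀ u u' → u ≢ u' → Percolates (both u u')) where

    exponent : Fin v → Fin v → ℕ
    exponent u u' with u Fin.≟ u'
    ... | yes _ = 0
    ... | no ne = depth (percolates u u' ne)

    -- Depends on H alone. The sum dominates the factor needed for whichever pair of vertices the
    -- pigeonhole principle selects in a given host.
    constant : ℕ
    constant = ∑ (allFin v) (λ u → ∑ (allFin v) (λ u' → (v * v) ^ suc (exponent u u')))

    constant≥ : ∀ u u' → (v * v) ^ suc (exponent u u') ≤ constant
    constant≥ u u' = ≤-trans (term≤∑ (λ u' → (v * v) ^ suc (exponent u u')) u')
      (term≤∑ (λ u → ∑ (allFin v) (λ u' → (v * v) ^ suc (exponent u u'))) u)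

    module _ {X Z : Set} (FX : Finite X) .{{_ : NonZero (Finite.card FX)}} (FZ : Finite Z)
      (π : X → Z) (E : X → X → Bool) where
      open Collapses FX FZ π E

      module _ (loopless : ∀ x y → E x y ≡ true → π x ≢ π y)
        (S : ℕ) (boundα : ∀ U → (∀ w → U (α w) ≡ true) → collapsing U ≤ S)
        (boundβ : ∀ U → (∀ w → U (β w) ≡ true) → collapsing U ≤ S)
        (collision : ∀ (φ : Fin v → X) → (∀ w → E (φ (α w)) (φ (β w)) ≡ true) →
          Σ (Fin v) λ u → Σ (Fin v) λ u' → u ≢ u' × π (φ u) ≡ π (φ u')) where
        private
          module Z = Finite FZ

          glued : Fin v → Fin v → ℕ
          glued u u' with u Fin.≟ u'
          ... | yes _ = 0
          ... | no _  = collapsing (both u u')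

          gluedAt : (Fin v → X) → Fin v → Fin v → ℕ
          gluedAt φ u u' with u Fin.≟ u'
          ... | yes _ = 0
          ... | no _  = ∑ Z.elems (λ ζ → weight (gated (both u u') ζ) φ)

          glued-∑ : ∀ u u' → ∑ (funs v) (λ φ → gluedAt φ u u') ≡ glued u u'
          glued-∑ u u' with u Fin.≟ u'
          ... | yes _ = ∑-zero (funs v)
          ... | no _  = sym (collapsing-swap (both u u'))

          glued-bound : ∀ u u' → glued u u' ^ suc (exponent u u') ≤ S * hom ^ exponent u u'
          glued-bound u u' with u Fin.≟ u'
          ... | yes _ = z≤n
          ... | no ne = collapsing-bound loopless S boundα boundβ (percolates u u' ne)

          -- Each homomorphism identifies some pair `u`, `u'` in the host, and is counted for that
          -- pair at `ζ = π (φ u)`.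
          glued-hom : ∀ φ → weight adjacency φ ≤ ∑ (allFin v) (λ u → ∑ (allFin v) (gluedAt φ u))
          glued-hom φ with ∏-Bool (λ w → E (φ (α w)) (φ (β w)))
          ... | inj₂ (_ , eq) = ≤-trans (≤-reflexive eq) z≤n
          ... | inj₁ (edges , eq) with collision φ edges
          ...   | u , u' , ne , same = ≤-trans (≤-reflexive eq) (≤-trans present
            (≤-trans (term≤∑ (gluedAt φ u) u') (term≤∑ (λ u → ∑ (allFin v) (gluedAt φ u)) u)))
            where
            open-gate : ∀ x → gate (both u u' x) (π (φ u)) (φ x) ≡ 1
            open-gate x with x Fin.≟ u | x Fin.≟ u'
            ... | yes refl | _        = Z.δ-refl _
            ... | no _     | yes refl = trans (cong (Z.δ _) (sym same)) (Z.δ-refl _)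
            ... | no _     | no _     = refl
            present : 1 ≤ gluedAt φ u u'
            present with u Fin.≟ u'
            ... | yes eq = ⊥-elim (ne eq)
            ... | no _   = ≤-trans (≤-reflexive (sym (∏-all-1 _ (λ w →
                  trans (cong₂ _*_ (cong ⟦_⟧ (edges w)) (cong₂ _*_ (open-gate (α w)) (open-gate (β w)))) refl))))
                (Enumeration.δ-term≤∑ Z.enumeration (λ ζ → weight (gated (both u u') ζ) φ)
                  (cong (λ ζ → weight (gated (both u u') ζ) φ)) Z.δ≤1 (π (φ u)))

          hom≤∑ : hom ≤ ∑ (allFin v) (λ u → ∑ (allFin v) (glued u))
          hom≤∑ = ≤-trans (∑-mono (funs v) glued-hom) (≤-reflexive
            (trans (∑-comm (funs v) (allFin v) _) (∑-cong (allFin v) (λ u →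
              trans (∑-comm (funs v) (allFin v) _) (∑-cong (allFin v) (glued-∑ u))))))

        -- Some pair satisfies hom <= v^2 `glued`. Raising this to the power T+1 and inserting the
        -- percolation bound gives hom^(T+1) <= (v^2)^(T+1) S hom^T, where hom^T cancels.
        hom-bound : hom ≤ constant * S
        hom-bound with hom in hom-eq
        ... | zero = z≤n
        ... | suc h with pigeonhole (allFin v) (λ u → ∑ (allFin v) (glued u))
        ...   | inj₁ eq = ⊥-elim (1+n≰n (≤-trans (≤-reflexive (sym hom-eq)) (≤-trans hom≤∑ (≤-trans (≤-reflexive eq) z≤n))))
        ...   | inj₂ (u , le) with pigeonhole (allFin v) (glued u)
        ...     | inj₁ eq = ⊥-elim (1+n≰n (≤-trans (≤-reflexive (sym hom-eq)) (≤-trans hom≤∑ (≤-trans le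
                    (≤-trans (≤-reflexive (trans (cong (∑ (allFin v) (λ _ → 1) *_) eq) (*-zeroʳ (∑ (allFin v) (λ _ → 1))))) z≤n)))))
        ...     | inj₂ (u' , le') = subst (_≤ constant * S) hom-eq
          (≤-trans (*-cancelʳ-≤ hom _ (hom ^ T) {{m^n≢0 hom T {{>-nonZero hom>0′}}}} powered)
            (*-monoˡ-≤ S (constant≥ u u')))
          where
          open ≤-Reasoning
          T = exponent u u'
          hom>0′ : 0 < hom
          hom>0′ = subst (0 <_) (sym hom-eq) (s≤s z≤n)
          hom≤ : hom ≤ v * v * glued u u'
          hom≤ = ≤-trans hom≤∑ (≤-trans le (≤-trans (*-monoʳ-≤ (∑ (allFin v) (λ _ → 1)) le')
            (≤-reflexive (trans (cong₂ (λ a b → a * (b * glued u u')) (∑-allFin-1 v) (∑-allFin-1 v)) (sym (*-assoc v v _))))))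
          powered : hom * hom ^ T ≤ (v * v) ^ suc T * S * hom ^ T
          powered = begin
            hom ^ suc T
              ≤⟨ ^-monoˡ-≤ (suc T) hom≤ ⟩
            (v * v * glued u u') ^ suc T
              ≡⟨ *-^ (v * v) (glued u u') (suc T) ⟩
            (v * v) ^ suc T * glued u u' ^ suc T
              ≤⟨ *-monoʳ-≤ ((v * v) ^ suc T) (glued-bound u u') ⟩
            (v * v) ^ suc T * (S * hom ^ T)
              ≡⟨ sym (*-assoc ((v * v) ^ suc T) S _) ⟩
            (v * v) ^ suc T * S * hom ^ T ∎

-- Homomorphisms constant on one part

finiteBool : Finite Bool
finiteBool = record { elems = true ∷ false ∷ [] ; _≟_ = Bool._≟_ ; once = λ { true → refl ; false → refl } }

finite⊤ : Finite ⊤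
finite⊤ = record { elems = tt ∷ [] ; _≟_ = λ _ _ → yes refl ; once = λ _ → refl }

module Stars {N m : ℕ} (G : FinGroup N) (s : Fin m → Fin N) (M : Fin m → Fin m → ℕ)
  (cox : IsCoxeterSystem G s M) {v : ℕ} (C : CosetGeometry.CosetStructure G s M cox v)
  (linked : ∀ k → CosetGeometry.Fixes G s M cox (CosetGeometry.CosetStructure.α C) k
                ⊎ CosetGeometry.Fixes G s M cox (CosetGeometry.CosetStructure.β C) k) where
  open Percolation G s M cox C public

  module _ {X Z : Set} (FX : Finite X) .{{_ : NonZero (Finite.card FX)}} (FZ : Finite Z)
    (π : X → Z) (E : X → X → Bool) where
    open Collapses FX FZ π E

    module _ (E-sym : ∀ x y → E x y ≡ true → E y x ≡ true)
      (locally-injective : ∀ x x' y → E x y ≡ true → E x' y ≡ true → π x ≡ π x' → x ≡ x')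
      (d : ℕ) (degree : ∀ x → ∑ (Finite.elems FX) (λ y → ⟦ E x y ⟧) ≤ d) where
      private
        module Z = Finite FZ

        module OnePart (γ δ : Fin N → Fin v) (isγ : Fin v → Bool)
          (isγ-γ : ∀ w → isγ (γ w) ≡ true) (isγ-δ : ∀ w → isγ (δ w) ≡ false)
          (coverγ : ∀ u → (u ≡ γ (rep u)) ⊎ (u ≡ δ (rep u)))
          (linkedγ : ∀ k → Fixes γ k ⊎ Fixes δ k)
          (edgeγ : ∀ (φ : Fin v → X) w → E (φ (α w)) (φ (β w)) ≡ true → E (φ (γ w)) (φ (δ w)) ≡ true) where

          pick : X → Fin v → X → ℕ
          pick p u x = if isγ u then X.δ x p else ⟦ E p x ⟧

          -- Neighbouring vertices of one part share a neighbour, so π-equal images coincide; H is connected.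
          constant-on-part : (φ : Fin v → X) → (∀ w → E (φ (γ w)) (φ (δ w)) ≡ true) →
            (∀ w → π (φ (γ w)) ≡ π (φ (γ e))) → (is : List (Fin m)) (x : Fin N) → φ (γ (x · word is)) ≡ φ (γ x)
          constant-on-part φ edge same []       x = cong (φ ∘ γ) (identityʳ x)
          constant-on-part φ edge same (k ∷ is) x = trans (cong (φ ∘ γ) (sym (assoc _ _ _)))
            (trans (constant-on-part φ edge same is (x · s k)) (step (linkedγ k)))
            where
            step : Fixes γ k ⊎ Fixes δ k → φ (γ (x · s k)) ≡ φ (γ x)
            step (inj₁ fix) = cong φ (fix x)
            step (inj₂ fix) = locally-injective _ _ (φ (δ x))
              (trans (cong (λ u → E (φ (γ (x · s k))) (φ u)) (sym (fix x))) (edge (x · s k))) (edge x)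
              (trans (same _) (sym (same _)))

          -- A nonzero gated weight makes `φ` a homomorphism constant on the part of `γ`, hence a
          -- star centred at `φ (γ e)`.
          pointwise : ∀ U → (∀ w → U (γ w) ≡ true) → ∀ φ →
            ∑ Z.elems (λ ζ → weight (gated U ζ) φ) ≤ ∑ X.elems (λ p → ∏ (λ u → pick p u (φ u)))
          pointwise U all φ with ∑ Z.elems (λ ζ → weight (gated U ζ) φ) in eq
          ... | zero  = z≤n
          ... | suc l with ∑-pos Z.elems _ (subst (0 <_) (sym eq) (s≤s z≤n))
          ...   | ζ , pos = ≤-trans (≤-reflexive (sym eq)) (≤-trans (∑-gated≤ U (γ e) (all e) φ)
            (≤-trans (∏≤1 _ (λ w → ⟦⟧≤1 (E (φ (α w)) (φ (β w))))) (≤-trans (≤-reflexive (sym (∏-all-1 _ picked)))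
              (Enumeration.δ-term≤∑ X.enumeration (λ p → ∏ (λ u → pick p u (φ u)))
                (cong (λ p → ∏ (λ u → pick p u (φ u)))) X.δ≤1 (φ (γ e))))))
            where
            bounded : ∀ w → 0 < Z.δ ζ (π (φ (γ w))) * weight adjacency φ
            bounded w = ≤-trans pos (weight-gated≤ U (γ w) (all w) φ ζ)
            at-ζ : ∀ w → ζ ≡ π (φ (γ w))
            at-ζ w with ζ Z.≟ π (φ (γ w)) | bounded w
            ... | yes p | _ = p
            edge : ∀ w → E (φ (γ w)) (φ (δ w)) ≡ true
            edge w = edgeγ φ w (⟦⟧-pos (E (φ (α w)) (φ (β w))) (∏-pos _ positive w))
              where
              positive : 0 < weight adjacency φ
              positive with weight adjacency φ in eq' | bounded e
              ... | suc _ | _ = s≤s z≤n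
              ... | zero  | b = ≤-trans b (≤-reflexive (*-zeroʳ (Z.δ ζ (π (φ (γ e))))))
            constantφ : ∀ w → φ (γ w) ≡ φ (γ e)
            constantφ w with word-of w
            ... | is , refl = trans (cong (φ ∘ γ) (sym (identityˡ _)))
              (constant-on-part φ edge (λ w → trans (sym (at-ζ w)) (at-ζ e)) is e)
            picked : ∀ u → pick (φ (γ e)) u (φ u) ≡ 1
            picked u with coverγ u
            ... | inj₁ p rewrite p | isγ-γ (rep u) = trans (cong (X.δ (φ (γ (rep u)))) (sym (constantφ (rep u)))) (X.δ-refl (φ (γ (rep u))))
            ... | inj₂ p rewrite p | isγ-δ (rep u) = cong ⟦_⟧
              (trans (cong (λ x → E x (φ (δ (rep u)))) (sym (constantφ (rep u)))) (edge (rep u)))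

          -- There are `X.card` choices for the common image of one part, and then at most `d`
          -- neighbours of it for each vertex of the other.
          star : ∀ U → (∀ w → U (γ w) ≡ true) → collapsing U ≤ X.card * d ^ ∑ (allFin v) (λ u → ⟦ not (isγ u) ⟧)
          star U all = begin
            collapsing U
              ≡⟨ collapsing-swap U ⟩
            ∑ (funs v) (λ φ → ∑ Z.elems (λ ζ → weight (gated U ζ) φ))
              ≤⟨ ∑-mono (funs v) (pointwise U all) ⟩
            ∑ (funs v) (λ φ → ∑ X.elems (λ p → ∏ (λ u → pick p u (φ u))))
              ≡⟨ trans (∑-comm (funs v) X.elems _) (∑-cong X.elems (λ p → ∑-∏ (pick p))) ⟩
            ∑ X.elems (λ p → ∏ (λ u → ∑ X.elems (pick p u)))
              ≤⟨ ∑-mono X.elems (λ p → ∏-mono (λ u → choices p u)) ⟩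
            ∑ X.elems (λ p → ∏ (λ u → if isγ u then 1 else d))
              ≡⟨ trans (∑-const X.elems _) (cong (X.card *_) (∏-if isγ d)) ⟩
            X.card * d ^ ∑ (allFin v) (λ u → ⟦ not (isγ u) ⟧) ∎
            where
            open ≤-Reasoning
            choices : ∀ p u → ∑ X.elems (pick p u) ≤ (if isγ u then 1 else d)
            choices p u with isγ u
            ... | true  = ≤-reflexive (X.once p)
            ... | false = degree p

      star-α : ∀ U → (∀ w → U (α w) ≡ true) → collapsing U ≤ X.card * d ^ #β
      star-α = OnePart.star α β isα isα-α isα-β cover linked (λ _ _ p → p)

      star-β : ∀ U → (∀ w → U (β w) ≡ true) → collapsing U ≤ X.card * d ^ #α
      star-β U all = ≤-trans
        (OnePart.star β α (not ∘ isα) (λ w → cong not (isα-β w)) (λ w → cong not (isα-α w))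
          (λ u → swap (cover u)) (λ k → swap (linked k)) (λ φ w p → E-sym _ _ p) U all)
        (≤-reflexive (cong (λ k → X.card * d ^ k)
          (∑-cong (allFin v) (λ u → cong ⟦_⟧ (Bool.not-involutive (isα u))))))

  -- Counting homomorphisms to K₂ from both sides shows that the connected graph H
  -- has at least v(H) - 1 edges.
  vertices≤edges+1 : ∀ ε → N ≤ multiplicity * ε → v ≤ suc ε
  vertices≤edges+1 ε N≤κε with ≤-<-connex v (suc ε)
  ... | inj₁ le = le
  ... | inj₂ lt = ⊥-elim (<⇒≱ (^-monoʳ-< 2 (s≤s (s≤s z≤n)) (+-monoʳ-< ε lt)) (begin
      2 ^ (ε + v)
        ≡⟨ ^-distribˡ-+-* 2 ε v ⟩
      2 ^ ε * 2 ^ v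
        ≤⟨ K.sidorenko ε N≤κε (s≤s z≤n) ⟩
      2 ^ (2 * ε) * K.hom
        ≤⟨ *-monoʳ-≤ (2 ^ (2 * ε)) hom≤2 ⟩
      2 ^ (2 * ε) * 2
        ≡⟨ trans (*-comm (2 ^ (2 * ε)) 2) (cong (2 ^_) (trans (cong (λ a → suc (ε + a)) (+-identityʳ ε)) (sym (+-suc ε ε)))) ⟩
      2 ^ (ε + suc ε) ∎))
    where
    open ≤-Reasoning
    -- The host is the single edge on `Bool`, with degree 1 and edge mass 2. Mapping everything to
    -- `tt` makes the collapsing condition empty, so the star bound applies to all homomorphisms.
    module K = Collapses finiteBool finite⊤ (λ _ → tt) _xor_
    all : Fin v → Bool
    all _ = true
    hom≤2 : K.hom ≤ 2
    hom≤2 = begin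
      K.hom
        ≡⟨ ∑-cong (K.funs v) (λ φ → ∏-cong (λ w → sym (*-identityʳ ⟦ φ (α w) xor φ (β w) ⟧))) ⟩
      ∑ (K.funs v) (K.weight (K.gated all tt))
        ≡⟨ sym (+-identityʳ _) ⟩
      K.collapsing all
        ≤⟨ star-α finiteBool finite⊤ (λ _ → tt) _xor_
             (λ { true false _ → refl ; false true _ → refl })
             (λ { true true false _ _ _ → refl ; false false true _ _ _ → refl })
             1 (λ { true → s≤s z≤n ; false → s≤s z≤n }) all (λ _ → refl) ⟩
      2 * 1 ^ #β
        ≡⟨ cong (2 *_) (^-zeroˡ #β) ⟩
      2 ∎

-- Vertex splitting

≡ᵇ-sound : ∀ a b → (a ≡ᵇ b) ≡ true → a ≡ b
≡ᵇ-sound a b eq = ≡ᵇ⇒≡ a b (Equivalence.from Bool.T-≡ eq)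

≡ᵇ-refl : ∀ a → (a ≡ᵇ a) ≡ true
≡ᵇ-refl zero    = refl
≡ᵇ-refl (suc a) = ≡ᵇ-refl a

∑-≡ᵇ≤1 : ∀ n q → ∑ (allFin n) (λ j → ⟦ toℕ j ≡ᵇ q ⟧) ≤ 1
∑-≡ᵇ≤1 zero    q       = z≤n
∑-≡ᵇ≤1 (suc n) zero    = ≤-reflexive (trans (∑-allFin-suc n (λ j → ⟦ toℕ j ≡ᵇ 0 ⟧)) (cong suc (∑-zero (allFin n))))
∑-≡ᵇ≤1 (suc n) (suc q) = ≤-trans (≤-reflexive (∑-allFin-suc n (λ j → ⟦ toℕ j ≡ᵇ suc q ⟧))) (∑-≡ᵇ≤1 n q)

rank : ∀ {n} → (Fin n → Bool) → Fin n → ℕ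
rank P zero    = 0
rank P (suc y) = ⟦ P zero ⟧ + rank (P ∘ suc) y

#_ : ∀ {n} → (Fin n → Bool) → ℕ
#_ {n} P = ∑ (allFin n) (λ y → ⟦ P y ⟧)

#-suc : ∀ {n} (P : Fin (suc n) → Bool) → # P ≡ ⟦ P zero ⟧ + # (P ∘ suc)
#-suc {n} P = ∑-allFin-suc n (λ y → ⟦ P y ⟧)

rank< : ∀ {n} (P : Fin n → Bool) y → P y ≡ true → rank P y < # P
rank< P zero    Py = subst (0 <_) (sym (trans (#-suc P) (cong (λ b → ⟦ b ⟧ + # (P ∘ suc)) Py))) (s≤s z≤n)
rank< P (suc y) Py = subst (rank P (suc y) <_) (sym (#-suc P))
  (subst (_≤ ⟦ P zero ⟧ + # (P ∘ suc)) (+-suc ⟦ P zero ⟧ _) (+-monoʳ-≤ ⟦ P zero ⟧ (rank< (P ∘ suc) y Py)))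

-- `rank P` numbers the positions where `P` holds consecutively from 0.
∑-rank : ∀ {n} (P : Fin n → Bool) (g : ℕ → ℕ) →
  ∑ (allFin n) (λ y → ⟦ P y ⟧ * g (rank P y)) ≡ ∑ (allFin (# P)) (g ∘ toℕ)
∑-rank {zero}  P g = refl
∑-rank {suc n} P g = trans (∑-allFin-suc n (λ y → ⟦ P y ⟧ * g (rank P y)))
  (trans (cong (⟦ P zero ⟧ * g 0 +_) (∑-rank (P ∘ suc) (λ r → g (⟦ P zero ⟧ + r))))
    (trans head (cong (λ k → ∑ (allFin k) (g ∘ toℕ)) (sym (#-suc P)))))
  where
  r = # (P ∘ suc)
  head : ⟦ P zero ⟧ * g 0 + ∑ (allFin r) (λ i → g (⟦ P zero ⟧ + toℕ i)) ≡ ∑ (allFin (⟦ P zero ⟧ + r)) (g ∘ toℕ)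
  head with P zero
  ... | true  = trans (cong (_+ ∑ (allFin r) (λ i → g (suc (toℕ i)))) (*-identityˡ (g 0))) (sym (∑-allFin-suc r (g ∘ toℕ)))
  ... | false = refl

-- A number with quotient `i` is determined by its remainder, which has `D` possible values.
block-size : ∀ (D : ℕ) .{{_ : NonZero D}} k i → ∑ (allFin k) (λ r → ⟦ i ≡ᵇ toℕ r / D ⟧) ≤ D
block-size D k i = begin
  ∑ (allFin k) (λ r → ⟦ i ≡ᵇ toℕ r / D ⟧)
    ≤⟨ ∑-mono (allFin k) (λ r → pointwise (toℕ r)) ⟩
  ∑ (allFin k) (λ r → ∑ (allFin D) (λ j → ⟦ toℕ r ≡ᵇ toℕ j + i * D ⟧))
    ≡⟨ ∑-comm (allFin k) (allFin D) _ ⟩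
  ∑ (allFin D) (λ j → ∑ (allFin k) (λ r → ⟦ toℕ r ≡ᵇ toℕ j + i * D ⟧))
    ≤⟨ ∑-mono (allFin D) (λ j → ∑-≡ᵇ≤1 k (toℕ j + i * D)) ⟩
  ∑ (allFin D) (λ _ → 1)
    ≡⟨ ∑-allFin-1 D ⟩
  D ∎
  where
  open ≤-Reasoning
  pointwise : ∀ r → ⟦ i ≡ᵇ r / D ⟧ ≤ ∑ (allFin D) (λ j → ⟦ r ≡ᵇ toℕ j + i * D ⟧)
  pointwise r with i ≡ᵇ r / D in eq
  ... | false = z≤n
  ... | true  = ≤-trans (≤-reflexive (sym (cong ⟦_⟧ hit))) (term≤∑ (λ j → ⟦ r ≡ᵇ toℕ j + i * D ⟧) (fromℕ< (m%n<n r D)))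
    where
    hit : (r ≡ᵇ toℕ (fromℕ< (m%n<n r D)) + i * D) ≡ true
    hit = trans (cong (r ≡ᵇ_) (trans (cong₂ (λ a b → a + b * D) (Fin.toℕ-fromℕ< _) (≡ᵇ-sound i _ eq))
      (sym (m≡m%n+[m/n]*n r D)))) (≡ᵇ-refl r)

-- Each vertex x of K is split into 1 + d(x)/D copies, the edges at x being distributed
-- among the copies in blocks of D.
module Splitting {n : ℕ} (K : Graph n) (D : ℕ) .{{_ : NonZero D}} where

  deg : Fin n → ℕ
  deg x = # (adj K x)

  -- The `suc` makes room for the last, incomplete block and keeps isolated vertices.
  copies : Fin n → ℕ
  copies x = suc (deg x / D)

  X : Set
  X = Σ (Fin n) (λ x → Fin (copies x))

  slot : Fin n → Fin n → ℕ
  slot x y = rank (adj K x) y / D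

  slot< : ∀ x y → adj K x y ≡ true → slot x y < copies x
  slot< x y xy = s≤s (/-monoˡ-≤ D (<⇒≤ (rank< (adj K x) y xy)))

  E : X → X → Bool
  E (x , i) (y , j) = adj K x y ∧ (toℕ i ≡ᵇ slot x y) ∧ (toℕ j ≡ᵇ slot y x)

  _≟_ : DecidableEquality X
  (x , i) ≟ (y , j) with x Fin.≟ y
  ... | no ne = no λ { refl → ne refl }
  ... | yes refl with i Fin.≟ j
  ...   | yes refl = yes refl
  ...   | no ne    = no λ { refl → ne refl }

  finiteX : Finite X
  finiteX = record { elems = concatMap copiesOf (allFin n) ; _≟_ = _≟_ ; once = once }
    where
    copiesOf : Fin n → List X
    copiesOf x = map (x ,_) (allFin (copies x))
    once : ∀ q → ∑ (concatMap copiesOf (allFin n)) (λ p → ⟦ does (p ≟ q) ⟧) ≡ 1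
    once (y , j) = trans (∑-concatMap copiesOf (allFin n) _)
      (trans (∑-cong (allFin n) (λ x → trans (∑-map (x ,_) (allFin (copies x)) (λ p → ⟦ does (p ≟ (y , j)) ⟧)) (fibre x))) (∑-δFin y))
      where
      fibre : ∀ x → ∑ (allFin (copies x)) (λ i → ⟦ does ((x , i) ≟ (y , j)) ⟧) ≡ ⟦ does (x Fin.≟ y) ⟧
      fibre x = by-cases x (x Fin.≟ y)
        where
        by-cases : ∀ x → Dec (x ≡ y) → ∑ (allFin (copies x)) (λ i → ⟦ does ((x , i) ≟ (y , j)) ⟧) ≡ ⟦ does (x Fin.≟ y) ⟧
        by-cases x (no ne) = trans (trans
          (∑-cong (allFin (copies x)) (λ i → cong ⟦_⟧ (dec-false ((x , i) ≟ (y , j)) (λ { refl → ne refl }))))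
          (∑-zero (allFin (copies x)))) (sym (cong ⟦_⟧ (dec-false (x Fin.≟ y) ne)))
        by-cases x (yes refl) = trans (trans
          (∑-cong (allFin (copies x)) (λ i → cong ⟦_⟧ (does-⇔ ((x , i) ≟ (x , j)) (i Fin.≟ j) (λ { refl → refl }) (λ { refl → refl }))))
          (∑-δFin j)) (sym (cong ⟦_⟧ (dec-true (x Fin.≟ x) refl)))

  ∑-X : (f : X → ℕ) → ∑ (Finite.elems finiteX) f ≡ ∑ (allFin n) (λ x → ∑ (allFin (copies x)) (λ i → f (x , i)))
  ∑-X f = trans (∑-concatMap (λ x → map (x ,_) (allFin (copies x))) (allFin n) f)
    (∑-cong (allFin n) (λ x → ∑-map (x ,_) (allFin (copies x)) f))

  degreeSum : ℕ
  degreeSum = ∑ (allFin n) deg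

  card-X : Finite.card finiteX ≡ n + ∑ (allFin n) (λ x → deg x / D)
  card-X = trans (∑-X (λ _ → 1)) (trans (∑-cong (allFin n) (λ x → ∑-allFin-1 (copies x)))
    (trans (∑-+ (allFin n) (λ _ → 1) _) (cong (_+ ∑ (allFin n) (λ x → deg x / D)) (∑-allFin-1 n))))

  card-lower : n ≤ Finite.card finiteX
  card-lower = ≤-trans (m≤m+n n _) (≤-reflexive (sym card-X))

  -- The copies beyond the first number at most `degreeSum` divided by `D`, hence at most `n`.
  card-upper : degreeSum ≤ D * n → Finite.card finiteX ≤ 2 * n
  card-upper le = ≤-trans (≤-reflexive card-X) (+-monoʳ-≤ n (≤-trans extra (≤-reflexive (sym (+-identityʳ n)))))
    where
    extra : ∑ (allFin n) (λ x → deg x / D) ≤ n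
    extra = *-cancelˡ-≤ D (≤-trans (≤-reflexive (sym (∑-*ˡ (allFin n) D _)))
      (≤-trans (∑-mono (allFin n) (λ x → ≤-trans (≤-reflexive (*-comm D _)) (m/n*n≤m (deg x) D))) le))

  E-sound : ∀ x i y j → E (x , i) (y , j) ≡ true →
    adj K x y ≡ true × toℕ i ≡ slot x y × toℕ j ≡ slot y x
  E-sound x i y j eq with adj K x y | toℕ i ≡ᵇ slot x y in p | toℕ j ≡ᵇ slot y x in q
  ... | true | true | true = refl , ≡ᵇ-sound _ _ p , ≡ᵇ-sound _ _ q

  E⇒adj : ∀ p q → E p q ≡ true → adj K (proj₁ p) (proj₁ q) ≡ true
  E⇒adj (x , i) (y , j) eq = proj₁ (E-sound x i y j eq)

  E-complete : ∀ x i y j → adj K x y ≡ true → toℕ i ≡ slot x y → toℕ j ≡ slot y x → E (x , i) (y , j) ≡ true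
  E-complete x i y j xy p q = cong₂ _∧_ xy (cong₂ _∧_
    (trans (cong (_≡ᵇ slot x y) p) (≡ᵇ-refl (slot x y))) (trans (cong (_≡ᵇ slot y x) q) (≡ᵇ-refl (slot y x))))

  E-sym : ∀ p q → E p q ≡ true → E q p ≡ true
  E-sym (x , i) (y , j) eq with E-sound x i y j eq
  ... | xy , p , q = E-complete y j x i (trans (Graph.sym K y x) xy) q p

  -- The copy of `x` that carries the edge to `y` is determined by `slot x y`.
  locally-injective : ∀ p p' q → E p q ≡ true → E p' q ≡ true → proj₁ p ≡ proj₁ p' → p ≡ p'
  locally-injective (x , i) (.x , i') (y , j) eq eq' refl =
    cong (x ,_) (Fin.toℕ-injective (trans (proj₁ (proj₂ (E-sound x i y j eq))) (sym (proj₁ (proj₂ (E-sound x i' y j eq'))))))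

  loopless : ∀ p q → E p q ≡ true → proj₁ p ≢ proj₁ q
  loopless (x , i) (.x , j) eq refl with trans (sym (proj₁ (E-sound x i x j eq))) (irrefl K x)
  ... | ()

  degree : ∀ p → ∑ (Finite.elems finiteX) (λ q → ⟦ E p q ⟧) ≤ D
  degree (x , i) = begin
    ∑ (Finite.elems finiteX) (λ q → ⟦ E (x , i) q ⟧)
      ≡⟨ ∑-X _ ⟩
    ∑ (allFin n) (λ y → ∑ (allFin (copies y)) (λ j → ⟦ E (x , i) (y , j) ⟧))
      ≤⟨ ∑-mono (allFin n) pointwise ⟩
    ∑ (allFin n) (λ y → ⟦ adj K x y ⟧ * ⟦ toℕ i ≡ᵇ slot x y ⟧)
      ≡⟨ ∑-rank (adj K x) (λ r → ⟦ toℕ i ≡ᵇ r / D ⟧) ⟩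
    ∑ (allFin (deg x)) (λ r → ⟦ toℕ i ≡ᵇ toℕ r / D ⟧)
      ≤⟨ block-size D (deg x) (toℕ i) ⟩
    D ∎
    where
    open ≤-Reasoning
    pointwise : ∀ y → ∑ (allFin (copies y)) (λ j → ⟦ E (x , i) (y , j) ⟧) ≤ ⟦ adj K x y ⟧ * ⟦ toℕ i ≡ᵇ slot x y ⟧
    pointwise y with adj K x y | toℕ i ≡ᵇ slot x y
    ... | true  | true  = ∑-≡ᵇ≤1 (copies y) (slot y x)
    ... | true  | false = ≤-reflexive (∑-zero (allFin (copies y)))
    ... | false | _     = ≤-reflexive (∑-zero (allFin (copies y)))

  mass : degreeSum ≤ ∑ (Finite.elems finiteX) (λ p → ∑ (Finite.elems finiteX) (λ q → ⟦ E p q ⟧))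
  mass = begin
    ∑ (allFin n) (λ x → ∑ (allFin n) (λ y → ⟦ adj K x y ⟧))
      ≤⟨ ∑-mono (allFin n) (λ x → ∑-mono (allFin n) (λ y → pointwise x y)) ⟩
    ∑ (allFin n) (λ x → ∑ (allFin n) (λ y → ∑ (allFin (copies x)) (λ i → ∑ (allFin (copies y)) (λ j → ⟦ E (x , i) (y , j) ⟧))))
      ≡⟨ ∑-cong (allFin n) (λ x → ∑-comm (allFin n) (allFin (copies x)) _) ⟩
    ∑ (allFin n) (λ x → ∑ (allFin (copies x)) (λ i → ∑ (allFin n) (λ y → ∑ (allFin (copies y)) (λ j → ⟦ E (x , i) (y , j) ⟧))))
      ≡⟨ ∑-cong (allFin n) (λ x → ∑-cong (allFin (copies x)) (λ i → sym (∑-X _))) ⟩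
    ∑ (allFin n) (λ x → ∑ (allFin (copies x)) (λ i → ∑ (Finite.elems finiteX) (λ q → ⟦ E (x , i) q ⟧)))
      ≡⟨ sym (∑-X _) ⟩
    ∑ (Finite.elems finiteX) (λ p → ∑ (Finite.elems finiteX) (λ q → ⟦ E p q ⟧)) ∎
    where
    open ≤-Reasoning
    pointwise : ∀ x y → ⟦ adj K x y ⟧ ≤ ∑ (allFin (copies x)) (λ i → ∑ (allFin (copies y)) (λ j → ⟦ E (x , i) (y , j) ⟧))
    pointwise x y with adj K x y in xy
    ... | false = z≤n
    ... | true  = ≤-trans (≤-reflexive (sym (cong ⟦_⟧ hit)))
      (≤-trans (term≤∑ (λ j → ⟦ E′ i j ⟧) j) (term≤∑ (λ i → ∑ (allFin (copies y)) (λ j → ⟦ E′ i j ⟧)) i))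
      where
      yx = trans (Graph.sym K y x) xy
      i = fromℕ< (slot< x y xy)
      j = fromℕ< (slot< y x yx)
      E′ : Fin (copies x) → Fin (copies y) → Bool
      E′ i j = true ∧ (toℕ i ≡ᵇ slot x y) ∧ (toℕ j ≡ᵇ slot y x)
      hit : E′ i j ≡ true
      hit = cong₂ _∧_
        (trans (cong (_≡ᵇ slot x y) (Fin.toℕ-fromℕ< (slot< x y xy))) (≡ᵇ-refl (slot x y)))
        (trans (cong (_≡ᵇ slot y x) (Fin.toℕ-fromℕ< (slot< y x yx))) (≡ᵇ-refl (slot y x)))

-- The coset graph

cosize-1 : ∀ {m} (I : Subset m) → suc ∣ I ∣ ≡ m → Σ (Fin m) λ i₀ → ∀ k → (k ≡ i₀) ⊎ (k ∈ I)
cosize-1 (outside ∷ I) eq = zero , λ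
  { zero → inj₁ refl
  ; (suc k) → inj₂ (there (subst (k ∈_) (sym (∣p∣≡n⇒p≡⊤ (suc-injective eq))) ∈⊤)) }
cosize-1 (inside ∷ I) eq with cosize-1 I (suc-injective eq)
... | i₀ , covers = suc i₀ , λ { zero → inj₂ here ; (suc k) → lift (covers k) }
  where
  lift : ∀ {k} → (k ≡ i₀) ⊎ (k ∈ I) → (suc k ≡ suc i₀) ⊎ (suc k ∈ inside ∷ I)
  lift (inj₁ eq) = inj₁ (cong suc eq)
  lift (inj₂ k∈) = inj₂ (there k∈)

<ᵇ-total : ∀ a b → a ≢ b → (b <ᵇ a) ≡ not (a <ᵇ b)
<ᵇ-total zero    zero    ne = ⊥-elim (ne refl)
<ᵇ-total zero    (suc b) ne = refl
<ᵇ-total (suc a) zero    ne = refl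
<ᵇ-total (suc a) (suc b) ne = <ᵇ-total a b (ne ∘ cong suc)

countF≡∑ : ∀ {n} (P : Fin n → Bool) → countF P ≡ ∑ (allFin n) (λ a → ⟦ P a ⟧)
countF≡∑ {n} P = sym (∑≡sum (allFin n) (λ a → ⟦ P a ⟧))

edges≡∑ : ∀ {n} (K : Graph n) →
  edges K ≡ ∑ (allFin n) (λ a → ∑ (allFin n) (λ b → ⟦ (toℕ a <ᵇ toℕ b) ∧ adj K a b ⟧))
edges≡∑ {n} K = trans (sym (∑≡sum (allFin n) (λ a → countF (λ b → (toℕ a <ᵇ toℕ b) ∧ adj K a b))))
  (∑-cong (allFin n) (λ a → countF≡∑ (λ b → (toℕ a <ᵇ toℕ b) ∧ adj K a b)))

module CosetGraph {N m : ℕ} (G : FinGroup N) (s : Fin m → Fin N) (M : Fin m → Fin m → ℕ)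
  (cox : IsCoxeterSystem G s M) (I J : Subset m)
  {v : ℕ} (H : Graph v) (iso : CosetGraphIso G s I J H) where
  open CosetGeometry G s M cox
  open CosetGraphIso iso

  Parabolic : Subset m → Fin N → Set
  Parabolic K x = Σ (List (Fin m)) λ is → All (_∈ K) is × word is ≡ x

  toParabolic : ∀ {K x} → InParabolic G s K x → Parabolic K x
  toParabolic (w , all , eq) = letters w , All.map⁺ all , trans (sym (evalWord≡word w)) eq

  fromParabolic : ∀ {K x} → Parabolic K x → InParabolic G s K x
  fromParabolic (is , all , eq) = signed is , signed-all is all , trans (evalWord≡word (signed is)) (trans (cong word (letters-signed is)) eq)
    where
    signed : List (Fin m) → List (Fin m × Bool)
    signed = map (_, false)
    letters-signed : ∀ is → letters (signed is) ≡ is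
    letters-signed []       = refl
    letters-signed (i ∷ is) = cong (i ∷_) (letters-signed is)
    signed-all : ∀ {K} is → All (_∈ K) is → All (λ l → proj₁ l ∈ K) (signed is)
    signed-all []       []       = []
    signed-all (i ∷ is) (p ∷ ps) = p ∷ signed-all is ps

  word-++ : ∀ is js → word (is ++ js) ≡ word is · word js
  word-++ []       js = sym (identityˡ _)
  word-++ (i ∷ is) js = trans (cong (s i ·_) (word-++ is js)) (sym (assoc _ _ _))

  parabolic-· : ∀ {K x y} → Parabolic K x → Parabolic K y → Parabolic K (x · y)
  parabolic-· (is , p , refl) (js , q , refl) = is ++ js , All.++⁺ p q , word-++ is js

  parabolic-inv : ∀ {K x} → Parabolic K x → Parabolic K (inv x)
  parabolic-inv ([] , [] , refl) = [] , [] , sym inv-e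
  parabolic-inv (i ∷ is , p ∷ ps , refl) = subst (Parabolic _)
    (trans (cong (inv (word is) ·_) (trans (identityʳ _) (sym (inv-s i)))) (sym (inv-· (s i) (word is))))
    (parabolic-· (parabolic-inv (is , ps , refl)) (i ∷ [] , p ∷ [] , refl))

  α β : Fin N → Fin v
  α w = from (inj₁ w)
  β w = from (inj₂ w)

  to-α : ∀ w → Σ (Fin N) λ x → to (α w) ≡ inj₁ x × Parabolic I (inv x · w)
  to-α w with to (α w) | to-from (inj₁ w)
  ... | inj₁ x | rel = x , refl , toParabolic rel

  to-β : ∀ w → Σ (Fin N) λ x → to (β w) ≡ inj₂ x × Parabolic J (inv x · w)
  to-β w with to (β w) | to-from (inj₂ w)
  ... | inj₂ x | rel = x , refl , toParabolic rel

  α-cong : ∀ x y → Parabolic I (inv x · y) → α x ≡ α y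
  α-cong x y p = from-resp (inj₁ x) (inj₁ y) (fromParabolic p)

  β-cong : ∀ x y → Parabolic J (inv x · y) → β x ≡ β y
  β-cong x y p = from-resp (inj₂ x) (inj₂ y) (fromParabolic p)

  common : ∀ {K} x w w' → Parabolic K (inv x · w) → Parabolic K (inv x · w') → Parabolic K (inv w · w')
  common x w w' p q = subst (Parabolic _) eq (parabolic-· (parabolic-inv p) q)
    where
    eq : inv (inv x · w) · (inv x · w') ≡ inv w · w'
    eq = trans (cong (_· (inv x · w')) (trans (inv-· (inv x) w) (cong (inv w ·_) (inv-inv x))))
      (trans (assoc _ _ _) (cong (inv w ·_) (cancel-invˡ x w')))

  α-injective : ∀ w w' → α w ≡ α w' → Parabolic I (inv w · w')
  α-injective w w' eq with to-α w | to-α w'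
  ... | x , p , pw | x' , p' , pw' with trans (sym p) (trans (cong to eq) p')
  ...   | refl = common x w w' pw pw'

  β-injective : ∀ w w' → β w ≡ β w' → Parabolic J (inv w · w')
  β-injective w w' eq with to-β w | to-β w'
  ... | x , p , pw | x' , p' , pw' with trans (sym p) (trans (cong to eq) p')
  ...   | refl = common x w w' pw pw'

  shift : Fin N → Fin N ⊎ Fin N → Fin N ⊎ Fin N
  shift g (inj₁ x) = inj₁ (g · x)
  shift g (inj₂ x) = inj₂ (g · x)

  action : Fin N → Fin v → Fin v
  action g u = from (shift g (to u))

  translate : ∀ g x w → inv (g · x) · (g · w) ≡ inv x · w
  translate g x w = trans (cong (_· (g · w)) (inv-· g x)) (trans (assoc _ _ _) (cong (inv x ·_) (inv-cancelˡ g w)))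

  step : ∀ {K k} → k ∈ K → ∀ x → Parabolic K (inv x · (x · s k))
  step {k = k} k∈ x = k ∷ [] , k∈ ∷ [] , trans (identityʳ _) (sym (inv-cancelˡ x (s k)))

  α-fixes : ∀ k → k ∈ I → Fixes α k
  α-fixes k k∈ x = sym (α-cong x (x · s k) (step k∈ x))

  β-fixes : ∀ k → k ∈ J → Fixes β k
  β-fixes k k∈ x = sym (β-cong x (x · s k) (step k∈ x))

  α-orbit : Orbit action α
  α-orbit = record { equivariant = equiv ; gallery = gal }
    where
    equiv : ∀ g w → α (g · w) ≡ action g (α w)
    equiv g w with to (α w) | to-α w
    ... | _ | x , refl , p = sym (α-cong (g · x) (g · w) (subst (Parabolic I) (sym (translate g x w)) p))
    gal : ∀ w w' → α w ≡ α w' → Σ (List (Fin m)) λ is → All (Fixes α) is × w · word is ≡ w'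
    gal w w' eq with α-injective w w' eq
    ... | is , all , p = is , fixes is all , trans (cong (w ·_) p) (cancel-invˡ w w')
      where
      fixes : ∀ is → All (_∈ I) is → All (Fixes α) is
      fixes []       []       = []
      fixes (i ∷ is) (p ∷ ps) = α-fixes i p ∷ fixes is ps

  β-orbit : Orbit action β
  β-orbit = record { equivariant = equiv ; gallery = gal }
    where
    equiv : ∀ g w → β (g · w) ≡ action g (β w)
    equiv g w with to (β w) | to-β w
    ... | _ | x , refl , p = sym (β-cong (g · x) (g · w) (subst (Parabolic J) (sym (translate g x w)) p))
    gal : ∀ w w' → β w ≡ β w' → Σ (List (Fin m)) λ is → All (Fixes β) is × w · word is ≡ w'
    gal w w' eq with β-injective w w' eq
    ... | is , all , p = is , fixes is all , trans (cong (w ·_) p) (cancel-invˡ w w')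
      where
      fixes : ∀ is → All (_∈ J) is → All (Fixes β) is
      fixes []       []       = []
      fixes (i ∷ is) (p ∷ ps) = β-fixes i p ∷ fixes is ps

  representative : Fin v → Fin N
  representative u with to u
  ... | inj₁ x = x
  ... | inj₂ x = x

  structure : CosetStructure v
  structure = record
    { act = action ; α = α ; β = β ; orbitα = α-orbit ; orbitβ = β-orbit
    ; rep = representative ; cover = covers ; α≢β = distinct }
    where
    covers : ∀ u → (u ≡ α (representative u)) ⊎ (u ≡ β (representative u))
    covers u with to u | from-to u
    ... | inj₁ x | eq = inj₁ (sym eq)
    ... | inj₂ x | eq = inj₂ (sym eq)
    distinct : ∀ w w' → α w ≢ β w'
    distinct w w' eq with to-α w | to-β w'
    ... | x , p , _ | x' , p' , _ with trans (sym p) (trans (cong to eq) p')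
    ...   | ()

  open Domination G s M cox structure using (isα; isα-α; isα-β; #α; #β; edgeStabilizer; multiplicity)
  open CosetStructure structure using (rep; cover; α≢β)

  isα≡isPart₁ : ∀ u → isα u ≡ isPart₁ (to u)
  isα≡isPart₁ u with cover u
  ... | inj₁ eq = trans (trans (cong isα eq) (isα-α (rep u)))
          (sym (trans (cong (isPart₁ ∘ to) eq) (cong isPart₁ (proj₁ (proj₂ (to-α (rep u)))))))
  ... | inj₂ eq = trans (trans (cong isα eq) (isα-β (rep u)))
          (sym (trans (cong (isPart₁ ∘ to) eq) (cong isPart₁ (proj₁ (proj₂ (to-β (rep u)))))))

  largerPart≡ : largerPart ≡ #α ⊔ #β
  largerPart≡ = cong₂ _⊔_
    (trans (countF≡∑ (λ a → isPart₁ (to a))) (∑-cong (allFin v) (λ u → cong ⟦_⟧ (sym (isα≡isPart₁ u)))))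
    (trans (countF≡∑ (λ a → not (isPart₁ (to a)))) (∑-cong (allFin v) (λ u → cong (⟦_⟧ ∘ not) (sym (isα≡isPart₁ u)))))

  adj-sound : ∀ a b → adj H a b ≡ true → Σ (Fin N) λ w → (a ≡ α w × b ≡ β w) ⊎ (a ≡ β w × b ≡ α w)
  adj-sound a b ab with to a | to b | from-to a | from-to b | adj-to a b ab
  ... | inj₁ x | inj₂ y | fa | fb | w , xw , yw =
    w , inj₁ (trans (sym fa) (from-resp (inj₁ x) (inj₁ w) xw) , trans (sym fb) (from-resp (inj₂ y) (inj₂ w) yw))
  ... | inj₂ y | inj₁ x | fa | fb | w , xw , yw =
    w , inj₂ (trans (sym fa) (from-resp (inj₂ y) (inj₂ w) yw) , trans (sym fb) (from-resp (inj₁ x) (inj₁ w) xw))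

  adj-αβ : ∀ w → adj H (α w) (β w) ≡ true
  adj-αβ w = adj-from (α w) (β w) meet
    where
    meet : CosetAdj G s I J (to (α w)) (to (β w))
    meet with to (α w) | to (β w) | to-α w | to-β w
    ... | _ | _ | x , refl , p | y , refl , q = w , fromParabolic p , fromParabolic q

  adj-parts : ∀ a b → adj H a b ≡ true → isα b ≡ not (isα a)
  adj-parts a b ab with adj-sound a b ab
  ... | w , inj₁ (refl , refl) = trans (isα-β w) (cong not (sym (isα-α w)))
  ... | w , inj₂ (refl , refl) = trans (isα-α w) (cong not (sym (isα-β w)))

  distinct-ends : ∀ a b → adj H a b ≡ true → toℕ a ≢ toℕ b
  distinct-ends a b ab eq with Fin.toℕ-injective eq
  ... | refl with trans (sym ab) (irrefl H a)
  ...   | ()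

  -- Each edge has exactly one end in the part of `α`; orienting it from that end replaces the order
  -- of the indices.
  edges≡oriented : edges H ≡ ∑ (allFin v) (λ a → ∑ (allFin v) (λ b → ⟦ isα a ∧ adj H a b ⟧))
  edges≡oriented = begin
    edges H
      ≡⟨ edges≡∑ H ⟩
    ∑∑ (λ a b → ⟦ a ≺ b ∧ adj H a b ⟧)
      ≡⟨ ∑∑-cong split ⟩
    ∑∑ (λ a b → ⟦ a ≺ b ∧ (isα a ∧ adj H a b) ⟧ + ⟦ a ≺ b ∧ (isα b ∧ adj H b a) ⟧)
      ≡⟨ ∑∑-+ _ _ ⟩
    ∑∑ (λ a b → ⟦ a ≺ b ∧ (isα a ∧ adj H a b) ⟧) + ∑∑ (λ a b → ⟦ a ≺ b ∧ (isα b ∧ adj H b a) ⟧)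
      ≡⟨ cong (∑∑ (λ a b → ⟦ a ≺ b ∧ (isα a ∧ adj H a b) ⟧) +_) (∑-comm (allFin v) (allFin v) _) ⟩
    ∑∑ (λ a b → ⟦ a ≺ b ∧ (isα a ∧ adj H a b) ⟧) + ∑∑ (λ a b → ⟦ b ≺ a ∧ (isα a ∧ adj H a b) ⟧)
      ≡⟨ sym (∑∑-+ _ _) ⟩
    ∑∑ (λ a b → ⟦ a ≺ b ∧ (isα a ∧ adj H a b) ⟧ + ⟦ b ≺ a ∧ (isα a ∧ adj H a b) ⟧)
      ≡⟨ ∑∑-cong (λ a b → sym (either a b)) ⟩
    ∑∑ (λ a b → ⟦ isα a ∧ adj H a b ⟧) ∎
    where
    open ≡-Reasoning
    ∑∑ : (Fin v → Fin v → ℕ) → ℕ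
    ∑∑ f = ∑ (allFin v) (λ a → ∑ (allFin v) (f a))
    ∑∑-cong : ∀ {f g : Fin v → Fin v → ℕ} → (∀ a b → f a b ≡ g a b) → ∑∑ f ≡ ∑∑ g
    ∑∑-cong eq = ∑-cong (allFin v) (λ a → ∑-cong (allFin v) (eq a))
    ∑∑-+ : ∀ (f g : Fin v → Fin v → ℕ) → ∑∑ (λ a b → f a b + g a b) ≡ ∑∑ f + ∑∑ g
    ∑∑-+ f g = trans (∑-cong (allFin v) (λ a → ∑-+ (allFin v) (f a) (g a))) (∑-+ (allFin v) _ _)
    infix 9 _≺_
    _≺_ : Fin v → Fin v → Bool
    a ≺ b = toℕ a <ᵇ toℕ b
    split : ∀ a b → ⟦ a ≺ b ∧ adj H a b ⟧ ≡ ⟦ a ≺ b ∧ (isα a ∧ adj H a b) ⟧ + ⟦ a ≺ b ∧ (isα b ∧ adj H b a) ⟧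
    split a b rewrite Graph.sym H b a with adj H a b in ab
    ... | false rewrite Bool.∧-zeroʳ (isα a) | Bool.∧-zeroʳ (isα b) | Bool.∧-zeroʳ (a ≺ b) = refl
    ... | true rewrite adj-parts a b ab with isα a | a ≺ b
    ...   | true  | true  = refl
    ...   | true  | false = refl
    ...   | false | true  = refl
    ...   | false | false = refl
    either : ∀ a b → ⟦ isα a ∧ adj H a b ⟧ ≡ ⟦ a ≺ b ∧ (isα a ∧ adj H a b) ⟧ + ⟦ b ≺ a ∧ (isα a ∧ adj H a b) ⟧
    either a b with adj H a b in ab
    ... | false rewrite Bool.∧-zeroʳ (isα a) | Bool.∧-zeroʳ (a ≺ b) | Bool.∧-zeroʳ (b ≺ a) = refl
    ... | true rewrite <ᵇ-total (toℕ a) (toℕ b) (distinct-ends a b ab) with isα a | a ≺ b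
    ...   | true  | true  = refl
    ...   | true  | false = refl
    ...   | false | true  = refl
    ...   | false | false = refl

  -- Orbit counting: every chamber represents an edge, and the chambers representing a given edge
  -- form a left coset of the edge stabilizer.
  chambers≤ : N ≤ multiplicity * edges H
  chambers≤ = begin
    N
      ≡⟨ sym (∑-allFin-1 N) ⟩
    ∑ (allFin N) (λ _ → 1)
      ≤⟨ ∑-mono (allFin N) covered ⟩
    ∑ (allFin N) (λ w → ∑ (allFin v) (λ a → ∑ (allFin v) (λ b → on w a b * ⟦ isα a ∧ adj H a b ⟧)))
      ≡⟨ trans (∑-comm (allFin N) (allFin v) _) (∑-cong (allFin v) (λ a → trans (∑-comm (allFin N) (allFin v) _)
           (∑-cong (allFin v) (λ b → ∑-*ʳ (allFin N) (λ w → on w a b) _)))) ⟩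
    ∑ (allFin v) (λ a → ∑ (allFin v) (λ b → ∑ (allFin N) (λ w → on w a b) * ⟦ isα a ∧ adj H a b ⟧))
      ≤⟨ ∑-mono (allFin v) (λ a → ∑-mono (allFin v) (λ b → *-monoˡ-≤ ⟦ isα a ∧ adj H a b ⟧ (fibre a b))) ⟩
    ∑ (allFin v) (λ a → ∑ (allFin v) (λ b → multiplicity * ⟦ isα a ∧ adj H a b ⟧))
      ≡⟨ trans (∑-cong (allFin v) (λ a → ∑-*ˡ (allFin v) multiplicity _)) (∑-*ˡ (allFin v) multiplicity _) ⟩
    multiplicity * ∑ (allFin v) (λ a → ∑ (allFin v) (λ b → ⟦ isα a ∧ adj H a b ⟧))
      ≡⟨ cong (multiplicity *_) (sym edges≡oriented) ⟩
    multiplicity * edges H ∎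
    where
    open ≤-Reasoning
    on : Fin N → Fin v → Fin v → ℕ
    on w a b = ⟦ does (α w Fin.≟ a) ∧ does (β w Fin.≟ b) ⟧
    covered : ∀ w → 1 ≤ ∑ (allFin v) (λ a → ∑ (allFin v) (λ b → on w a b * ⟦ isα a ∧ adj H a b ⟧))
    covered w = ≤-trans (≤-reflexive (sym (cong₂ _*_
        (cong ⟦_⟧ (cong₂ _∧_ (dec-true (α w Fin.≟ α w) refl) (dec-true (β w Fin.≟ β w) refl)))
        (cong ⟦_⟧ (cong₂ _∧_ (isα-α w) (adj-αβ w))))))
      (≤-trans (term≤∑ (λ b → on w (α w) b * ⟦ isα (α w) ∧ adj H (α w) b ⟧) (β w))
        (term≤∑ (λ a → ∑ (allFin v) (λ b → on w a b * ⟦ isα a ∧ adj H a b ⟧)) (α w)))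
    stab : ∀ w₀ w → edgeStabilizer (inv w₀ · w) ≡ does (α w Fin.≟ α w₀) ∧ does (β w Fin.≟ β w₀)
    stab w₀ w = cong₂ _∧_
      (does-⇔ (α (inv w₀ · w) Fin.≟ α e) (α w Fin.≟ α w₀)
        (λ eq → trans (cong α (sym (cancel-invˡ w₀ w))) (trans (Orbit.equivariant α-orbit w₀ _)
          (trans (cong (action w₀) eq) (trans (sym (Orbit.equivariant α-orbit w₀ e)) (cong α (identityʳ w₀))))))
        (λ eq → trans (Orbit.equivariant α-orbit (inv w₀) w) (trans (cong (action (inv w₀)) eq)
          (trans (sym (Orbit.equivariant α-orbit (inv w₀) w₀)) (cong α (inverseˡ w₀))))))
      (does-⇔ (β (inv w₀ · w) Fin.≟ β e) (β w Fin.≟ β w₀)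
        (λ eq → trans (cong β (sym (cancel-invˡ w₀ w))) (trans (Orbit.equivariant β-orbit w₀ _)
          (trans (cong (action w₀) eq) (trans (sym (Orbit.equivariant β-orbit w₀ e)) (cong β (identityʳ w₀))))))
        (λ eq → trans (Orbit.equivariant β-orbit (inv w₀) w) (trans (cong (action (inv w₀)) eq)
          (trans (sym (Orbit.equivariant β-orbit (inv w₀) w₀)) (cong β (inverseˡ w₀))))))
    fibre : ∀ a b → ∑ (allFin N) (λ w → on w a b) ≤ multiplicity
    fibre a b with ∑ (allFin N) (λ w → on w a b) in eq
    ... | zero  = z≤n
    ... | suc l with ∑-pos (allFin N) (λ w → on w a b) (subst (0 <_) (sym eq) (s≤s z≤n))
    ...   | w₀ , pos with α w₀ Fin.≟ a | β w₀ Fin.≟ b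
    ...     | yes refl | yes refl = ≤-reflexive (trans (sym eq) (trans
      (∑-cong (allFin N) (λ w → cong ⟦_⟧ (sym (stab w₀ w))))
      (Finite.∑-bijection (finiteFin N) (inv w₀ ·_) (w₀ ·_) (inv-cancelˡ w₀) (cancel-invˡ w₀) (λ w → ⟦ edgeStabilizer w ⟧))))

  -- If W_I = W_J, then the graph is a perfect matching.
  matching : (∀ k → k ∈ I → k ∈ J) → edges H ≤ #α
  matching I⊆J = ≤-trans (≤-reflexive edges≡oriented) (∑-mono (allFin v) pointwise)
    where
    pointwise : ∀ a → ∑ (allFin v) (λ b → ⟦ isα a ∧ adj H a b ⟧) ≤ ⟦ isα a ⟧
    pointwise a with a Fin.≟ α (rep a)
    ... | no _  = ≤-reflexive (∑-zero (allFin v))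
    ... | yes a≡ = ≤-trans (∑-mono (allFin v) partner) (≤-reflexive (∑-δFin (β (rep a))))
      where
      enlarge : ∀ is → All (_∈ I) is → All (_∈ J) is
      enlarge []       []       = []
      enlarge (i ∷ is) (p ∷ ps) = I⊆J i p ∷ enlarge is ps
      partner : ∀ b → ⟦ adj H a b ⟧ ≤ ⟦ does (b Fin.≟ β (rep a)) ⟧
      partner b with adj H a b in ab
      ... | false = z≤n
      ... | true with adj-sound a b ab
      ...   | w , inj₂ (a≡β , _) = ⊥-elim (α≢β _ _ (trans (sym a≡) a≡β))
      ...   | w , inj₁ (a≡α , b≡β) with α-injective w (rep a) (trans (sym a≡α) a≡)
      ...     | is , all , eq = ≤-reflexive (sym (cong ⟦_⟧ (dec-true (b Fin.≟ β (rep a))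
        (trans b≡β (β-cong w (rep a) (is , enlarge is all , eq))))))

  -- This is the connectivity of H. A generator outside both `I` and `J` would be the one missing
  -- from each, so the graph would be a matching with at most `largerPart` edges.
  linked : suc ∣ I ∣ ≡ m → suc ∣ J ∣ ≡ m → largerPart < edges H → ∀ k → Fixes α k ⊎ Fixes β k
  linked |I| |J| t<edges k with k ∈? I | k ∈? J
  ... | yes k∈I | _       = inj₁ (α-fixes k k∈I)
  ... | no _    | yes k∈J = inj₂ (β-fixes k k∈J)
  ... | no k∉I  | no k∉J  = ⊥-elim (<⇒≱ t<edges (≤-trans (matching I⊆J) (≤-trans (m≤m⊔n #α #β) (≤-reflexive (sym largerPart≡)))))
    where
    I⊆J : ∀ j → j ∈ I → j ∈ J
    I⊆J j j∈I with proj₂ (cosize-1 J |J|) j | proj₂ (cosize-1 J |J|) k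
    ... | inj₂ j∈J | _        = j∈J
    ... | inj₁ _   | inj₂ k∈J = ⊥-elim (k∉J k∈J)
    ... | inj₁ p   | inj₁ q   = ⊥-elim (k∉I (subst (_∈ I) (trans p (sym q)) j∈I))

  cosize-α : suc ∣ I ∣ ≡ m → Σ (Fin m) λ i₀ → ∀ k → (k ≡ i₀) ⊎ Fixes α k
  cosize-α |I| with cosize-1 I |I|
  ... | i₀ , covers = i₀ , λ k → map₂ (α-fixes k) (covers k)

  cosize-β : suc ∣ J ∣ ≡ m → Σ (Fin m) λ i₀ → ∀ k → (k ≡ i₀) ⊎ Fixes β k
  cosize-β |J| with cosize-1 J |J|
  ... | i₀ , covers = i₀ , λ k → map₂ (β-fixes k) (covers k)

-- The extremal bound

edges≤degreeSum : ∀ {n} (K : Graph n) → edges K ≤ ∑ (allFin n) (λ x → # adj K x)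
edges≤degreeSum {n} K = ≤-trans (≤-reflexive (edges≡∑ K))
  (∑-mono (allFin n) (λ a → ∑-mono (allFin n) (λ b → weaken (toℕ a <ᵇ toℕ b) (adj K a b))))
  where
  weaken : ∀ p q → ⟦ p ∧ q ⟧ ≤ ⟦ q ⟧
  weaken true  q = ≤-refl
  weaken false q = z≤n

-- The estimates m^ε n̂^v ≤ n̂^(2ε) hom, hom ≤ c₀ n̂ D^t and n ≤ n̂ ≤ 2n combine, when m > n and Dn ≤ 2m.
module Assembly (q t p c₀ : ℕ) where
  ε v : ℕ
  ε = q + t
  v = suc (p + t)

  C : ℕ
  C = 2 ^ (2 * ε) * c₀ * 2 * 2 ^ t

  assemble : ∀ m n n̂ D hom .{{_ : NonZero m}} .{{_ : NonZero n}} →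
    n ≤ n̂ → n̂ ≤ 2 * n → D * n ≤ 2 * m →
    m ^ ε * n̂ ^ v ≤ n̂ ^ (2 * ε) * hom → hom ≤ c₀ * (n̂ * D ^ t) →
    m ^ q * n ^ p ≤ C * n ^ (2 * q)
  assemble m n n̂ D hom n≤n̂ n̂≤2n Dn≤2m lower upper =
    -- The factors m^t and n^(t+1) complete the exponents q and p to `ε` and `v`; the remaining n^t
    -- pays for D^t through Dn <= 2m.
    *-cancelʳ-≤ _ _ (m ^ t * (n * (n ^ t * n ^ t))) {{nonZero}} (begin
      m ^ q * n ^ p * (m ^ t * (n * (n ^ t * n ^ t)))
        ≡⟨ trans (l₁ (m ^ q) (n ^ p) (m ^ t) n (n ^ t))
             (cong₂ (λ a b → a * (n * b) * n ^ t) (sym (^-distribˡ-+-* m q t)) (sym (^-distribˡ-+-* n p t))) ⟩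
      m ^ ε * n ^ v * n ^ t
        ≤⟨ *-monoˡ-≤ (n ^ t) (≤-trans (*-monoʳ-≤ (m ^ ε) (^-monoˡ-≤ v n≤n̂)) (≤-trans lower (*-monoʳ-≤ (n̂ ^ (2 * ε)) upper))) ⟩
      n̂ ^ (2 * ε) * (c₀ * (n̂ * D ^ t)) * n ^ t
        ≤⟨ *-monoˡ-≤ (n ^ t) (*-mono-≤ (^-monoˡ-≤ (2 * ε) n̂≤2n) (*-monoʳ-≤ c₀ (*-monoˡ-≤ (D ^ t) n̂≤2n))) ⟩
      (2 * n) ^ (2 * ε) * (c₀ * (2 * n * D ^ t)) * n ^ t
        ≡⟨ l₂ ((2 * n) ^ (2 * ε)) c₀ n (D ^ t) (n ^ t) ⟩
      (2 * n) ^ (2 * ε) * c₀ * 2 * n * (D ^ t * n ^ t)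
        ≤⟨ *-monoʳ-≤ ((2 * n) ^ (2 * ε) * c₀ * 2 * n) (≤-trans (≤-reflexive (sym (*-^ D n t)))
             (≤-trans (^-monoˡ-≤ t Dn≤2m) (≤-reflexive (*-^ 2 m t)))) ⟩
      (2 * n) ^ (2 * ε) * c₀ * 2 * n * (2 ^ t * m ^ t)
        ≡⟨ cong (λ a → a * c₀ * 2 * n * (2 ^ t * m ^ t)) (trans (*-^ 2 n (2 * ε)) (cong (2 ^ (2 * ε) *_) exponents)) ⟩
      2 ^ (2 * ε) * (n ^ (2 * q) * (n ^ t * n ^ t)) * c₀ * 2 * n * (2 ^ t * m ^ t)
        ≡⟨ l₃ (2 ^ (2 * ε)) (n ^ (2 * q)) (n ^ t) c₀ n (2 ^ t) (m ^ t) ⟩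
      C * n ^ (2 * q) * (m ^ t * (n * (n ^ t * n ^ t))) ∎)
    where
    open ≤-Reasoning
    nonZero : NonZero (m ^ t * (n * (n ^ t * n ^ t)))
    nonZero = m*n≢0 _ _ {{m^n≢0 m t}} {{m*n≢0 n _ {{it}} {{m*n≢0 _ _ {{m^n≢0 n t}} {{m^n≢0 n t}}}}}}
      where
      it : NonZero n
      it = >-nonZero (>-nonZero⁻¹ n)
    exponents : n ^ (2 * ε) ≡ n ^ (2 * q) * (n ^ t * n ^ t)
    exponents = trans (cong (n ^_) (double q t)) (trans (^-distribˡ-+-* n (2 * q) (t + t))
      (cong (n ^ (2 * q) *_) (^-distribˡ-+-* n t t)))
      where
      double : ∀ q t → 2 * (q + t) ≡ 2 * q + (t + t)
      double = solve-∀
    l₁ : ∀ a b c n d → a * b * (c * (n * (d * d))) ≡ a * c * (n * (b * d)) * d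
    l₁ = solve-∀
    l₂ : ∀ a c n d f → a * (c * (2 * n * d)) * f ≡ a * c * 2 * n * (d * f)
    l₂ = solve-∀
    l₃ : ∀ a b d c n f g → a * (b * (d * d)) * c * 2 * n * (f * g) ≡ a * c * 2 * f * b * (g * (n * (d * d)))
    l₃ = solve-∀

-- With c = p/q, the bound n^(2-c) is raised to the power q to avoid real exponents; positivity of q
-- makes c meaningful.
theorem2p1 : {N m : ℕ} (G : FinGroup N) (s : Fin m → Fin N) (M : Fin m → Fin m → ℕ) →
    IsCoxeterSystem G s M →
    (I J : Subset m) → suc ∣ I ∣ ≡ m → suc ∣ J ∣ ≡ m →
    {v : ℕ} (H : Graph v) (iso : CosetGraphIso G s I J H) →
    let t = CosetGraphIso.largerPart iso
        q = edges H ∸ t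
        p = v ∸ t ∸ 1
    in 0 < q →
    Σ ℕ λ C → Σ ℕ λ n₀ → (n : ℕ) → n₀ ≤ n → (K : Graph n) → ¬ ContainsSub K H →
      edges K ^ q * n ^ p ≤ C * n ^ (2 * q)
theorem2p1 {N} {m} G s M cox I J |I| |J| {v} H iso 0<q = suc C , 1 , bound
  where
  open CosetGraph G s M cox I J H iso using (structure; chambers≤; linked; adj-sound; largerPart≡; cosize-α; cosize-β)

  t q p : ℕ
  t = CosetGraphIso.largerPart iso
  q = edges H ∸ t
  p = v ∸ t ∸ 1

  t<edges : t < edges H
  t<edges = m∸n≢0⇒n<m (λ eq → <-irrefl (sym eq) 0<q)

  open Stars G s M cox structure (linked |I| |J| t<edges)

  #α≤t : #α ≤ t
  #α≤t = ≤-trans (m≤m⊔n #α #β) (≤-reflexive (sym largerPart≡))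

  #β≤t : #β ≤ t
  #β≤t = ≤-trans (m≤n⊔m #α #β) (≤-reflexive (sym largerPart≡))

  edges≡ : q + t ≡ edges H
  edges≡ = m∸n+n≡m (<⇒≤ t<edges)

  -- Both parts are nonempty. Hence the truncated subtractions in `p` are exact.
  t<v : t < v
  t<v = subst (_< v) (sym largerPart≡) (⊔-lub (subst (suc #α ≤_) #α+#β
      (subst (_≤ #α + #β) (+-comm #α 1) (+-monoʳ-≤ #α 0<#β)))
    (subst (suc #β ≤_) #α+#β (+-monoˡ-≤ #β 0<#α)))
    where
    0<#α : 0 < #α
    0<#α = ≤-trans (≤-reflexive (sym (cong ⟦_⟧ (isα-α e)))) (term≤∑ (λ u → ⟦ isα u ⟧) (α e))
    0<#β : 0 < #β
    0<#β = ≤-trans (≤-reflexive (sym (cong (⟦_⟧ ∘ not) (isα-β e)))) (term≤∑ (λ u → ⟦ not (isα u) ⟧) (β e))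

  vertices≡ : suc (p + t) ≡ v
  vertices≡ = trans (sym (+-suc p t)) (trans (cong (_+ suc t) p≡) (m∸n+n≡m t<v))
    where
    p≡ : p ≡ v ∸ suc t
    p≡ = trans (∸-+-assoc v t 1) (cong (v ∸_) (+-comm t 1))

  -- This says c <= 1, so hosts with degree sum at most n satisfy the bound trivially. It is the
  -- connectivity inequality v <= e + 1 with t + 1 taken off both sides.
  p≤q : p ≤ q
  p≤q = +-cancelʳ-≤ t p q (≤-pred (subst₂ _≤_ (sym vertices≡) (cong suc (sym edges≡)) (vertices≤edges+1 (edges H) chambers≤)))

  percolates : ∀ u u' → u ≢ u' → Percolates (both u u')
  percolates u u' ne = pair-percolates (proj₁ cosize-α′) (proj₁ cosize-β′) (proj₂ cosize-α′) (proj₂ cosize-β′)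
    (both u u') u u' ne (both-left u u') (both-right u u')
    where
    cosize-α′ = cosize-α |I|
    cosize-β′ = cosize-β |J|

  open Degenerate percolates using (constant; hom-bound)
  open Assembly q t p constant using (C; assemble)

  -- The additional 1 in `suc C` covers the sparse hosts; n >= 1 permits division by n.
  bound : ∀ n → 1 ≤ n → (K : Graph n) → ¬ ContainsSub K H → edges K ^ q * n ^ p ≤ suc C * n ^ (2 * q)
  bound n 1≤n K free = ≤-trans (*-monoˡ-≤ (n ^ p) (^-monoˡ-≤ q (edges≤degreeSum K))) (cases (≤-<-connex μ n))
    where
    instance
      n≢0 : NonZero n
      n≢0 = >-nonZero 1≤n
    μ = ∑ (allFin n) (λ x → # adj K x)
    -- Slightly above the average degree: μ <= Dn keeps the split graph at no more than 2n vertices,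
    -- while Dn <= 2μ holds as soon as n < μ.
    D = suc (μ / n)
    module Split = Splitting K D
    open Split using (finiteX; E; mass; card-lower; card-upper)
    n̂ = Finite.card finiteX
    instance
      n̂≢0 : NonZero n̂
      n̂≢0 = >-nonZero (≤-trans 1≤n card-lower)
    module Count = Collapses finiteX (finiteFin n) proj₁ E

    -- A homomorphism to the split graph whose projection is injective would be a copy of H in `K`.
    collision : ∀ φ → (∀ w → E (φ (α w)) (φ (β w)) ≡ true) →
      Σ (Fin v) λ u → Σ (Fin v) λ u' → u ≢ u' × proj₁ (φ u) ≡ proj₁ (φ u')
    collision φ edge with Fin.any? (λ u → Fin.any? (λ u' → ¬? (u Fin.≟ u') ×-dec (proj₁ (φ u) Fin.≟ proj₁ (φ u'))))
    ... | yes found = found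
    ... | no none = ⊥-elim (free (proj₁ ∘ φ , injective , homomorphism))
      where
      injective : ∀ a b → proj₁ (φ a) ≡ proj₁ (φ b) → a ≡ b
      injective a b eq with a Fin.≟ b
      ... | yes p = p
      ... | no ne = ⊥-elim (none (a , b , ne , eq))
      homomorphism : ∀ a b → adj H a b ≡ true → adj K (proj₁ (φ a)) (proj₁ (φ b)) ≡ true
      homomorphism a b ab with adj-sound a b ab
      ... | w , inj₁ (refl , refl) = Split.E⇒adj (φ (α w)) (φ (β w)) (edge w)
      ... | w , inj₂ (refl , refl) = trans (Graph.sym K _ _) (Split.E⇒adj (φ (α w)) (φ (β w)) (edge w))

    star-bound : ∀ {k} → k ≤ t → n̂ * D ^ k ≤ n̂ * D ^ t
    star-bound k≤t = *-monoʳ-≤ n̂ (^-monoʳ-≤ D k≤t)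

    upper : Count.hom ≤ constant * (n̂ * D ^ t)
    upper = hom-bound finiteX (finiteFin n) proj₁ E Split.loopless (n̂ * D ^ t)
      (λ U all → ≤-trans (star-α finiteX (finiteFin n) proj₁ E Split.E-sym Split.locally-injective D Split.degree U all) (star-bound #β≤t))
      (λ U all → ≤-trans (star-β finiteX (finiteFin n) proj₁ E Split.E-sym Split.locally-injective D Split.degree U all) (star-bound #α≤t))
      collision

    μ≤Dn : μ ≤ D * n
    μ≤Dn = ≤-trans (≤-reflexive (m≡m%n+[m/n]*n μ n)) (+-monoˡ-≤ (μ / n * n) (<⇒≤ (m%n<n μ n)))

    cases : (μ ≤ n) ⊎ (n < μ) → μ ^ q * n ^ p ≤ suc C * n ^ (2 * q)
    cases (inj₁ μ≤n) = ≤-trans (*-mono-≤ (^-monoˡ-≤ q μ≤n) (^-monoʳ-≤ n p≤q)) (≤-trans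
      (≤-reflexive (trans (sym (^-distribˡ-+-* n q q)) (cong (n ^_) (cong (q +_) (sym (+-identityʳ q))))))
      (m≤m+n (n ^ (2 * q)) (C * n ^ (2 * q))))
    cases (inj₂ n<μ) = ≤-trans (assemble μ n n̂ D Count.hom {{>-nonZero 0<μ}} card-lower (card-upper μ≤Dn) Dn≤2μ lower upper)
      (m≤n+m (C * n ^ (2 * q)) (n ^ (2 * q)))
      where
      0<μ : 0 < μ
      0<μ = ≤-trans (s≤s z≤n) n<μ
      Dn≤2μ : D * n ≤ 2 * μ
      Dn≤2μ = +-mono-≤ (<⇒≤ n<μ) (≤-trans (m/n*n≤m μ n) (≤-reflexive (sym (+-identityʳ μ))))
      lower : μ ^ (q + t) * n̂ ^ suc (p + t) ≤ n̂ ^ (2 * (q + t)) * Count.hom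
      lower = subst₂ (λ ε k → μ ^ ε * n̂ ^ k ≤ n̂ ^ (2 * ε) * Count.hom) (sym edges≡) (sym vertices≡)
        (≤-trans (*-monoˡ-≤ (n̂ ^ v) (^-monoˡ-≤ (edges H) mass))
          (Count.sidorenko (edges H) chambers≤ (≤-trans 0<μ mass)))
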